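{- Given $\beta>0$ and $\alpha\in\mathbb{R}\setminus\mathbb{Q}$, the sequence $\left(k^{\beta}\cdot\sin(2\pi k\alpha)\right)_{k\in\mathbb{N}}$ is dense in $\mathbb{R}$ if and only if at least one of the following holds: 1. $\mu_+(\alpha,\beta)=0$ and $\mu_-(\alpha,\beta)=0$; 2. $\mu_+(\alpha,\beta)=0$ and $\mu_+\left(\alpha,\beta,\frac12\right)=0$; 3. $\mu_-(\alpha,\beta)=0$ and $\mu_-\left(\alpha,\beta,\frac12\right)=0$.
   Context: For $x\in\mathbb{R}$, $\{x\}_2$ is the signed fractional part, the unique number in $[-\frac12,\frac12)$ with $x-\{x\}_2\in\mathbb{Z}$. For $\alpha\in\mathbb{R}\setminus\mathbb{Q}$, $\beta>0$, $\rho\in\mathbb{R}$ set $$\mu_+(\alpha,\beta,\rho)=\liminf_{k\to+\infty,\ \{k\alpha-\rho\}_2>0}k^\beta\{k\alpha-\rho\}_2,\qquad \mu_-(\alpha,\beta,\rho)=\liminf_{k\to+\infty,\ \{k\alpha-\rho\}_2<0}-k^\beta\{k\alpha-\rho\}_2 ,$$ where $k$ ranges over $\mathbb{N}=\{1,2,\dots\}$, and $\mu_\pm(\alpha,\beta)=\mu_\pm(\alpha,\beta,0)$. -}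

module Defs where

open import Level using (0ℓ)
open import Algebra.Bundles using (CommutativeRing; Semiring)
open import Algebra.Structures using (IsCommutativeRing)
open import Axiom.ExcludedMiddle using (ExcludedMiddle)
open import Data.Integer.Base using (ℤ; +_; -[1+_])
open import Data.Nat.Base as ℕ using (ℕ; zero; suc; _!)
open import Data.Product.Base using (∃; _×_; _,_; proj₁)
open import Data.Rational.Base using (ℚ; ↥_; ↧ₙ_)
open import Relation.Binary.Structures using (IsStrictTotalOrder)
import Algebra.Definitions.RawSemiring as RawSemiringDefinitions
import Relation.Binary.Construct.Add.Extrema.Equality as ExtremaEquality
import Relation.Binary.Construct.Add.Extrema.NonStrict as ExtremaOrder
import Relation.Binary.Construct.StrictToNonStrict as StrictToNonStrict
open import Relation.Nullary.Construct.Add.Extrema using (_±; ⊥±; ⊤±; [_])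
open import Relation.Nullary.Decidable.Core using (yes; no)
open import Relation.Nullary.Negation.Core using (¬_; contradiction)

-- The real numbers: a Dedekind-complete ordered field, which classically is
-- unique up to isomorphism.

record CompleteOrderedField : Set₁ where
  infix  4 _≈_ _<_
  infixl 6 _+_
  infixl 7 _*_
  infix  8 -_
  infix  9 _⁻¹
  field
    Carrier            : Set
    _≈_                : Carrier → Carrier → Set
    _<_                : Carrier → Carrier → Set
    _+_ _*_            : Carrier → Carrier → Carrier
    -_                 : Carrier → Carrier
    0# 1#              : Carrier
    _⁻¹                : Carrier → Carrier
    isCommutativeRing  : IsCommutativeRing _≈_ _+_ _*_ -_ 0# 1#
    0≉1                : ¬ 0# ≈ 1#
    -- The value of 0# ⁻¹ is unconstrained.
    *-inverseʳ         : ∀ x → ¬ x ≈ 0# → x * x ⁻¹ ≈ 1#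
    isStrictTotalOrder : IsStrictTotalOrder _≈_ _<_
    +-monoˡ-<          : ∀ z {x y} → x < y → x + z < y + z
    *-pos              : ∀ {x y} → 0# < x → 0# < y → 0# < x * y

  open StrictToNonStrict _≈_ _<_ public using (_≤_)

  UpperBound : (Carrier → Set) → Carrier → Set
  UpperBound P u = ∀ x → P x → x ≤ u

  field
    complete : (P : Carrier → Set) → ∃ P → ∃ (UpperBound P) →
               ∃ λ s → UpperBound P s × (∀ u → UpperBound P u → s ≤ u)

  commutativeRing : CommutativeRing 0ℓ 0ℓ
  commutativeRing = record { isCommutativeRing = isCommutativeRing }

  open CommutativeRing commutativeRing public using (_-_; semiring)
  open RawSemiringDefinitions (Semiring.rawSemiring semiring) public
    using (_^_) renaming (_×_ to _×ⁿ_)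

module Analysis (lem : ExcludedMiddle 0ℓ) (R : CompleteOrderedField) where

  open CompleteOrderedField R

  fromℕ : ℕ → Carrier
  fromℕ n = n ×ⁿ 1#

  fromℤ : ℤ → Carrier
  fromℤ (+ n)    = fromℕ n
  fromℤ -[1+ n ] = - fromℕ (suc n)

  fromℚ : ℚ → Carrier
  fromℚ q = fromℤ (↥ q) * fromℕ (↧ₙ q) ⁻¹

  Irrational : Carrier → Set
  Irrational x = ∀ q → ¬ x ≈ fromℚ q

  ½ : Carrier
  ½ = fromℕ 2 ⁻¹

  Dense : (Carrier → Set) → Set
  Dense S = ∀ a b → a < b → ∃ λ y → S y × a < y × y < b

  -- Definite description. Below it is applied to predicates that hold of
  -- exactly one real (up to ≈), except that ln needs a positive argument;
  -- 0# is only a default.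
  the : (Carrier → Set) → Carrier
  the P with lem {∃ P}
  ... | yes (x , _) = x
  ... | no  _       = 0#

  the-satisfies : ∀ P → ∃ P → P (the P)
  the-satisfies P e with lem {∃ P}
  ... | yes (_ , p) = p
  ... | no  ¬e      = contradiction e ¬e

  ConvergesTo : (ℕ → Carrier) → Carrier → Set
  ConvergesTo a l = ∀ ε → 0# < ε →
    ∃ λ N → ∀ n → N ℕ.≤ n → l - ε < a n × a n < l + ε

  partialSum : (ℕ → Carrier) → ℕ → Carrier
  partialSum a zero    = 0#
  partialSum a (suc n) = partialSum a n + a n

  ∑∞ : (ℕ → Carrier) → Carrier
  ∑∞ a = the (ConvergesTo (partialSum a))

  exp : Carrier → Carrier
  exp x = ∑∞ λ n → x ^ n * fromℕ (n !) ⁻¹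

  sin : Carrier → Carrier
  sin x = ∑∞ λ n → let m = 2 ℕ.* n ℕ.+ 1 in (- 1#) ^ n * (x ^ m * fromℕ (m !) ⁻¹)

  -- The least positive zero of sin.
  π : Carrier
  π = the λ p → 0# < p × sin p ≈ 0# × (∀ x → 0# < x → sin x ≈ 0# → p ≤ x)

  ln : Carrier → Carrier
  ln x = the λ y → exp y ≈ x

  -- Real powers of positive reals.
  infixr 8 _^ʳ_
  _^ʳ_ : Carrier → Carrier → Carrier
  x ^ʳ y = exp (y * ln x)

  -- The signed fractional part.
  ⟨_⟩₂ : Carrier → Carrier
  ⟨ x ⟩₂ = the λ y → - ½ ≤ y × y < ½ × ∃ λ z → x - y ≈ fromℤ z

  -- ⊥± and ⊤± are -∞ and +∞.
  open ExtremaEquality _≈_ public using (_≈±_)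
  open ExtremaOrder _≤_ public using (_≤±_; [≤]-injective)

  sup± : (Carrier ± → Set) → Carrier ±
  sup± P with lem {∃ λ u → ∀ x → P x → x ≤± [ u ]}
  ... | no  _       = ⊤±
  ... | yes (u , b) with lem {∃ λ x → P [ x ]}
  ...   | no  _ = ⊥±
  ...   | yes e = [ proj₁ (complete (λ x → P [ x ]) e (u , λ x p → [≤]-injective (b [ x ] p))) ]

  inf± : (Carrier ± → Set) → Carrier ±
  inf± P = sup± λ l → ∀ x → P x → l ≤± x

  -- Limit inferior of f k as k → +∞ through the k ≥ 1 satisfying A.
  liminf : (A : ℕ → Set) (f : ℕ → Carrier) → Carrier ±
  liminf A f = sup± λ y → ∃ λ n → y ≈± inf± (tail n)
    where
    tail : ℕ → Carrier ± → Set
    tail n x = ∃ λ k → 1 ℕ.≤ k × n ℕ.≤ k × A k × x ≈± [ f k ]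

  μ₊ μ₋ : (α β ρ : Carrier) → Carrier ±
  μ₊ α β ρ = liminf (λ k → 0# < ⟨ fromℕ k * α - ρ ⟩₂)
                    (λ k → fromℕ k ^ʳ β * ⟨ fromℕ k * α - ρ ⟩₂)
  μ₋ α β ρ = liminf (λ k → ⟨ fromℕ k * α - ρ ⟩₂ < 0#)
                    (λ k → - (fromℕ k ^ʳ β * ⟨ fromℕ k * α - ρ ⟩₂))

  0± : Carrier ±
  0± = [ 0# ]

{-# OPTIONS --safe #-}

-- Write kα − ρ = u modulo 1 with ρ ∈ {0, ½} and |u| ≤ ¼; then sin(2πkα) = ± sin(2πu), so k^β sin(2πkα) is small
-- of a prescribed sign precisely when k^β |u| is small, with ρ and the side of u compatible with that sign. Density
-- near 0 from both sides therefore yields μ₊(0) = 0 or μ₋(½) = 0, and μ₋(0) = 0 or μ₊(½) = 0; doubling k turns an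
-- approximation of ½ into one of 0 on the same side, which leaves exactly the three alternatives.
-- Conversely, if k^β |u| is tiny then the odd multiples m k give the values ± m^(β+1) · 2π k^β |u| up to a factor
-- close to 1, and (m + 2)^(β+1) / m^(β+1) → 1, so these values meet every interval of a half-line.
-- The addition theorems for exp, sin and cos come from Mertens' theorem on Cauchy products applied to xⁿ/n!
-- multiplied by the real and imaginary parts of iⁿ; π is located by a zero of cos in (0, 2].

module Submission where

open import Defs
open import Level using (0ℓ)
open import Algebra.Bundles using (CommutativeRing)
open import Algebra.Solver.Ring.AlmostCommutativeRing using (fromCommutativeRing; _-Raw-AlmostCommutative⟶_; Induced-equivalence)
open import Axiom.ExcludedMiddle using (ExcludedMiddle)
open import Data.Integer.Base as ℤ using (ℤ; +_; -[1+_]; _⊖_)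
open import Data.Integer.Properties as ℤ using ([1+m]⊖[1+n]≡m⊖n)
open import Data.Maybe.Base using (just; nothing)
open import Data.Nat.Base as ℕ using (ℕ; zero; suc; z≤n; s≤s; _!)
open import Data.Nat.Properties as ℕ using ()
open import Data.Product.Base using (∃; _×_; _,_; proj₁; proj₂; uncurry)
open import Data.Sum.Base using (_⊎_; inj₁; inj₂; [_,_]′)
open import Function.Base using (_∘_; case_of_)
open import Function.Bundles using (_⇔_; mk⇔)
open import Relation.Binary.Bundles using (StrictPartialOrder)
open import Relation.Binary.Definitions using (WeaklyDecidable; tri<; tri≈; tri>)
open import Relation.Binary.PropositionalEquality as ≡ using (_≡_)
open import Relation.Binary.Structures using (IsStrictTotalOrder)
open import Relation.Nullary.Construct.Add.Extrema using (_±; ⊥±; ⊤±; [_])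
open import Relation.Nullary.Decidable.Core using (Dec; yes; no)
open import Relation.Nullary.Negation.Core using (¬_; contradiction)
import Algebra.Properties.Ring as RingProperties
import Algebra.Properties.Semiring.Exp as SemiringExp
import Algebra.Properties.Semiring.Mult as UnoptimisedMult
import Algebra.Properties.Semiring.Mult.TCOptimised as SemiringMult
import Algebra.Solver.Ring as RingSolver
import Relation.Binary.Construct.StrictToNonStrict as StrictToNonStrict
import Relation.Binary.Reasoning.Setoid as SetoidReasoning
import Relation.Binary.Reasoning.StrictPartialOrder as StrictReasoning
import Relation.Binary.Construct.Add.Extrema.Equality as ExtremaEquality
import Relation.Binary.Construct.Add.Extrema.NonStrict as ExtremaOrder

-- Signs are tracked multiplicatively: ρ contributes σ, equal to 1 at 0 and to -1 at ½, the side of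
-- u contributes s, and the resulting small values have the sign σ s. Density needs both signs, so
-- each alternative pairs two approximations with opposite products. Odd multipliers are forced at
-- ½, since an even multiple of ½ is an integer. The delicate point of the sweep is that sin y must
-- stay close to y at the multiple finally reached, whose size is not known beforehand. Choosing k
-- with k^β at least b/δ settles this in advance: whatever the multiplier m, a product (mk)^β y
-- below b has y at most δ. In the other direction density yields one index for each interval,
-- possibly an early one. Asking for a value smaller than all positive values at indices below n
-- pushes the index to n or beyond. Each such index is near 0 or near ½, and a classical case
-- distinction extracts a residue that recurs. Since `exp`, `sin`, `ln` and `π` are descriptions,
-- each becomes usable only once an object of the described kind has been exhibited.

-- Ring normalisation with integer coefficients

module IntegerRingSolver {c ℓ} (𝓡 : CommutativeRing c ℓ) where

  open CommutativeRing 𝓡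
  open RingProperties ring using (-‿involutive; -‿+-comm; -0#≈0#; -‿distribˡ-*; -‿distribʳ-*)
  open SetoidReasoning setoid
  private
    module Mult = SemiringMult semiring
    open Mult using () renaming (_×_ to _×′_)

  -- The optimised multiple makes `1 ×′ 1#` reduce to `1#`, so the coefficient 1 denotes `1#`
  -- definitionally.
  ⟦_⟧ℤ : ℤ → Carrier
  ⟦ + n ⟧ℤ      = n ×′ 1#
  ⟦ -[1+ n ] ⟧ℤ = - (suc n ×′ 1#)

  ⊖-homo : ∀ m n → ⟦ m ⊖ n ⟧ℤ ≈ m ×′ 1# - n ×′ 1#
  ⊖-homo m zero = begin
    m ×′ 1#         ≈⟨ +-identityʳ _ ⟨
    m ×′ 1# + 0#    ≈⟨ +-congˡ -0#≈0# ⟨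
    m ×′ 1# - 0#    ∎
  ⊖-homo zero (suc n) = sym (+-identityˡ _)
  ⊖-homo (suc m) (suc n) = begin
    ⟦ suc m ⊖ suc n ⟧ℤ                    ≡⟨ ≡.cong ⟦_⟧ℤ ([1+m]⊖[1+n]≡m⊖n m n) ⟩
    ⟦ m ⊖ n ⟧ℤ                            ≈⟨ ⊖-homo m n ⟩
    m ×′ 1# - n ×′ 1#                     ≈⟨ cancel 1# (m ×′ 1#) (n ×′ 1#) ⟨
    (1# + m ×′ 1#) - (1# + n ×′ 1#)       ≈⟨ +-cong (Mult.1+× m 1#) (-‿cong (Mult.1+× n 1#)) ⟨
    suc m ×′ 1# - suc n ×′ 1#             ∎
    where
    cancel : ∀ a x y → (a + x) - (a + y) ≈ x - y
    cancel a x y = begin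
      (a + x) - (a + y)       ≈⟨ +-cong (+-comm a x) (sym (-‿+-comm a y)) ⟩
      (x + a) + (- a + - y)   ≈⟨ +-assoc x a _ ⟩
      x + (a + (- a + - y))   ≈⟨ +-congˡ (+-assoc a (- a) (- y)) ⟨
      x + ((a - a) - y)       ≈⟨ +-congˡ (+-congʳ (-‿inverseʳ a)) ⟩
      x + (0# - y)            ≈⟨ +-congˡ (+-identityˡ _) ⟩
      x - y                   ∎

  neg-homo : ∀ i → ⟦ ℤ.- i ⟧ℤ ≈ - ⟦ i ⟧ℤ
  neg-homo (+ zero)   = sym -0#≈0#
  neg-homo (+ suc n)  = refl
  neg-homo -[1+ n ]   = sym (-‿involutive _)

  +-homo : ∀ i j → ⟦ i ℤ.+ j ⟧ℤ ≈ ⟦ i ⟧ℤ + ⟦ j ⟧ℤ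
  +-homo (+ m)    (+ n)    = Mult.×-homo-+ 1# m n
  +-homo (+ m)    -[1+ n ] = ⊖-homo m (suc n)
  +-homo -[1+ m ] (+ n)    = trans (⊖-homo n (suc m)) (+-comm _ _)
  +-homo -[1+ m ] -[1+ n ] = begin
    - (suc (suc (m ℕ.+ n)) ×′ 1#)        ≡⟨ ≡.cong (λ k → - (suc k ×′ 1#)) (ℕ.+-suc m n) ⟨
    - ((suc m ℕ.+ suc n) ×′ 1#)          ≈⟨ -‿cong (Mult.×-homo-+ 1# (suc m) (suc n)) ⟩
    - (suc m ×′ 1# + suc n ×′ 1#)        ≈⟨ -‿+-comm _ _ ⟨
    - (suc m ×′ 1#) - (suc n ×′ 1#)      ∎

  +*-homo : ∀ m j → ⟦ + m ℤ.* j ⟧ℤ ≈ m ×′ 1# * ⟦ j ⟧ℤ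
  +*-homo m (+ n)    = begin
    ⟦ + m ℤ.* + n ⟧ℤ       ≡⟨ ≡.cong ⟦_⟧ℤ (ℤ.pos-* m n) ⟨
    (m ℕ.* n) ×′ 1#        ≈⟨ Mult.×1-homo-* m n ⟩
    m ×′ 1# * n ×′ 1#      ∎
  +*-homo m -[1+ n ] = begin
    ⟦ + m ℤ.* ℤ.- + suc n ⟧ℤ         ≡⟨ ≡.cong ⟦_⟧ℤ (ℤ.neg-distribʳ-* (+ m) (+ suc n)) ⟨
    ⟦ ℤ.- (+ m ℤ.* + suc n) ⟧ℤ       ≈⟨ neg-homo (+ m ℤ.* + suc n) ⟩
    - ⟦ + m ℤ.* + suc n ⟧ℤ           ≈⟨ -‿cong (+*-homo m (+ suc n)) ⟩
    - (m ×′ 1# * suc n ×′ 1#)        ≈⟨ -‿distribʳ-* _ _ ⟩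
    m ×′ 1# * - (suc n ×′ 1#)        ∎
  *-homo : ∀ i j → ⟦ i ℤ.* j ⟧ℤ ≈ ⟦ i ⟧ℤ * ⟦ j ⟧ℤ
  *-homo (+ m)    j = +*-homo m j
  *-homo -[1+ m ] j = begin
    ⟦ ℤ.- + suc m ℤ.* j ⟧ℤ          ≡⟨ ≡.cong ⟦_⟧ℤ (ℤ.neg-distribˡ-* (+ suc m) j) ⟨
    ⟦ ℤ.- (+ suc m ℤ.* j) ⟧ℤ        ≈⟨ neg-homo (+ suc m ℤ.* j) ⟩
    - ⟦ + suc m ℤ.* j ⟧ℤ            ≈⟨ -‿cong (+*-homo (suc m) j) ⟩
    - (suc m ×′ 1# * ⟦ j ⟧ℤ)        ≈⟨ -‿distribˡ-* _ _ ⟩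
    - (suc m ×′ 1#) * ⟦ j ⟧ℤ        ∎

  ℤ-morphism : ℤ.+-*-rawRing -Raw-AlmostCommutative⟶ fromCommutativeRing 𝓡
  ℤ-morphism = record
    { ⟦_⟧ = ⟦_⟧ℤ ; +-homo = +-homo ; *-homo = *-homo ; -‿homo = neg-homo
    ; 0-homo = refl ; 1-homo = refl }

  _coeff≟_ : WeaklyDecidable (Induced-equivalence ℤ-morphism)
  i coeff≟ j with i ℤ.≟ j
  ... | yes i≡j = just (reflexive (≡.cong ⟦_⟧ℤ i≡j))
  ... | no  _   = nothing

  private
    module Solver = RingSolver ℤ.+-*-rawRing (fromCommutativeRing 𝓡) ℤ-morphism _coeff≟_
  open Solver public using (solve; _:=_; _:+_; _:*_; _:-_; :-_; con)

  -- Evaluates to n × 1# on the nose, so that numerals are recognised.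
  lit : ∀ {m} → ℕ → Solver.Polynomial m
  lit zero    = con (+ 0)
  lit (suc n) = con (+ 1) :+ lit n

-- Ordered field arithmetic and the Archimedean property

module OrderedField (lem : ExcludedMiddle 0ℓ) (R : CompleteOrderedField) where

  open CompleteOrderedField R public
  open Analysis lem R public
  open CommutativeRing commutativeRing public
    using ( +-cong; +-congˡ; +-congʳ; *-cong; *-congˡ; *-congʳ; -‿cong
          ; +-identityˡ; +-identityʳ; *-identityˡ; *-identityʳ; zeroˡ; zeroʳ; +-comm; *-comm )
    renaming (refl to ≈-refl; sym to ≈-sym; trans to ≈-trans; reflexive to ≈-reflexive)
  open IntegerRingSolver commutativeRing public
  open IsStrictTotalOrder isStrictTotalOrder public
    using (compare; isStrictPartialOrder; isEquivalence; <-resp-≈)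
    renaming (trans to <-trans; irrefl to <-irrefl)

  strictPartialOrder : StrictPartialOrder _ _ _
  strictPartialOrder = record { isStrictPartialOrder = isStrictPartialOrder }

  module ≤-Reasoning = StrictReasoning strictPartialOrder
  open ≤-Reasoning

  private module NonStrict = StrictToNonStrict _≈_ _<_

  ≤-refl : ∀ {x} → x ≤ x
  ≤-refl = inj₂ ≈-refl

  ≤-trans : ∀ {x y z} → x ≤ y → y ≤ z → x ≤ z
  ≤-trans = NonStrict.trans isEquivalence <-resp-≈ <-trans

  ≤-antisym : ∀ {x y} → x ≤ y → y ≤ x → x ≈ y
  ≤-antisym = NonStrict.antisym isEquivalence <-trans <-irrefl

  <-≤-trans : ∀ {x y z} → x < y → y ≤ z → x < z
  <-≤-trans = NonStrict.<-≤-trans <-trans (proj₁ <-resp-≈)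

  ≤-<-trans : ∀ {x y z} → x ≤ y → y < z → x < z
  ≤-<-trans = NonStrict.≤-<-trans ≈-sym <-trans (proj₂ <-resp-≈)

  <⇒≤ : ∀ {x y} → x < y → x ≤ y
  <⇒≤ = inj₁

  ≤⇒≯ : ∀ {x y} → x ≤ y → ¬ y < x
  ≤⇒≯ x≤y y<x = <-irrefl ≈-refl (≤-<-trans x≤y y<x)

  ≮⇒≥ : ∀ {x y} → ¬ x < y → y ≤ x
  ≮⇒≥ {x} {y} x≮y with compare x y
  ... | tri< x<y _ _ = contradiction x<y x≮y
  ... | tri≈ _ x≈y _ = inj₂ (≈-sym x≈y)
  ... | tri> _ _ y<x = inj₁ y<x

  <-≤-total : ∀ x y → x < y ⊎ y ≤ x
  <-≤-total x y with compare x y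
  ... | tri< x<y _ _ = inj₁ x<y
  ... | tri≈ _ x≈y _ = inj₂ (inj₂ (≈-sym x≈y))
  ... | tri> _ _ y<x = inj₂ (inj₁ y<x)

  ≤-total : ∀ x y → x ≤ y ⊎ y ≤ x
  ≤-total x y with <-≤-total x y
  ... | inj₁ x<y = inj₁ (inj₁ x<y)
  ... | inj₂ y≤x = inj₂ y≤x

  >⇒≉0 : ∀ {x} → 0# < x → ¬ x ≈ 0#
  >⇒≉0 0<x x≈0 = <-irrefl (≈-sym x≈0) 0<x

  +-monoˡ-≤ : ∀ z {x y} → x ≤ y → x + z ≤ y + z
  +-monoˡ-≤ z (inj₁ x<y) = inj₁ (+-monoˡ-< z x<y)
  +-monoˡ-≤ z (inj₂ x≈y) = inj₂ (+-congʳ x≈y)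

  -- An inequality a ≤ b reduces to x ≤ y as soon as b − a = y − x; the ring
  -- solver discharges that equation, with all terms moved to avoid subtraction.
  by-≤ : ∀ {a b x y} → x ≤ y → b + x ≈ a + y → a ≤ b
  by-≤ {a} {b} {x} {y} x≤y eq = begin
    a            ≈⟨ (solve 2 (λ x0 x1 → x0 := x0 :+ x1 :- x1) ≈-refl a y) ⟩
    (a + y) - y  ≈⟨ +-congʳ (≈-sym eq) ⟩
    (b + x) - y  ≈⟨ (solve 3 (λ x0 x1 x2 → x0 :+ x1 :- x2 := x1 :+ (x0 :- x2)) ≈-refl b x y) ⟩
    x + (b - y)  ≤⟨ +-monoˡ-≤ (b - y) x≤y ⟩
    y + (b - y)  ≈⟨ (solve 2 (λ x0 x1 → x0 :+ (x1 :- x0) := x1) ≈-refl y b) ⟩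
    b            ∎

  by-< : ∀ {a b x y} → x < y → b + x ≈ a + y → a < b
  by-< {a} {b} {x} {y} x<y eq = begin-strict
    a            ≈⟨ (solve 2 (λ x0 x1 → x0 := x0 :+ x1 :- x1) ≈-refl a y) ⟩
    (a + y) - y  ≈⟨ +-congʳ (≈-sym eq) ⟩
    (b + x) - y  ≈⟨ (solve 3 (λ x0 x1 x2 → x0 :+ x1 :- x2 := x1 :+ (x0 :- x2)) ≈-refl b x y) ⟩
    x + (b - y)  <⟨ +-monoˡ-< (b - y) x<y ⟩
    y + (b - y)  ≈⟨ (solve 2 (λ x0 x1 → x0 :+ (x1 :- x0) := x1) ≈-refl y b) ⟩
    b            ∎

  by-≈ : ∀ {a b x y} → x ≈ y → b + x ≈ a + y → a ≈ b
  by-≈ {a} {b} {x} {y} x≈y eq = begin-equality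
    a            ≈⟨ (solve 2 (λ x0 x1 → x0 := x0 :+ x1 :- x1) ≈-refl a y) ⟩
    (a + y) - y  ≈⟨ +-cong (≈-sym eq) (-‿cong (≈-sym x≈y)) ⟩
    (b + x) - x  ≈⟨ (solve 2 (λ x0 x1 → x0 :+ x1 :- x1 := x0) ≈-refl b x) ⟩
    b            ∎

  infixl 6 _+-≤_ _+-<_ _+-≤<_ _+-<≤_

  _+-≤_ : ∀ {a b c d} → a ≤ b → c ≤ d → a + c ≤ b + d
  _+-≤_ {a} {b} {c} {d} a≤b c≤d =
    ≤-trans (+-monoˡ-≤ c a≤b) (by-≤ c≤d (solve 3 (λ x0 x1 x2 → x0 :+ x1 :+ x2 := x0 :+ x2 :+ x1) ≈-refl b d c))

  _+-<≤_ : ∀ {a b c d} → a < b → c ≤ d → a + c < b + d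
  _+-<≤_ {a} {b} {c} {d} a<b c≤d =
    <-≤-trans (+-monoˡ-< c a<b) (by-≤ c≤d (solve 3 (λ x0 x1 x2 → x0 :+ x1 :+ x2 := x0 :+ x2 :+ x1) ≈-refl b d c))

  _+-≤<_ : ∀ {a b c d} → a ≤ b → c < d → a + c < b + d
  _+-≤<_ {a} {b} {c} {d} a≤b c<d =
    ≤-<-trans (+-monoˡ-≤ c a≤b) (by-< c<d (solve 3 (λ x0 x1 x2 → x0 :+ x1 :+ x2 := x0 :+ x2 :+ x1) ≈-refl b d c))

  _+-<_ : ∀ {a b c d} → a < b → c < d → a + c < b + d
  a<b +-< c<d = a<b +-<≤ <⇒≤ c<d

  neg-≤ : ∀ {x y} → x ≤ y → - y ≤ - x
  neg-≤ {x} {y} x≤y = by-≤ x≤y (solve 2 (λ x0 x1 → (:- x0) :+ x0 := (:- x1) :+ x1) ≈-refl x y)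

  neg-< : ∀ {x y} → x < y → - y < - x
  neg-< {x} {y} x<y = by-< x<y (solve 2 (λ x0 x1 → (:- x0) :+ x0 := (:- x1) :+ x1) ≈-refl x y)

  0≤y-x : ∀ {x y} → x ≤ y → 0# ≤ y - x
  0≤y-x {x} {y} x≤y = by-≤ x≤y (solve 2 (λ x0 x1 → x0 :- x1 :+ x1 := con (+ 0) :+ x0) ≈-refl y x)

  0<y-x : ∀ {x y} → x < y → 0# < y - x
  0<y-x {x} {y} x<y = by-< x<y (solve 2 (λ x0 x1 → x0 :- x1 :+ x1 := con (+ 0) :+ x0) ≈-refl y x)

  *-nonneg : ∀ {x y} → 0# ≤ x → 0# ≤ y → 0# ≤ x * y
  *-nonneg {x} {y} (inj₁ 0<x) (inj₁ 0<y) = inj₁ (*-pos 0<x 0<y)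
  *-nonneg {x} {y} (inj₂ 0≈x) _ = inj₂ (≈-sym (≈-trans (*-congʳ (≈-sym 0≈x)) (zeroˡ y)))
  *-nonneg {x} {y} (inj₁ _) (inj₂ 0≈y) = inj₂ (≈-sym (≈-trans (*-congˡ (≈-sym 0≈y)) (zeroʳ x)))

  *-monoˡ-≤ : ∀ {z x y} → 0# ≤ z → x ≤ y → x * z ≤ y * z
  *-monoˡ-≤ {z} {x} {y} 0≤z x≤y = by-≤ (*-nonneg (0≤y-x x≤y) 0≤z) (solve 3 (λ x0 x1 x2 → x0 :* x1 :+ con (+ 0) := x2 :* x1 :+ (x0 :- x2) :* x1)
          ≈-refl y z x)

  *-monoʳ-≤ : ∀ {z x y} → 0# ≤ z → x ≤ y → z * x ≤ z * y
  *-monoʳ-≤ {z} {x} {y} 0≤z x≤y = by-≤ (*-nonneg 0≤z (0≤y-x x≤y)) (solve 3 (λ x0 x1 x2 → x0 :* x1 :+ con (+ 0) := x0 :* x2 :+ x0 :* (x1 :- x2))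
          ≈-refl z y x)

  *-monoˡ-< : ∀ {z x y} → 0# < z → x < y → x * z < y * z
  *-monoˡ-< {z} {x} {y} 0<z x<y = by-< (*-pos (0<y-x x<y) 0<z) (solve 3 (λ x0 x1 x2 → x0 :* x1 :+ con (+ 0) := x2 :* x1 :+ (x0 :- x2) :* x1)
          ≈-refl y z x)

  *-monoʳ-< : ∀ {z x y} → 0# < z → x < y → z * x < z * y
  *-monoʳ-< {z} {x} {y} 0<z x<y = by-< (*-pos 0<z (0<y-x x<y)) (solve 3 (λ x0 x1 x2 → x0 :* x1 :+ con (+ 0) := x0 :* x2 :+ x0 :* (x1 :- x2))
          ≈-refl z y x)

  *-mono-≤ : ∀ {x y u v} → 0# ≤ x → 0# ≤ u → x ≤ y → u ≤ v → x * u ≤ y * v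
  *-mono-≤ 0≤x 0≤u x≤y u≤v = ≤-trans (*-monoˡ-≤ 0≤u x≤y) (*-monoʳ-≤ (≤-trans 0≤x x≤y) u≤v)

  *-cancelʳ-< : ∀ {z x y} → 0# ≤ z → x * z < y * z → x < y
  *-cancelʳ-< {z} {x} {y} 0≤z xz<yz with <-≤-total x y
  ... | inj₁ x<y = x<y
  ... | inj₂ y≤x = contradiction xz<yz (≤⇒≯ (*-monoˡ-≤ 0≤z y≤x))

  *-cancelʳ-≤ : ∀ {z x y} → 0# < z → x * z ≤ y * z → x ≤ y
  *-cancelʳ-≤ {z} {x} {y} 0<z xz≤yz with <-≤-total y x
  ... | inj₁ y<x = contradiction (*-monoˡ-< 0<z y<x) (≤⇒≯ xz≤yz)
  ... | inj₂ x≤y = x≤y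

  square-nonneg : ∀ x → 0# ≤ x * x
  square-nonneg x with ≤-total 0# x
  ... | inj₁ 0≤x = *-nonneg 0≤x 0≤x
  ... | inj₂ x≤0 = ≤-trans (*-nonneg (0≤y-x x≤0) (0≤y-x x≤0)) (inj₂ (solve 1 (λ x0 → (con (+ 0) :- x0) :* (con (+ 0) :- x0) := x0 :* x0)
          ≈-refl x))

  -- As a square, 1 is nonnegative, and `0≉1` excludes equality.
  0<1 : 0# < 1#
  0<1 with square-nonneg 1#
  ... | inj₁ 0<1*1 = <-≤-trans 0<1*1 (inj₂ (solve 0 (con (+ 1) :* con (+ 1) := con (+ 1)) ≈-refl))
  ... | inj₂ 0≈1*1 = contradiction (≈-trans 0≈1*1 (solve 0 (con (+ 1) :* con (+ 1) := con (+ 1)) ≈-refl)) 0≉1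

  0≤1 : 0# ≤ 1#
  0≤1 = <⇒≤ 0<1

  0<+ : ∀ {x y} → 0# < x → 0# < y → 0# < x + y
  0<+ {x} {y} 0<x 0<y = by-< (0<x +-< 0<y) (solve 2 (λ x0 x1 → x0 :+ x1 :+ (con (+ 0) :+ con (+ 0)) := con (+ 0) :+ (x0 :+ x1))
          ≈-refl x y)

  0≤+ : ∀ {x y} → 0# ≤ x → 0# ≤ y → 0# ≤ x + y
  0≤+ {x} {y} 0≤x 0≤y = by-≤ (0≤x +-≤ 0≤y) (solve 2 (λ x0 x1 → x0 :+ x1 :+ (con (+ 0) :+ con (+ 0)) := con (+ 0) :+ (x0 :+ x1))
          ≈-refl x y)

  -- Serves estimates that are first obtained for twice the quantity, as a sum of two nonnegative
  -- terms.
  x+x≥0⇒x≥0 : ∀ {x} → 0# ≤ x + x → 0# ≤ x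
  x+x≥0⇒x≥0 {x} h with <-≤-total x 0#
  ... | inj₂ 0≤x = 0≤x
  ... | inj₁ x<0 = contradiction (x<0 +-< x<0) (≤⇒≯ (≤-trans (inj₂ (+-identityˡ 0#)) h))

  0<2 : 0# < fromℕ 2
  0<2 = <-≤-trans (0<+ 0<1 0<1) (inj₂ (solve 0 (con (+ 1) :+ con (+ 1) := lit 2) ≈-refl))

  ⁻¹-pos : ∀ {x} → 0# < x → 0# < x ⁻¹
  ⁻¹-pos {x} 0<x = *-cancelʳ-< (<⇒≤ 0<x) (begin-strict
    0# * x    ≈⟨ zeroˡ x ⟩
    0#        <⟨ 0<1 ⟩
    1#        ≈⟨ *-inverseʳ x (>⇒≉0 0<x) ⟨
    x * x ⁻¹  ≈⟨ *-comm x (x ⁻¹) ⟩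
    x ⁻¹ * x  ∎)

  *-inverse-pos : ∀ {x} → 0# < x → x * x ⁻¹ ≈ 1#
  *-inverse-pos 0<x = *-inverseʳ _ (>⇒≉0 0<x)

  *-cancelˡ-≈ : ∀ {z x y} → 0# < z → z * x ≈ z * y → x ≈ y
  *-cancelˡ-≈ {z} {x} {y} 0<z eq = begin-equality
    x                ≈⟨ *-identityˡ x ⟨
    1# * x           ≈⟨ *-congʳ (*-inverse-pos 0<z) ⟨
    (z * z ⁻¹) * x   ≈⟨ (solve 3 (λ x0 x1 x2 → x0 :* x1 :* x2 := x1 :* (x0 :* x2)) ≈-refl z (z ⁻¹) x) ⟩
    z ⁻¹ * (z * x)   ≈⟨ *-congˡ eq ⟩
    z ⁻¹ * (z * y)   ≈⟨ (solve 3 (λ x0 x1 x2 → x0 :* (x1 :* x2) := x1 :* x0 :* x2) ≈-refl (z ⁻¹) z y) ⟩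
    (z * z ⁻¹) * y   ≈⟨ *-congʳ (*-inverse-pos 0<z) ⟩
    1# * y           ≈⟨ *-identityˡ y ⟩
    y                ∎

  ½+½≈1 : ½ + ½ ≈ 1#
  ½+½≈1 = ≈-trans (solve 1 (λ x0 → x0 :+ x0 := lit 2 :* x0) ≈-refl ½) (*-inverse-pos 0<2)

  0<½ : 0# < ½
  0<½ = ⁻¹-pos 0<2

  half : ∀ x → ½ * x + ½ * x ≈ x
  half x = ≈-trans (solve 2 (λ x0 x1 → x0 :* x1 :+ x0 :* x1 := (x0 :+ x0) :* x1)
          ≈-refl ½ x) (≈-trans (*-congʳ ½+½≈1) (*-identityˡ x))

  0<half : ∀ {x} → 0# < x → 0# < ½ * x
  0<half = *-pos 0<½

  -- If y were below x, half the gap taken as ε would refute the hypothesis.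
  ≤-all-ε : ∀ {x y} → (∀ ε → 0# < ε → x ≤ y + ε) → x ≤ y
  ≤-all-ε {x} {y} h = ≮⇒≥ λ y<x → let d = x - y in
    ≤⇒≯ (h (½ * d) (0<half (0<y-x y<x)))
      (by-< (0<half (0<y-x y<x)) (≈-trans (+-identityʳ x) (≈-trans (solve 2 (λ x0 x1 → x0 := x1 :+ (x0 :- x1))
              ≈-refl x y)
        (≈-trans (+-congˡ (≈-sym (half d))) (solve 3 (λ x0 x1 x2 → x0 :+ (x1 :* x2 :+ x1 :* x2) := x0 :+ x1 :* x2 :+ x1 :* x2)
                ≈-refl y ½ d)))))

  private module Mult = UnoptimisedMult semiring

  fromℕ-+ : ∀ m n → fromℕ (m ℕ.+ n) ≈ fromℕ m + fromℕ n
  fromℕ-+ = Mult.×-homo-+ 1#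

  fromℕ-* : ∀ m n → fromℕ (m ℕ.* n) ≈ fromℕ m * fromℕ n
  fromℕ-* = Mult.×1-homo-*

  0≤fromℕ : ∀ n → 0# ≤ fromℕ n
  0≤fromℕ zero    = ≤-refl
  0≤fromℕ (suc n) = 0≤+ 0≤1 (0≤fromℕ n)

  1≤fromℕ-suc : ∀ n → 1# ≤ fromℕ (suc n)
  1≤fromℕ-suc n = by-≤ (0≤fromℕ n) (+-identityʳ _)

  0<fromℕ-suc : ∀ n → 0# < fromℕ (suc n)
  0<fromℕ-suc n = <-≤-trans 0<1 (1≤fromℕ-suc n)

  1≤fromℕ : ∀ {n} → 1 ℕ.≤ n → 1# ≤ fromℕ n
  1≤fromℕ (s≤s {n = n} _) = 1≤fromℕ-suc n

  0<fromℕ : ∀ {n} → 1 ℕ.≤ n → 0# < fromℕ n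
  0<fromℕ 1≤n = <-≤-trans 0<1 (1≤fromℕ 1≤n)

  fromℕ-mono-≤ : ∀ {m n} → m ℕ.≤ n → fromℕ m ≤ fromℕ n
  fromℕ-mono-≤ {n = n} z≤n = 0≤fromℕ n
  fromℕ-mono-≤ (s≤s {m} {n} m≤n) = ≤-refl +-≤ fromℕ-mono-≤ m≤n

  -- Transfers the homomorphism laws of the solver's interpretation of integers to `fromℤ`, which is
  -- built on the unoptimised multiples.
  fromℤ≈⟦⟧ : ∀ i → fromℤ i ≈ ⟦ i ⟧ℤ
  fromℤ≈⟦⟧ (+ n)    = ×ᵤ≈× n 1#
    where open SemiringMult semiring using (×ᵤ≈×)
  fromℤ≈⟦⟧ -[1+ n ] = -‿cong (fromℤ≈⟦⟧ (+ suc n))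

  fromℤ-+ : ∀ i j → fromℤ (i ℤ.+ j) ≈ fromℤ i + fromℤ j
  fromℤ-+ i j = ≈-trans (fromℤ≈⟦⟧ (i ℤ.+ j))
    (≈-trans (+-homo i j) (+-cong (≈-sym (fromℤ≈⟦⟧ i)) (≈-sym (fromℤ≈⟦⟧ j))))

  fromℤ-* : ∀ i j → fromℤ (i ℤ.* j) ≈ fromℤ i * fromℤ j
  fromℤ-* i j = ≈-trans (fromℤ≈⟦⟧ (i ℤ.* j))
    (≈-trans (*-homo i j) (*-cong (≈-sym (fromℤ≈⟦⟧ i)) (≈-sym (fromℤ≈⟦⟧ j))))

  fromℤ-neg : ∀ i → fromℤ (ℤ.- i) ≈ - fromℤ i
  fromℤ-neg i = ≈-trans (fromℤ≈⟦⟧ (ℤ.- i)) (≈-trans (neg-homo i) (-‿cong (≈-sym (fromℤ≈⟦⟧ i))))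

  -- If x bounded the natural numbers they would have a supremum s; since n + 1 ≤ s for every n,
  -- already s - 1 would bound them.
  archimedean : ∀ x → ∃ λ n → x < fromℕ n
  archimedean x with lem {∃ λ n → x < fromℕ n}
  ... | yes e = e
  ... | no ¬e = contradiction s-1<s (≤⇒≯ s≤s-1)
    where
    IsFromℕ : Carrier → Set
    IsFromℕ y = ∃ λ n → y ≈ fromℕ n
    supremum = complete IsFromℕ (0# , 0 , ≈-refl)
      (x , λ { y (n , y≈n) → ≮⇒≥ λ x<y → ¬e (n , <-≤-trans x<y (inj₂ y≈n)) })
    s = proj₁ supremum
    s-1<s : s - 1# < s
    s-1<s = by-< 0<1 (solve 1 (λ x0 → x0 :+ con (+ 0) := x0 :- con (+ 1) :+ con (+ 1)) ≈-refl s)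
    s≤s-1 : s ≤ s - 1#
    s≤s-1 = proj₂ (proj₂ supremum) (s - 1#) λ { y (n , y≈n) →
      by-≤ (proj₁ (proj₂ supremum) (fromℕ (suc n)) (suc n , ≈-refl))
        (≈-trans (+-congˡ (+-congˡ (≈-sym y≈n))) (solve 2 (λ x0 x1 → x0 :- con (+ 1) :+ (con (+ 1) :+ x1) := x1 :+ x0)
                ≈-refl s y)) }

-- Limits of sequences and series

module Series (lem : ExcludedMiddle 0ℓ) (R : CompleteOrderedField) where

  open OrderedField lem R
  open ≤-Reasoning

  infix 4 ∣_∣≤_

  -- A bound on the absolute value is kept as a pair of linear inequalities, the form in which
  -- `by-≤` can work with it.
  ∣_∣≤_ : Carrier → Carrier → Set
  ∣ x ∣≤ b = - b ≤ x × x ≤ b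

  ∣∣≤-bound : ∀ x → ∃ λ b → 0# ≤ b × ∣ x ∣≤ b
  ∣∣≤-bound x with ≤-total 0# x
  ... | inj₁ 0≤x = x , 0≤x , by-≤ (0≤x +-≤ 0≤x) (solve 1 (λ x0 → x0 :+ (con (+ 0) :+ con (+ 0)) := (:- x0) :+ (x0 :+ x0))
          ≈-refl x) , ≤-refl
  ... | inj₂ x≤0 = - x , by-≤ x≤0 (solve 1 (λ x0 → (:- x0) :+ x0 := con (+ 0) :+ con (+ 0))
          ≈-refl x) , inj₂ (solve 1 (λ x0 → (:- ((:- x0))) := x0) ≈-refl x)
                 , by-≤ (x≤0 +-≤ x≤0) (solve 1 (λ x0 → (:- x0) :+ (x0 :+ x0) := x0 :+ (con (+ 0) :+ con (+ 0)))
                         ≈-refl x)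

  ∣∣≤⇒0≤ : ∀ {x b} → ∣ x ∣≤ b → 0# ≤ b
  ∣∣≤⇒0≤ {x} {b} (l , u) = x+x≥0⇒x≥0 (by-≤ (l +-≤ u) (solve 2 (λ x0 x1 → x0 :+ x0 :+ ((:- x0) :+ x1) := con (+ 0) :+ (x1 :+ x0))
          ≈-refl b x))

  ∣∣≤-cong : ∀ {x y b c} → x ≈ y → b ≈ c → ∣ x ∣≤ b → ∣ y ∣≤ c
  ∣∣≤-cong x≈y b≈c (l , u) =
      ≤-trans (inj₂ (-‿cong (≈-sym b≈c))) (≤-trans l (inj₂ x≈y))
    , ≤-trans (inj₂ (≈-sym x≈y)) (≤-trans u (inj₂ b≈c))

  ∣∣≤-weaken : ∀ {x b c} → b ≤ c → ∣ x ∣≤ b → ∣ x ∣≤ c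
  ∣∣≤-weaken b≤c (l , u) = ≤-trans (neg-≤ b≤c) l , ≤-trans u b≤c

  ∣0∣≤ : ∀ {b} → 0# ≤ b → ∣ 0# ∣≤ b
  ∣0∣≤ {b} 0≤b = by-≤ 0≤b (solve 1 (λ x0 → con (+ 0) :+ con (+ 0) := (:- x0) :+ x0) ≈-refl b) , 0≤b

  ∣+∣≤ : ∀ {x y b c} → ∣ x ∣≤ b → ∣ y ∣≤ c → ∣ x + y ∣≤ b + c
  ∣+∣≤ {x} {y} {b} {c} (l , u) (l′ , u′) =
    by-≤ (l +-≤ l′) (solve 4 (λ x0 x1 x2 x3 → x0 :+ x1 :+ ((:- x2) :+ (:- x3)) := (:- (x2 :+ x3)) :+ (x0 :+ x1))
            ≈-refl x y b c) , u +-≤ u′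

  ∣-∣≤ : ∀ {x b} → ∣ x ∣≤ b → ∣ - x ∣≤ b
  ∣-∣≤ {x} {b} (l , u) = neg-≤ u , by-≤ l (solve 2 (λ x0 x1 → x0 :+ (:- x0) := (:- x1) :+ x1) ≈-refl b x)

  -- (b - x)(c - y) + (x + b)(y + c) = 2(xy + bc) is a sum of nonnegative products, and exchanging
  -- the roles of the factors gives 2(bc - xy).
  ∣*∣≤ : ∀ {x y b c} → ∣ x ∣≤ b → ∣ y ∣≤ c → ∣ x * y ∣≤ b * c
  ∣*∣≤ {x} {y} {b} {c} (l , u) (l′ , u′) = by-≤ lower (solve 4 (λ x0 x1 x2 x3 → x0 :* x1 :+ con (+ 0) := (:- (x2 :* x3)) :+ (x0 :* x1 :+ x2 :* x3))
          ≈-refl x y b c)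
                                         , by-≤ upper (solve 4 (λ x0 x1 x2 x3 → x0 :* x1 :+ con (+ 0) := x2 :* x3 :+ (x0 :* x1 :- x2 :* x3))
                                                 ≈-refl b c x y)
    where
    lower : 0# ≤ x * y + b * c
    lower = x+x≥0⇒x≥0 (by-≤ (0≤+ (*-nonneg (0≤y-x u) (0≤y-x u′)) (*-nonneg (0≤y-x l) (0≤y-x l′)))
      (solve 4 (λ x0 x1 x2 x3 → x0 :* x1 :+ x2 :* x3 :+ (x0 :* x1 :+ x2 :* x3) :+ con (+ 0)
                := con (+ 0) :+ ((x2 :- x0) :* (x3 :- x1) :+ (x0 :- (:- x2)) :* (x1 :- (:- x3))))
              ≈-refl x y b c))
    upper : 0# ≤ b * c - x * y
    upper = x+x≥0⇒x≥0 (by-≤ (0≤+ (*-nonneg (0≤y-x u) (0≤y-x l′)) (*-nonneg (0≤y-x l) (0≤y-x u′)))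
      (solve 4 (λ x0 x1 x2 x3 → x0 :* x1 :- x2 :* x3 :+ (x0 :* x1 :- x2 :* x3) :+ con (+ 0)
                := con (+ 0) :+ ((x0 :- x2) :* (x3 :- (:- x1)) :+ (x2 :- (:- x0)) :* (x1 :- x3)))
              ≈-refl b c x y))

  limit-cong : ∀ {a b l m} → (∀ n → a n ≈ b n) → l ≈ m → ConvergesTo a l → ConvergesTo b m
  limit-cong {a} {b} {l} {m} a≈b l≈m a→l ε 0<ε with a→l ε 0<ε
  ... | N , close = N , λ n N≤n →
      <-≤-trans (≤-<-trans (inj₂ (+-congʳ (≈-sym l≈m))) (proj₁ (close n N≤n))) (inj₂ (a≈b n))
    , <-≤-trans (≤-<-trans (inj₂ (≈-sym (a≈b n))) (proj₂ (close n N≤n))) (inj₂ (+-congʳ l≈m))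

  limit-mono : ∀ {a b l m} → (∃ λ N → ∀ n → N ℕ.≤ n → a n ≤ b n) →
               ConvergesTo a l → ConvergesTo b m → l ≤ m
  limit-mono {a} {b} {l} {m} (N , a≤b) a→l b→m = ≤-all-ε λ ε 0<ε →
    let N₁ , close₁ = a→l (½ * ε) (0<half 0<ε)
        N₂ , close₂ = b→m (½ * ε) (0<half 0<ε)
        n = N ℕ.+ (N₁ ℕ.+ N₂)
        N₁≤n = ℕ.≤-trans (ℕ.m≤m+n N₁ N₂) (ℕ.m≤n+m _ N)
        N₂≤n = ℕ.≤-trans (ℕ.m≤n+m N₂ N₁) (ℕ.m≤n+m _ N)
        l-½ε<m+½ε = <-trans (<-≤-trans (proj₁ (close₁ n N₁≤n)) (a≤b n (ℕ.m≤m+n N _))) (proj₂ (close₂ n N₂≤n))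
    in by-≤ (<⇒≤ l-½ε<m+½ε) (≈-trans (+-congʳ (+-congˡ (≈-sym (half ε))))
         (solve 4 (λ x0 x1 x2 x3 → x0 :+ (x1 :* x2 :+ x1 :* x2) :+ (x3 :- x1 :* x2) := x3 :+ (x0 :+ x1 :* x2))
                 ≈-refl m ½ ε l))

  limit-unique : ∀ {a l m} → ConvergesTo a l → ConvergesTo a m → l ≈ m
  limit-unique a→l a→m =
    ≤-antisym (limit-mono (0 , λ _ _ → ≤-refl) a→l a→m) (limit-mono (0 , λ _ _ → ≤-refl) a→m a→l)

  limit-const : ∀ l → ConvergesTo (λ _ → l) l
  limit-const l ε 0<ε = 0 , λ _ _ → by-< 0<ε (solve 2 (λ x0 x1 → x0 :+ con (+ 0) := x0 :- x1 :+ x1)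
          ≈-refl l ε) , by-< 0<ε (solve 2 (λ x0 x1 → x0 :+ x1 :+ con (+ 0) := x0 :+ x1)
          ≈-refl l ε)

  limit-≤ : ∀ {a l b} → (∃ λ N → ∀ n → N ℕ.≤ n → a n ≤ b) → ConvergesTo a l → l ≤ b
  limit-≤ {b = b} a≤b a→l = limit-mono a≤b a→l (limit-const b)

  limit-≥ : ∀ {a l b} → (∃ λ N → ∀ n → N ℕ.≤ n → b ≤ a n) → ConvergesTo a l → b ≤ l
  limit-≥ {b = b} b≤a a→l = limit-mono b≤a (limit-const b) a→l

  limit-+ : ∀ {a b l m} → ConvergesTo a l → ConvergesTo b m → ConvergesTo (λ n → a n + b n) (l + m)
  limit-+ {a} {b} {l} {m} a→l b→m ε 0<ε =
    let N₁ , close₁ = a→l (½ * ε) (0<half 0<ε)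
        N₂ , close₂ = b→m (½ * ε) (0<half 0<ε)
    in N₁ ℕ.+ N₂ , λ n N≤n →
      let l₁ , u₁ = close₁ n (ℕ.≤-trans (ℕ.m≤m+n N₁ N₂) N≤n)
          l₂ , u₂ = close₂ n (ℕ.≤-trans (ℕ.m≤n+m N₂ N₁) N≤n)
      in by-< (l₁ +-< l₂) (≈-trans (solve 6 (λ x0 x1 x2 x3 x4 x5 → x0 :+ x1 :+ (x2 :- x3 :* x4 :+ (x5 :- x3 :* x4))
                := x2 :+ x5 :- (x3 :* x4 :+ x3 :* x4) :+ (x0 :+ x1))
              ≈-refl (a n) (b n) l ½ ε m)
                                    (+-congʳ (+-congˡ (-‿cong (half ε)))))
       , by-< (u₁ +-< u₂) (≈-trans (+-congʳ (+-congˡ (≈-sym (half ε))))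
           (solve 6 (λ x0 x1 x2 x3 x4 x5 → x0 :+ x1 :+ (x2 :* x3 :+ x2 :* x3) :+ (x4 :+ x5)
                     := x4 :+ x5 :+ (x0 :+ x2 :* x3 :+ (x1 :+ x2 :* x3)))
                   ≈-refl l m ½ ε (a n) (b n)))

  limit-suc : ∀ {a l} → ConvergesTo a l → ConvergesTo (a ∘ suc) l
  limit-suc a→l ε 0<ε with a→l ε 0<ε
  ... | N , close = N , λ n N≤n → close (suc n) (ℕ.m≤n⇒m≤1+n N≤n)

  limit-pred : ∀ {a l} → ConvergesTo (a ∘ suc) l → ConvergesTo a l
  limit-pred {a} {l} a→l ε 0<ε with a→l ε 0<ε
  ... | N , close = suc N , λ { (suc n) (s≤s N≤n) → close n N≤n }

  -- Convergence to 0 with weak inequalities, so that the rules for `∣_∣≤_` apply; halving ε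
  -- recovers the strict bounds of `ConvergesTo`.
  Null : (ℕ → Carrier) → Set
  Null d = ∀ ε → 0# < ε → ∃ λ N → ∀ n → N ℕ.≤ n → ∣ d n ∣≤ ε

  null⇒limit : ∀ {a l} → Null (λ n → a n - l) → ConvergesTo a l
  null⇒limit {a} {l} null ε 0<ε with null (½ * ε) (0<half 0<ε)
  ... | N , close = N , λ n N≤n → let L , U = close n N≤n in
      by-< (L +-≤< ½ε<ε) (solve 4 (λ x0 x1 x2 x3 → x0 :+ ((:- (x1 :* x2)) :+ x1 :* x2) := x3 :- x2 :+ (x0 :- x3 :+ x2))
              ≈-refl (a n) ½ ε l)
    , by-< (U +-≤< ½ε<ε) (solve 4 (λ x0 x1 x2 x3 → x0 :+ x1 :+ (x2 :- x0 :+ x3 :* x1) := x2 :+ (x3 :* x1 :+ x1))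
            ≈-refl l ε (a n) ½)
    where
    ½ε<ε : ½ * ε < ε
    ½ε<ε = by-< (0<half 0<ε) (≈-trans (+-identityʳ ε) (≈-sym (half ε)))

  limit⇒null : ∀ {a l} → ConvergesTo a l → Null (λ n → a n - l)
  limit⇒null {a} {l} a→l ε 0<ε with a→l ε 0<ε
  ... | N , close = N , λ n N≤n → let L , U = close n N≤n in
      by-≤ (<⇒≤ L) (solve 3 (λ x0 x1 x2 → x0 :- x1 :+ (x1 :- x2) := (:- x2) :+ x0) ≈-refl (a n) l ε)
    , by-≤ (<⇒≤ U) (solve 3 (λ x0 x1 x2 → x0 :+ x1 := x1 :- x2 :+ (x2 :+ x0)) ≈-refl ε (a n) l)

  limit-*ˡ : ∀ {a l} c → ConvergesTo a l → ConvergesTo (λ n → c * a n) (c * l)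
  limit-*ˡ {a} {l} c a→l = null⇒limit λ ε 0<ε →
    let b , 0≤b , ∣c∣≤b = ∣∣≤-bound c
        0<b+1 = ≤-<-trans 0≤b (by-< 0<1 (solve 1 (λ x0 → x0 :+ con (+ 1) :+ con (+ 0) := x0 :+ con (+ 1))
                ≈-refl b))
        -- The added 1 keeps the divisor positive even if the bound b of c is 0.
        δ = ε * (b + 1#) ⁻¹
        0<δ = *-pos 0<ε (⁻¹-pos 0<b+1)
        N , close = limit⇒null a→l δ 0<δ
        bδ≤ε : b * δ ≤ ε
        bδ≤ε = begin
          b * δ                              ≤⟨ by-≤ (<⇒≤ 0<δ) (solve 2 (λ x0 x1 → (x0 :+ con (+ 1)) :* x1 :+ con (+ 0) := x0 :* x1 :+ x1)
                  ≈-refl b δ) ⟩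
          (b + 1#) * (ε * (b + 1#) ⁻¹)       ≈⟨ (solve 3 (λ x0 x1 x2 → (x0 :+ con (+ 1)) :* (x1 :* x2) := x1 :* ((x0 :+ con (+ 1)) :* x2))
                  ≈-refl b ε ((b + 1#) ⁻¹)) ⟩
          ε * ((b + 1#) * (b + 1#) ⁻¹)       ≈⟨ *-congˡ (*-inverse-pos 0<b+1) ⟩
          ε * 1#                             ≈⟨ *-identityʳ ε ⟩
          ε                                  ∎
    in N , λ n N≤n → ∣∣≤-weaken bδ≤ε
         (∣∣≤-cong (solve 3 (λ x0 x1 x2 → x0 :* (x1 :- x2) := x0 :* x1 :- x0 :* x2)
                 ≈-refl c (a n) l) ≈-refl (∣*∣≤ ∣c∣≤b (close n N≤n)))

  limit-neg : ∀ {a l} → ConvergesTo a l → ConvergesTo (λ n → - a n) (- l)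
  limit-neg {a} {l} a→l = limit-cong (λ n → (solve 1 (λ x0 → (:- (con (+ 1))) :* x0 := (:- x0))
          ≈-refl (a n))) (solve 1 (λ x0 → (:- (con (+ 1))) :* x0 := (:- x0))
          ≈-refl l) (limit-*ˡ (- 1#) a→l)

  monotone-mono : ∀ {a : ℕ → Carrier} → (∀ n → a n ≤ a (suc n)) → ∀ {m n} → m ℕ.≤ n → a m ≤ a n
  monotone-mono {a} a↑ {m} m≤n = go (ℕ.≤⇒≤′ m≤n)
    where
    go : ∀ {n} → m ℕ.≤′ n → a m ≤ a n
    go ℕ.≤′-refl        = ≤-refl
    go (ℕ.≤′-step m≤′n) = ≤-trans (go m≤′n) (a↑ _)

  monotone-limit-≥ : ∀ {a : ℕ → Carrier} {l} → (∀ n → a n ≤ a (suc n)) → ConvergesTo a l → ∀ n → a n ≤ l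
  monotone-limit-≥ a↑ a→l n = limit-≥ (n , λ m n≤m → monotone-mono a↑ n≤m) a→l

  monotone-converges : ∀ {a : ℕ → Carrier} {b} → (∀ n → a n ≤ a (suc n)) → (∀ n → a n ≤ b) → ∃ (ConvergesTo a)
  monotone-converges {a} {b} a↑ a≤b = s , converges
    where
    InImage : Carrier → Set
    InImage y = ∃ λ n → y ≈ a n
    supremum = complete InImage (a 0 , 0 , ≈-refl) (b , λ { y (n , y≈an) → ≤-trans (inj₂ y≈an) (a≤b n) })
    s = proj₁ supremum
    a≤s : ∀ n → a n ≤ s
    a≤s n = proj₁ (proj₂ supremum) (a n) (n , ≈-refl)
    converges : ConvergesTo a s
    converges ε 0<ε with lem {∃ λ N → s - ε < a N}
    ... | yes (N , s-ε<aN) = N , λ n N≤n →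
            <-≤-trans s-ε<aN (monotone-mono a↑ N≤n)
          , by-< (a≤s n +-≤< 0<ε) (solve 3 (λ x0 x1 x2 → x0 :+ x1 :+ (x2 :+ con (+ 0)) := x2 :+ (x0 :+ x1))
                  ≈-refl s ε (a n))
    ... | no ¬∃ = contradiction (by-< 0<ε (solve 2 (λ x0 x1 → x0 :+ con (+ 0) := x0 :- x1 :+ x1) ≈-refl s ε))
          (≤⇒≯ (proj₂ (proj₂ supremum) (s - ε) λ { y (n , y≈an) →
            ≤-trans (inj₂ y≈an) (≮⇒≥ λ s-ε<an → ¬∃ (n , s-ε<an)) }))

  partialSum-cong : ∀ {a b} → (∀ n → a n ≈ b n) → ∀ n → partialSum a n ≈ partialSum b n
  partialSum-cong a≈b zero    = ≈-refl
  partialSum-cong a≈b (suc n) = +-cong (partialSum-cong a≈b n) (a≈b n)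

  partialSum-+ : ∀ a b n → partialSum (λ i → a i + b i) n ≈ partialSum a n + partialSum b n
  partialSum-+ a b zero    = (solve 0 (con (+ 0) := con (+ 0) :+ con (+ 0)) ≈-refl)
  partialSum-+ a b (suc n) = ≈-trans (+-congʳ (partialSum-+ a b n))
    (solve 4 (λ x0 x1 x2 x3 → x0 :+ x1 :+ (x2 :+ x3) := x0 :+ x2 :+ (x1 :+ x3))
            ≈-refl (partialSum a n) (partialSum b n) (a n) (b n))

  partialSum-*ˡ : ∀ c a n → partialSum (λ i → c * a i) n ≈ c * partialSum a n
  partialSum-*ˡ c a zero    = ≈-sym (zeroʳ c)
  partialSum-*ˡ c a (suc n) = ≈-trans (+-congʳ (partialSum-*ˡ c a n)) (solve 3 (λ x0 x1 x2 → x0 :* x1 :+ x0 :* x2 := x0 :* (x1 :+ x2))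
          ≈-refl c (partialSum a n) (a n))

  partialSum-suc : ∀ a n → partialSum a (suc n) ≈ a 0 + partialSum (a ∘ suc) n
  partialSum-suc a zero    = +-comm 0# (a 0)
  partialSum-suc a (suc n) = ≈-trans (+-congʳ (partialSum-suc a n))
    (solve 3 (λ x0 x1 x2 → x0 :+ x1 :+ x2 := x0 :+ (x1 :+ x2)) ≈-refl (a 0) (partialSum (a ∘ suc) n) (a (suc n)))

  partialSum-∣∣≤ : ∀ {a A} → (∀ n → ∣ a n ∣≤ A n) → ∀ n → ∣ partialSum a n ∣≤ partialSum A n
  partialSum-∣∣≤ a≤A zero    = ∣0∣≤ ≤-refl
  partialSum-∣∣≤ a≤A (suc n) = ∣+∣≤ (partialSum-∣∣≤ a≤A n) (a≤A n)

  partialSum-mono : ∀ {a} → (∀ n → 0# ≤ a n) → ∀ n → partialSum a n ≤ partialSum a (suc n)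
  partialSum-mono {a} 0≤a n = by-≤ (0≤a n) (+-identityʳ _)

  -- The partial sums of a + A increase and stay below 2Ā, hence converge; subtracting those of A
  -- leaves the partial sums of a.
  dominated-converges : ∀ {a A Ā} → (∀ n → ∣ a n ∣≤ A n) → ConvergesTo (partialSum A) Ā →
                        ∃ (ConvergesTo (partialSum a))
  dominated-converges {a} {A} {Ā} a≤A A→Ā =
    let l , →l = monotone-converges (partialSum-mono λ n → by-≤ (proj₁ (a≤A n)) (solve 2 (λ x0 x1 → x0 :+ x1 :+ (:- x1) := con (+ 0) :+ x0)
            ≈-refl (a n) (A n))) bounded
    in l + - Ā , limit-cong (λ n → ≈-trans (+-congʳ (partialSum-+ a A n))
                    (solve 2 (λ x0 x1 → x0 :+ x1 :+ (:- x1) := x0)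
                            ≈-refl (partialSum a n) (partialSum A n))) ≈-refl
                   (limit-+ →l (limit-neg A→Ā))
    where
    bounded : ∀ n → partialSum (λ i → a i + A i) n ≤ Ā + Ā
    bounded n = begin
      partialSum (λ i → a i + A i) n    ≈⟨ partialSum-+ a A n ⟩
      partialSum a n + partialSum A n   ≤⟨ proj₂ (partialSum-∣∣≤ a≤A n) +-≤ ≤-refl ⟩
      partialSum A n + partialSum A n   ≤⟨ A≤Ā +-≤ A≤Ā ⟩
      Ā + Ā                             ∎
      where A≤Ā = monotone-limit-≥ (partialSum-mono λ n → ∣∣≤⇒0≤ (a≤A n)) A→Ā n

  -- Cauchy products and Mertens' theorem

  infixl 7 _⋆_

  -- The Cauchy product, by recursion on shifts of the first factor, so that no difference of
  -- indices appears.
  _⋆_ : (ℕ → Carrier) → (ℕ → Carrier) → ℕ → Carrier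
  (a ⋆ b) zero    = a 0 * b 0
  (a ⋆ b) (suc n) = a 0 * b (suc n) + ((a ∘ suc) ⋆ b) n

  ⋆-cong : ∀ {a a′ b b′} → (∀ n → a n ≈ a′ n) → (∀ n → b n ≈ b′ n) → ∀ n → (a ⋆ b) n ≈ (a′ ⋆ b′) n
  ⋆-cong a≈ b≈ zero    = *-cong (a≈ 0) (b≈ 0)
  ⋆-cong a≈ b≈ (suc n) = +-cong (*-cong (a≈ 0) (b≈ (suc n))) (⋆-cong (a≈ ∘ suc) b≈ n)

  -- The products of a i and b j with i + j ≤ n are collected by rows: each a i meets a partial sum
  -- of b.
  partialSum-⋆ : ∀ a b n → partialSum (a ⋆ b) (suc n) ≈ (a ⋆ (partialSum b ∘ suc)) n
  partialSum-⋆ a b zero    = (solve 2 (λ x0 x1 → con (+ 0) :+ x0 :* x1 := x0 :* (con (+ 0) :+ x1))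
          ≈-refl (a 0) (b 0))
  partialSum-⋆ a b (suc n) = begin-equality
    partialSum (a ⋆ b) (suc (suc n))
      ≈⟨ partialSum-suc (a ⋆ b) (suc n) ⟩
    a 0 * b 0 + partialSum (λ k → a 0 * b (suc k) + ((a ∘ suc) ⋆ b) k) (suc n)
      ≈⟨ +-congˡ (partialSum-+ (λ k → a 0 * b (suc k)) ((a ∘ suc) ⋆ b) (suc n)) ⟩
    a 0 * b 0 + (partialSum (λ k → a 0 * b (suc k)) (suc n) + partialSum ((a ∘ suc) ⋆ b) (suc n))
      ≈⟨ +-congˡ (+-cong (partialSum-*ˡ (a 0) (b ∘ suc) (suc n)) (partialSum-⋆ (a ∘ suc) b n)) ⟩
    a 0 * b 0 + (a 0 * partialSum (b ∘ suc) (suc n) + ((a ∘ suc) ⋆ (partialSum b ∘ suc)) n)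
      ≈⟨ (solve 4 (λ x0 x1 x2 x3 → x0 :* x1 :+ (x0 :* x2 :+ x3) := x0 :* (x1 :+ x2) :+ x3)
              ≈-refl (a 0) (b 0) (partialSum (b ∘ suc) (suc n)) (((a ∘ suc) ⋆ (partialSum b ∘ suc)) n)) ⟩
    a 0 * (b 0 + partialSum (b ∘ suc) (suc n)) + ((a ∘ suc) ⋆ (partialSum b ∘ suc)) n
      ≈⟨ +-congʳ (*-congˡ (partialSum-suc b (suc n))) ⟨
    a 0 * partialSum b (suc (suc n)) + ((a ∘ suc) ⋆ (partialSum b ∘ suc)) n
      ∎

  -- Splits off the limit β when b consists of partial sums: the convolution with the differences
  -- turns out null, and the rest is β times a partial sum of a.
  ⋆-shift : ∀ a b β n → (a ⋆ b) n ≈ (a ⋆ (λ j → b j - β)) n + β * partialSum a (suc n)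
  ⋆-shift a b β zero    = (solve 3 (λ x0 x1 x2 → x0 :* x1 := x0 :* (x1 :- x2) :+ x2 :* (con (+ 0) :+ x0))
          ≈-refl (a 0) (b 0) β)
  ⋆-shift a b β (suc n) = begin-equality
    a 0 * b (suc n) + ((a ∘ suc) ⋆ b) n
      ≈⟨ +-congˡ (⋆-shift (a ∘ suc) b β n) ⟩
    a 0 * b (suc n) + (((a ∘ suc) ⋆ b′) n + β * partialSum (a ∘ suc) (suc n))
      ≈⟨ (solve 5 (λ x0 x1 x2 x3 x4 → x0 :* x1 :+ (x2 :+ x3 :* x4) := x0 :* (x1 :- x3) :+ x2 :+ x3 :* (x0 :+ x4))
              ≈-refl (a 0) (b (suc n)) (((a ∘ suc) ⋆ b′) n) β (partialSum (a ∘ suc) (suc n))) ⟩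
    (a 0 * (b (suc n) - β) + ((a ∘ suc) ⋆ b′) n) + β * (a 0 + partialSum (a ∘ suc) (suc n))
      ≈⟨ +-congˡ (*-congˡ (partialSum-suc a (suc n))) ⟨
    (a ⋆ b′) (suc n) + β * partialSum a (suc (suc n))
      ∎
    where b′ = λ j → b j - β

  ⋆-∣∣≤ : ∀ {a A d D} → (∀ i → ∣ a i ∣≤ A i) → (∀ j → ∣ d j ∣≤ D) →
          ∀ n → ∣ (a ⋆ d) n ∣≤ D * partialSum A (suc n)
  ⋆-∣∣≤ {A = A} {D = D} a≤A d≤D zero = ∣∣≤-cong ≈-refl (solve 2 (λ x0 x1 → x0 :* x1 := x1 :* (con (+ 0) :+ x0))
          ≈-refl (A 0) D) (∣*∣≤ (a≤A 0) (d≤D 0))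
  ⋆-∣∣≤ {A = A} {D = D} a≤A d≤D (suc n) = ∣∣≤-cong ≈-refl
    (≈-trans (solve 3 (λ x0 x1 x2 → x0 :* x1 :+ x1 :* x2 := x1 :* (x0 :+ x2))
            ≈-refl (A 0) D (partialSum (A ∘ suc) (suc n)))
             (*-congˡ (≈-sym (partialSum-suc A (suc n)))))
    (∣+∣≤ (∣*∣≤ (a≤A 0) (d≤D (suc n))) (⋆-∣∣≤ (a≤A ∘ suc) d≤D n))

  -- The first M terms of a meet the small tail of d; the others only use the bound D.
  ⋆-split-∣∣≤ : ∀ {a A d D ε N} → (∀ i → ∣ a i ∣≤ A i) → (∀ j → ∣ d j ∣≤ D) →
                (∀ j → N ℕ.≤ j → ∣ d j ∣≤ ε) → ∀ M n → M ℕ.+ N ℕ.≤ n →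
                ∣ (a ⋆ d) n ∣≤ ε * partialSum A M + D * (partialSum A (suc n) - partialSum A M)
  ⋆-split-∣∣≤ {A = A} {D = D} {ε} a≤A d≤D d≤ε zero n _ = ∣∣≤-cong ≈-refl
    (solve 3 (λ x0 x1 x2 → x0 :* x1 := x2 :* con (+ 0) :+ x0 :* (x1 :- con (+ 0)))
            ≈-refl D (partialSum A (suc n)) ε) (⋆-∣∣≤ a≤A d≤D n)
  ⋆-split-∣∣≤ {A = A} {D = D} {ε} {N} a≤A d≤D d≤ε (suc M) (suc n) (s≤s M+N≤n) =
    ∣∣≤-cong ≈-refl eq
      (∣+∣≤ (∣*∣≤ (a≤A 0) (d≤ε (suc n) (ℕ.m≤n⇒m≤1+n (ℕ.≤-trans (ℕ.m≤n+m N M) M+N≤n))))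
            (⋆-split-∣∣≤ (a≤A ∘ suc) d≤D d≤ε M n M+N≤n))
    where
    A′ = partialSum (A ∘ suc)
    eq : A 0 * ε + (ε * A′ M + D * (A′ (suc n) - A′ M))
         ≈ ε * partialSum A (suc M) + D * (partialSum A (suc (suc n)) - partialSum A (suc M))
    eq = ≈-trans (solve 5 (λ x0 x1 x2 x3 x4 → x0 :* x1 :+ (x1 :* x2 :+ x3 :* (x4 :- x2))
              := x1 :* (x0 :+ x2) :+ x3 :* (x0 :+ x4 :- (x0 :+ x2)))
            ≈-refl (A 0) ε (A′ M) D (A′ (suc n)))
         (≈-sym (+-cong (*-congˡ (partialSum-suc A M))
           (*-congˡ (+-cong (partialSum-suc A (suc n)) (-‿cong (partialSum-suc A M))))))

  -- In `⋆-split-∣∣≤`, M is chosen so that the tail of the majorant is at most δ and N so that d is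
  -- at most δ from there on; the total is at most δ Ā + D δ.
  ⋆-null : ∀ {a A Ā d D} → (∀ i → ∣ a i ∣≤ A i) → ConvergesTo (partialSum A) Ā →
           (∀ j → ∣ d j ∣≤ D) → Null d → Null (a ⋆ d)
  ⋆-null {a} {A} {Ā} {d} {D} a≤A A→Ā d≤D d→0 ε 0<ε =
    let N , d≤δ = d→0 δ 0<δ
        M , close = A→Ā δ 0<δ
        Ā-δ≤M = <⇒≤ (proj₁ (close M ℕ.≤-refl))
        bound : ∀ n → δ * partialSum A M + D * (partialSum A (suc n) - partialSum A M) ≤ ε
        bound n = begin
          δ * partialSum A M + D * (partialSum A (suc n) - partialSum A M)
            ≤⟨ *-monoʳ-≤ (<⇒≤ 0<δ) (A≤Ā M) +-≤ *-monoʳ-≤ 0≤D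
                 (by-≤ (A≤Ā (suc n) +-≤ Ā-δ≤M)
                   (solve 4 (λ x0 x1 x2 x3 → x0 :+ (x1 :+ (x2 :- x0)) := x1 :- x3 :+ (x2 :+ x3))
                           ≈-refl δ (partialSum A (suc n)) Ā (partialSum A M))) ⟩
          δ * Ā + D * δ               ≤⟨ by-≤ (<⇒≤ 0<δ) (solve 3 (λ x0 x1 x2 → x0 :* (x1 :+ x2 :+ con (+ 1)) :+ con (+ 0) := x0 :* x1 :+ x2 :* x0 :+ x0)
                  ≈-refl δ Ā D) ⟩
          δ * (Ā + D + 1#)            ≈⟨ (solve 4 (λ x0 x1 x2 x3 → x0 :* x1 :* (x2 :+ x3 :+ con (+ 1)) := x0 :* ((x2 :+ x3 :+ con (+ 1)) :* x1))
                  ≈-refl ε ((Ā + D + 1#) ⁻¹) Ā D) ⟩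
          ε * (K * K ⁻¹)              ≈⟨ *-congˡ (*-inverse-pos 0<K) ⟩
          ε * 1#                      ≈⟨ *-identityʳ ε ⟩
          ε                           ∎
    in M ℕ.+ N , λ n M+N≤n → ∣∣≤-weaken (bound n) (⋆-split-∣∣≤ a≤A d≤D d≤δ M n M+N≤n)
    where
    0≤A : ∀ n → 0# ≤ A n
    0≤A n = ∣∣≤⇒0≤ (a≤A n)
    A≤Ā = monotone-limit-≥ (partialSum-mono 0≤A) A→Ā
    0≤D = ∣∣≤⇒0≤ (d≤D 0)
    -- The total δ (Ā + D) has to stay below ε; the added 1 makes the divisor positive.
    K = Ā + D + 1#
    0<K : 0# < K
    0<K = ≤-<-trans (0≤+ (A≤Ā 0) 0≤D) (by-< 0<1 (solve 2 (λ x0 x1 → x0 :+ x1 :+ con (+ 1) :+ con (+ 0) := x0 :+ x1 :+ con (+ 1))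
            ≈-refl Ā D))
    δ = ε * K ⁻¹
    0<δ = *-pos 0<ε (⁻¹-pos 0<K)

  -- By `partialSum-⋆` and `⋆-shift` each partial sum with successor index is a null convolution
  -- plus β times a partial sum of a.
  mertens : ∀ {a A Ā α b B β} → (∀ i → ∣ a i ∣≤ A i) → ConvergesTo (partialSum A) Ā →
            ConvergesTo (partialSum a) α → (∀ n → ∣ partialSum b n ∣≤ B) → ConvergesTo (partialSum b) β →
            ConvergesTo (partialSum (a ⋆ b)) (α * β)
  mertens {a} {A} {Ā} {α} {b} {B} {β} a≤A A→Ā a→α b≤B b→β = limit-pred
    (limit-cong (λ n → ≈-sym (≈-trans (partialSum-⋆ a b n) (⋆-shift a (partialSum b ∘ suc) β n)))
       (solve 2 (λ x0 x1 → con (+ 0) :+ x0 :* x1 := x1 :* x0) ≈-refl β α)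
       (limit-+ (null⇒limit (λ ε 0<ε → let N , close = ⋆-null a≤A A→Ā d≤ (limit⇒null (limit-suc b→β)) ε 0<ε
                                          in N , λ n N≤n → ∣∣≤-cong (solve 1 (λ x0 → x0 := x0 :- con (+ 0))
                                                  ≈-refl ((a ⋆ d) n)) ≈-refl (close n N≤n)))
                (limit-*ˡ β (limit-suc a→α))))
    where
    d = λ j → partialSum b (suc j) - β
    -- The limit β inherits the bound B of the partial sums, so a difference is bounded by 2B.
    d≤ : ∀ j → ∣ d j ∣≤ B + B
    d≤ j = ∣+∣≤ (b≤B (suc j)) (∣-∣≤
      ( limit-≥ (0 , λ n _ → proj₁ (b≤B n)) b→β , limit-≤ (0 , λ n _ → proj₂ (b≤B n)) b→β))

-- The exponential series

module ExpSinCos (lem : ExcludedMiddle 0ℓ) (R : CompleteOrderedField) where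

  open OrderedField lem R
  open Series lem R
  open ≤-Reasoning

  open SemiringExp semiring using (^-congˡ)

  0<n! : ∀ n → 0# < fromℕ (n !)
  0<n! n = 0<fromℕ (ℕ.1≤n! n)

  powerTerm : Carrier → ℕ → Carrier
  powerTerm x n = x ^ n * fromℕ (n !) ⁻¹

  private e = powerTerm

  -- This recurrence stands in for the factorials in the addition theorem, in the ratio estimates
  -- and in the computation of the first terms.
  powerTerm-suc : ∀ x n → fromℕ (suc n) * e x (suc n) ≈ x * e x n
  powerTerm-suc x n = begin-equality
    fromℕ (suc n) * (x * x ^ n * fromℕ (suc n !) ⁻¹)
      ≈⟨ (solve 4 (λ x0 x1 x2 x3 → x0 :* (x1 :* x2 :* x3) := x1 :* (x2 :* (x0 :* x3)))
              ≈-refl (fromℕ (suc n)) x (x ^ n) (fromℕ (suc n !) ⁻¹)) ⟩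
    x * (x ^ n * (fromℕ (suc n) * fromℕ (suc n !) ⁻¹))
      ≈⟨ *-congˡ (*-congˡ (*-cancelˡ-≈ (0<n! n) cancelled)) ⟩
    x * (x ^ n * fromℕ (n !) ⁻¹)
      ∎
    where
    cancelled : fromℕ (n !) * (fromℕ (suc n) * fromℕ (suc n !) ⁻¹) ≈ fromℕ (n !) * fromℕ (n !) ⁻¹
    cancelled = begin-equality
      fromℕ (n !) * (fromℕ (suc n) * fromℕ (suc n !) ⁻¹)
        ≈⟨ (solve 3 (λ x0 x1 x2 → x0 :* (x1 :* x2) := x1 :* x0 :* x2)
                ≈-refl (fromℕ (n !)) (fromℕ (suc n)) (fromℕ (suc n !) ⁻¹)) ⟩
      fromℕ (suc n) * fromℕ (n !) * fromℕ (suc n !) ⁻¹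
        ≈⟨ *-congʳ (fromℕ-* (suc n) (n !)) ⟨
      fromℕ (suc n !) * fromℕ (suc n !) ⁻¹
        ≈⟨ *-inverse-pos (0<n! (suc n)) ⟩
      1#
        ≈⟨ *-inverse-pos (0<n! n) ⟨
      fromℕ (n !) * fromℕ (n !) ⁻¹
        ∎

  powerTerm-0 : ∀ x → e x 0 ≈ 1#
  powerTerm-0 x = ≈-trans (solve 1 (λ x0 → con (+ 1) :* x0 := (con (+ 1) :+ con (+ 0)) :* x0)
          ≈-refl (fromℕ (0 !) ⁻¹)) (*-inverse-pos (0<n! 0))

  powerTerm-1 : ∀ x → e x 1 ≈ x
  powerTerm-1 x = begin-equality
    e x 1                ≈⟨ (solve 1 (λ x0 → x0 := (con (+ 1) :+ con (+ 0)) :* x0) ≈-refl (e x 1)) ⟩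
    fromℕ 1 * e x 1      ≈⟨ powerTerm-suc x 0 ⟩
    x * e x 0            ≈⟨ *-congˡ (powerTerm-0 x) ⟩
    x * 1#               ≈⟨ *-identityʳ x ⟩
    x                    ∎

  powerTerm-cong : ∀ {x y} → x ≈ y → ∀ n → e x n ≈ e y n
  powerTerm-cong x≈y n = *-congʳ (^-congˡ n x≈y)

  ^-∣∣≤ : ∀ {x X} → ∣ x ∣≤ X → ∀ n → ∣ x ^ n ∣≤ X ^ n
  ^-∣∣≤ x≤X zero    = ∣1∣≤1
    where
    ∣1∣≤1 : ∣ 1# ∣≤ 1#
    ∣1∣≤1 = by-≤ (0≤+ 0≤1 0≤1) (solve 0 (con (+ 1) :+ con (+ 0) := (:- (con (+ 1))) :+ (con (+ 1) :+ con (+ 1)))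
            ≈-refl) , ≤-refl
  ^-∣∣≤ x≤X (suc n) = ∣*∣≤ x≤X (^-∣∣≤ x≤X n)

  nonneg⇒∣∣≤ : ∀ {x} → 0# ≤ x → ∣ x ∣≤ x
  nonneg⇒∣∣≤ {x} 0≤x = by-≤ (0≤+ 0≤x 0≤x) (solve 1 (λ x0 → x0 :+ con (+ 0) := (:- x0) :+ (x0 :+ x0))
          ≈-refl x) , ≤-refl

  powerTerm-∣∣≤ : ∀ {x X} → ∣ x ∣≤ X → ∀ n → ∣ e x n ∣≤ e X n
  powerTerm-∣∣≤ x≤X n = ∣*∣≤ (^-∣∣≤ x≤X n) (nonneg⇒∣∣≤ (<⇒≤ (⁻¹-pos (0<n! n))))

  powerTerm-nonneg : ∀ {x} → 0# ≤ x → ∀ n → 0# ≤ e x n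
  powerTerm-nonneg 0≤x n = ∣∣≤⇒0≤ (powerTerm-∣∣≤ (nonneg⇒∣∣≤ 0≤x) n)

  -- From an index N above 2x on, every term is at least twice its successor, so the partial sum
  -- plus twice the next term no longer increases.
  powerSeries-bounded : ∀ {x} → 0# ≤ x → ∃ λ b → ∀ n → partialSum (e x) n ≤ b
  powerSeries-bounded {x} 0≤x = b , λ n → begin
      partialSum (e x) n                                    ≤⟨ monotone-mono (partialSum-mono 0≤e) (ℕ.m≤m+n n N) ⟩
      partialSum (e x) (n ℕ.+ N)                            ≤⟨ by-≤ (0≤+ (0≤e (n ℕ.+ N)) (0≤e (n ℕ.+ N))) (+-identityʳ _) ⟩
      partialSum (e x) (n ℕ.+ N) + (e x (n ℕ.+ N) + e x (n ℕ.+ N))  ≤⟨ tail n ⟩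
      b                                                     ∎
    where
    0≤e = powerTerm-nonneg 0≤x
    N = proj₁ (archimedean (x + x))
    2x<N = proj₂ (archimedean (x + x))
    b = partialSum (e x) N + (e x N + e x N)
    halving : ∀ n → N ℕ.≤ n → e x (suc n) + e x (suc n) ≤ e x n
    halving n N≤n = *-cancelʳ-≤ (0<fromℕ-suc n) (begin
      (e x (suc n) + e x (suc n)) * fromℕ (suc n)
        ≈⟨ (solve 2 (λ x0 x1 → (x0 :+ x0) :* x1 := x1 :* x0 :+ x1 :* x0) ≈-refl (e x (suc n)) (fromℕ (suc n))) ⟩
      fromℕ (suc n) * e x (suc n) + fromℕ (suc n) * e x (suc n)
        ≈⟨ +-cong (powerTerm-suc x n) (powerTerm-suc x n) ⟩
      x * e x n + x * e x n
        ≈⟨ (solve 2 (λ x0 x1 → x0 :* x1 :+ x0 :* x1 := x1 :* (x0 :+ x0)) ≈-refl x (e x n)) ⟩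
      e x n * (x + x)
        ≤⟨ *-monoʳ-≤ (0≤e n) (≤-trans (<⇒≤ 2x<N) (fromℕ-mono-≤ (ℕ.m≤n⇒m≤1+n N≤n))) ⟩
      e x n * fromℕ (suc n) ∎)
    tail : ∀ n → partialSum (e x) (n ℕ.+ N) + (e x (n ℕ.+ N) + e x (n ℕ.+ N)) ≤ b
    tail zero    = ≤-refl
    tail (suc n) = ≤-trans (by-≤ (halving (n ℕ.+ N) (ℕ.m≤n+m N n))
      (solve 3 (λ x0 x1 x2 → x0 :+ (x1 :+ x1) :+ (x2 :+ x2) := x0 :+ x1 :+ (x2 :+ x2) :+ x1)
              ≈-refl (partialSum (e x) (n ℕ.+ N)) (e x (n ℕ.+ N)) (e x (suc (n ℕ.+ N))))) (tail n)

  -- `∑∞` is a description and carries information only once some limit has been exhibited.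
  ∑∞-converges : ∀ {a} → ∃ (ConvergesTo (partialSum a)) → ConvergesTo (partialSum a) (∑∞ a)
  ∑∞-converges {a} = the-satisfies (ConvergesTo (partialSum a))

  exp-converges-nonneg : ∀ {x} → 0# ≤ x → ConvergesTo (partialSum (e x)) (exp x)
  exp-converges-nonneg 0≤x = ∑∞-converges
    (monotone-converges (partialSum-mono (powerTerm-nonneg 0≤x)) (proj₂ (powerSeries-bounded 0≤x)))

  exp-converges : ∀ x → ConvergesTo (partialSum (e x)) (exp x)
  exp-converges x = let X , 0≤X , x≤X = ∣∣≤-bound x in
    ∑∞-converges (dominated-converges (powerTerm-∣∣≤ x≤X) (exp-converges-nonneg 0≤X))

  exp-cong : ∀ {x y} → x ≈ y → exp x ≈ exp y
  exp-cong {x} {y} x≈y = limit-unique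
    (limit-cong (partialSum-cong (powerTerm-cong x≈y)) ≈-refl (exp-converges x)) (exp-converges y)

  -- If (C + i) uᵢ = x uᵢ₋₁ and j vⱼ = y vⱼ₋₁, split C + n + 1 as (C + i) + j in each term of the convolution.
  ⋆-recurrence : ∀ C x y u v → (∀ i → (C + fromℕ (suc i)) * u (suc i) ≈ x * u i) →
                 (∀ j → fromℕ (suc j) * v (suc j) ≈ y * v j) → ∀ n →
                 (C + fromℕ (suc n)) * (u ⋆ v) (suc n) ≈ C * (u 0 * v (suc n)) + (x + y) * (u ⋆ v) n
  ⋆-recurrence C x y u v hu hv zero = begin-equality
    (C + fromℕ 1) * (u 0 * v 1 + u 1 * v 0)
      ≈⟨ (solve 5 (λ x0 x1 x2 x3 x4 → (x0 :+ lit 1) :* (x1 :* x2 :+ x3 :* x4)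
                := x0 :* (x1 :* x2) :+ (x1 :* (lit 1 :* x2) :+ (x0 :+ lit 1) :* x3 :* x4))
              ≈-refl C (u 0) (v 1) (u 1) (v 0)) ⟩
    C * (u 0 * v 1) + (u 0 * (fromℕ 1 * v 1) + ((C + fromℕ 1) * u 1) * v 0)
      ≈⟨ +-congˡ (+-cong (*-congˡ (hv 0)) (*-congʳ (hu 0))) ⟩
    C * (u 0 * v 1) + (u 0 * (y * v 0) + (x * u 0) * v 0)
      ≈⟨ (solve 6 (λ x0 x1 x2 x3 x4 x5 → x0 :* (x1 :* x2) :+ (x1 :* (x3 :* x4) :+ x5 :* x1 :* x4)
                := x0 :* (x1 :* x2) :+ (x5 :+ x3) :* (x1 :* x4))
              ≈-refl C (u 0) (v 1) y (v 0) x) ⟩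
    C * (u 0 * v 1) + (x + y) * (u 0 * v 0)
      ∎
  ⋆-recurrence C x y u v hu hv (suc n) = begin-equality
    (C + (1# + N)) * (u 0 * v (suc (suc n)) + (u′ ⋆ v) (suc n))
      ≈⟨ (solve 5 (λ x0 x1 x2 x3 x4 → (x0 :+ (con (+ 1) :+ x1)) :* (x2 :* x3 :+ x4)
                := x0 :* (x2 :* x3) :+ (x2 :* ((con (+ 1) :+ x1) :* x3) :+ (x0 :+ con (+ 1) :+ x1) :* x4))
              ≈-refl C N (u 0) (v (suc (suc n))) ((u′ ⋆ v) (suc n))) ⟩
    C * (u 0 * v (suc (suc n))) + (u 0 * ((1# + N) * v (suc (suc n))) + ((C + 1#) + N) * (u′ ⋆ v) (suc n))
      ≈⟨ +-congˡ (+-cong (*-congˡ (hv (suc n))) (⋆-recurrence (C + 1#) x y u′ v hu′ hv n)) ⟩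
    C * (u 0 * v (suc (suc n))) + (u 0 * (y * v (suc n)) + ((C + 1#) * (u 1 * v (suc n)) + (x + y) * (u′ ⋆ v) n))
      ≈⟨ (solve 8 (λ x0 x1 x2 x3 x4 x5 x6 x7 → x0 :* (x1 :* x2) :+ (x1 :* (x3 :* x4) :+ ((x0 :+ con (+ 1)) :* (x5 :* x4) :+ (x6 :+ x3) :* x7))
                := x0 :* (x1 :* x2) :+ (x1 :* (x3 :* x4) :+ ((x0 :+ lit 1) :* x5 :* x4 :+ (x6 :+ x3) :* x7)))
              ≈-refl C (u 0) (v (suc (suc n))) y (v (suc n)) (u 1) x ((u′ ⋆ v) n)) ⟩
    C * (u 0 * v (suc (suc n))) + (u 0 * (y * v (suc n)) + (((C + fromℕ 1) * u 1) * v (suc n) + (x + y) * (u′ ⋆ v) n))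
      ≈⟨ +-congˡ (+-congˡ (+-congʳ (*-congʳ (hu 0)))) ⟩
    C * (u 0 * v (suc (suc n))) + (u 0 * (y * v (suc n)) + ((x * u 0) * v (suc n) + (x + y) * (u′ ⋆ v) n))
      ≈⟨ (solve 7 (λ x0 x1 x2 x3 x4 x5 x6 → x0 :* (x1 :* x2) :+ (x1 :* (x3 :* x4) :+ (x5 :* x1 :* x4 :+ (x5 :+ x3) :* x6))
                := x0 :* (x1 :* x2) :+ (x5 :+ x3) :* (x1 :* x4 :+ x6))
              ≈-refl C (u 0) (v (suc (suc n))) y (v (suc n)) x ((u′ ⋆ v) n)) ⟩
    C * (u 0 * v (suc (suc n))) + (x + y) * (u 0 * v (suc n) + (u′ ⋆ v) n)
      ∎
    where
    u′ = u ∘ suc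
    N = fromℕ (suc n)
    hu′ : ∀ i → ((C + 1#) + fromℕ (suc i)) * u′ (suc i) ≈ x * u′ i
    hu′ i = ≈-trans (solve 3 (λ x0 x1 x2 → (x0 :+ con (+ 1) :+ x1) :* x2 := (x0 :+ (con (+ 1) :+ x1)) :* x2)
            ≈-refl C (fromℕ (suc i)) (u′ (suc i))) (hu (suc i))

  -- The binomial theorem divided by n!: both sides start at 1 and obey (n + 1) c(n + 1) = (x + y)
  -- c(n), by `⋆-recurrence` with C = 0.
  powerTerm-+ : ∀ x y n → (e x ⋆ e y) n ≈ e (x + y) n
  powerTerm-+ x y zero = ≈-trans (*-cong (powerTerm-0 x) (powerTerm-0 y))
    (≈-trans (*-identityʳ 1#) (≈-sym (powerTerm-0 (x + y))))
  powerTerm-+ x y (suc n) = *-cancelˡ-≈ (0<fromℕ-suc n) (begin-equality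
    fromℕ (suc n) * (e x ⋆ e y) (suc n)
      ≈⟨ (solve 2 (λ x0 x1 → x0 :* x1 := (con (+ 0) :+ x0) :* x1) ≈-refl (fromℕ (suc n)) ((e x ⋆ e y) (suc n))) ⟩
    (0# + fromℕ (suc n)) * (e x ⋆ e y) (suc n)
      ≈⟨ ⋆-recurrence 0# x y (e x) (e y) (λ i → ≈-trans (*-congʳ (+-identityˡ _)) (powerTerm-suc x i)) (powerTerm-suc y) n ⟩
    0# * (e x 0 * e y (suc n)) + (x + y) * (e x ⋆ e y) n
      ≈⟨ ≈-trans (+-congʳ (zeroˡ _)) (+-identityˡ _) ⟩
    (x + y) * (e x ⋆ e y) n
      ≈⟨ *-congˡ (powerTerm-+ x y n) ⟩
    (x + y) * e (x + y) n
      ≈⟨ powerTerm-suc (x + y) n ⟨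
    fromℕ (suc n) * e (x + y) (suc n) ∎)

  powerSeries-≤-exp : ∀ {x} → 0# ≤ x → ∀ n → partialSum (e x) n ≤ exp x
  powerSeries-≤-exp 0≤x = monotone-limit-≥ (partialSum-mono (powerTerm-nonneg 0≤x)) (exp-converges-nonneg 0≤x)

  -- The form of Mertens' theorem shared by the addition theorems: the terms of an exponential
  -- series majorise each factor.
  dominated-mertens : ∀ {a b x y X Y α β} → ∣ x ∣≤ X → ∣ y ∣≤ Y →
    (∀ n → ∣ a n ∣≤ e X n) → (∀ n → ∣ b n ∣≤ e Y n) →
    ConvergesTo (partialSum a) α → ConvergesTo (partialSum b) β → ConvergesTo (partialSum (a ⋆ b)) (α * β)
  dominated-mertens x≤X y≤Y a≤ b≤ a→α b→β = mertens a≤ (exp-converges-nonneg (∣∣≤⇒0≤ x≤X)) a→α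
    (λ n → ∣∣≤-weaken (powerSeries-≤-exp (∣∣≤⇒0≤ y≤Y) n) (partialSum-∣∣≤ b≤ n)) b→β

  exp-+ : ∀ x y → exp (x + y) ≈ exp x * exp y
  exp-+ x y = let X , _ , x≤X = ∣∣≤-bound x ; Y , _ , y≤Y = ∣∣≤-bound y in
    limit-unique (exp-converges (x + y)) (limit-cong (partialSum-cong (powerTerm-+ x y)) ≈-refl
      (dominated-mertens x≤X y≤Y (powerTerm-∣∣≤ x≤X) (powerTerm-∣∣≤ y≤Y) (exp-converges x) (exp-converges y)))

  1+x≤exp : ∀ {x} → 0# ≤ x → 1# + x ≤ exp x
  1+x≤exp {x} 0≤x = ≤-trans (inj₂ (+-cong (≈-sym (≈-trans (+-identityˡ _) (powerTerm-0 x))) (≈-sym (powerTerm-1 x))))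
    (powerSeries-≤-exp 0≤x 2)

  -- Termwise e(n + 1) ≤ (n + 1) e(n + 1) = x e(n). For small x this turns into an upper bound on
  -- exp x.
  exp≤1+x*exp : ∀ {x} → 0# ≤ x → exp x ≤ 1# + x * exp x
  exp≤1+x*exp {x} 0≤x = limit-mono (0 , λ n _ → step n) (limit-suc (exp-converges x))
    (limit-+ (limit-const 1#) (limit-*ˡ x (exp-converges x)))
    where
    term : ∀ n → e x (suc n) ≤ x * e x n
    term n = ≤-trans (≤-trans (inj₂ (≈-sym (*-identityˡ _)))
      (*-monoˡ-≤ (powerTerm-nonneg 0≤x (suc n)) (1≤fromℕ-suc n))) (inj₂ (powerTerm-suc x n))
    step : ∀ n → partialSum (e x) (suc n) ≤ 1# + x * partialSum (e x) n
    step zero    = inj₂ (≈-trans (+-congˡ (powerTerm-0 x)) (solve 1 (λ x0 → con (+ 0) :+ con (+ 1) := con (+ 1) :+ x0 :* con (+ 0))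
            ≈-refl x))
    step (suc n) = by-≤ (step n +-≤ term n)
      (solve 5 (λ x0 x1 x2 x3 x4 → con (+ 1) :+ x0 :* (x1 :+ x2) :+ (x3 :+ x4)
                := x3 :+ x4 :+ (con (+ 1) :+ x0 :* x1 :+ x0 :* x2))
              ≈-refl x (partialSum (e x) n) (e x n) (partialSum (e x) (suc n)) (e x (suc n)))

-- Sine and cosine: addition theorems and estimates

module Trigonometry (lem : ExcludedMiddle 0ℓ) (R : CompleteOrderedField) where

  open OrderedField lem R
  open Series lem R
  open ExpSinCos lem R
  open ≤-Reasoning
  private e = powerTerm

  -- cosSign n + i sinSign n = iⁿ.
  cosSign sinSign : ℕ → Carrier
  cosSign zero    = 1#
  cosSign (suc n) = - sinSign n
  sinSign zero    = 0#
  sinSign (suc n) = cosSign n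

  -- Zero terms are kept so that both series share the index of the exponential series, its
  -- majorants and its Cauchy products.
  cosTerm sinTerm : Carrier → ℕ → Carrier
  cosTerm x n = cosSign n * e x n
  sinTerm x n = sinSign n * e x n

  cos : Carrier → Carrier
  cos x = ∑∞ (cosTerm x)

  ∣1∣≤1 : ∣ 1# ∣≤ 1#
  ∣1∣≤1 = nonneg⇒∣∣≤ 0≤1

  cosSign-∣∣≤ : ∀ n → ∣ cosSign n ∣≤ 1#
  sinSign-∣∣≤ : ∀ n → ∣ sinSign n ∣≤ 1#
  cosSign-∣∣≤ zero    = ∣1∣≤1
  cosSign-∣∣≤ (suc n) = ∣-∣≤ (sinSign-∣∣≤ n)
  sinSign-∣∣≤ zero    = ∣0∣≤ 0≤1
  sinSign-∣∣≤ (suc n) = cosSign-∣∣≤ n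

  cosTerm-∣∣≤ : ∀ {x X} → ∣ x ∣≤ X → ∀ n → ∣ cosTerm x n ∣≤ e X n
  cosTerm-∣∣≤ x≤X n = ∣∣≤-cong ≈-refl (*-identityˡ _) (∣*∣≤ (cosSign-∣∣≤ n) (powerTerm-∣∣≤ x≤X n))

  sinTerm-∣∣≤ : ∀ {x X} → ∣ x ∣≤ X → ∀ n → ∣ sinTerm x n ∣≤ e X n
  sinTerm-∣∣≤ x≤X n = ∣∣≤-cong ≈-refl (*-identityˡ _) (∣*∣≤ (sinSign-∣∣≤ n) (powerTerm-∣∣≤ x≤X n))

  cos-converges : ∀ x → ConvergesTo (partialSum (cosTerm x)) (cos x)
  cos-converges x = let X , 0≤X , x≤X = ∣∣≤-bound x in
    ∑∞-converges (dominated-converges (cosTerm-∣∣≤ x≤X) (exp-converges-nonneg 0≤X))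

  -- Exposes two successors at each step, which is the step at which the signs reproduce themselves
  -- up to negation.
  double : ℕ → ℕ
  double zero    = zero
  double (suc n) = suc (suc (double n))

  sign : ℕ → Carrier
  sign n = (- 1#) ^ n

  cosSign-double : ∀ n → cosSign (double n) ≈ sign n
  cosSign-double zero    = ≈-refl
  cosSign-double (suc n) = ≈-trans (-‿cong (cosSign-double n)) (solve 1 (λ x0 → (:- x0) := (:- (con (+ 1))) :* x0)
          ≈-refl (sign n))

  sinSign-double : ∀ n → sinSign (double n) ≈ 0#
  sinSign-double zero    = ≈-refl
  sinSign-double (suc n) = ≈-trans (-‿cong (sinSign-double n)) (solve 0 ((:- (con (+ 0))) := con (+ 0)) ≈-refl)

  n≤double : ∀ n → n ℕ.≤ double n
  n≤double zero    = z≤n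
  n≤double (suc n) = s≤s (ℕ.m≤n⇒m≤1+n (n≤double n))

  2*n+1≡ : ∀ n → 2 ℕ.* n ℕ.+ 1 ≡ suc (double n)
  2*n+1≡ zero    = ≡.refl
  2*n+1≡ (suc n) = ≡.trans (≡.cong (ℕ._+ 1) (ℕ.*-suc 2 n)) (≡.cong (suc ∘ suc) (2*n+1≡ n))

  oddTerm : Carrier → ℕ → Carrier
  oddTerm x n = e x (suc (double n))

  alternating : (ℕ → Carrier) → ℕ → Carrier
  alternating t n = sign n * t n

  partialSum-oddTerm : ∀ x n → partialSum (alternating (oddTerm x)) n ≈ partialSum (sinTerm x) (double n)
  partialSum-oddTerm x zero    = ≈-refl
  partialSum-oddTerm x (suc n) = begin-equality
    partialSum (alternating (oddTerm x)) n + sign n * oddTerm x n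
      ≈⟨ +-cong (partialSum-oddTerm x n) (*-congʳ (≈-sym (cosSign-double n))) ⟩
    S + sinTerm x (suc (double n))
      ≈⟨ +-congʳ (≈-sym (≈-trans (+-congˡ (≈-trans (*-congʳ (sinSign-double n)) (zeroˡ _))) (+-identityʳ _))) ⟩
    (S + sinTerm x (double n)) + sinTerm x (suc (double n))
      ∎
    where S = partialSum (sinTerm x) (double n)

  limit-double : ∀ {a l} → ConvergesTo a l → ConvergesTo (a ∘ double) l
  limit-double a→l ε 0<ε with a→l ε 0<ε
  ... | N , close = N , λ n N≤n → close (double n) (ℕ.≤-trans N≤n (n≤double n))

  -- The partial sums in the definition of `sin` are those of the padded series taken at even
  -- indices, and a subsequence has the same limit.
  sin-converges : ∀ x → ConvergesTo (partialSum (sinTerm x)) (sin x)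
  sin-converges x = limit-cong (λ _ → ≈-refl) (limit-unique odd→l (∑∞-converges (l , odd→l))) →l
    where
    X = proj₁ (∣∣≤-bound x)
    convergent = dominated-converges (sinTerm-∣∣≤ (proj₂ (proj₂ (∣∣≤-bound x)))) (exp-converges-nonneg (proj₁ (proj₂ (∣∣≤-bound x))))
    l = proj₁ convergent
    →l = proj₂ convergent
    term : ∀ n → alternating (oddTerm x) n ≈ sign n * e x (2 ℕ.* n ℕ.+ 1)
    term n = *-congˡ (≈-reflexive (≡.cong (e x) (≡.sym (2*n+1≡ n))))
    odd→l = limit-cong (λ n → ≈-trans (≈-sym (partialSum-oddTerm x n)) (partialSum-cong term n)) ≈-refl (limit-double →l)

  sin-converges-odd : ∀ x → ConvergesTo (partialSum (alternating (oddTerm x))) (sin x)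
  sin-converges-odd x = limit-cong (λ n → ≈-sym (partialSum-oddTerm x n)) ≈-refl (limit-double (sin-converges x))

  sin-cong : ∀ {x y} → x ≈ y → sin x ≈ sin y
  sin-cong {x} {y} x≈y = limit-unique
    (limit-cong (partialSum-cong (λ n → *-congˡ (powerTerm-cong x≈y n))) ≈-refl (sin-converges x)) (sin-converges y)

  cos-cong : ∀ {x y} → x ≈ y → cos x ≈ cos y
  cos-cong {x} {y} x≈y = limit-unique
    (limit-cong (partialSum-cong (λ n → *-congˡ (powerTerm-cong x≈y n))) ≈-refl (cos-converges x)) (cos-converges y)

  -- The real and imaginary parts of a geometric sequence of ratio i.
  record Rotating (p q : ℕ → Carrier) : Set where
    constructor rotating
    field
      p-suc : ∀ n → p (suc n) ≈ - q n
      q-suc : ∀ n → q (suc n) ≈ p n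

  rotating-suc : ∀ {p q} → Rotating p q → Rotating (p ∘ suc) (q ∘ suc)
  rotating-suc (rotating p-suc q-suc) = rotating (p-suc ∘ suc) (q-suc ∘ suc)

  rotating-signs : ∀ {p q} → Rotating p q → ∀ n → p n ≈ p 0 * cosSign n - q 0 * sinSign n
  rotating-signs {p} {q} r zero    = (solve 2 (λ x0 x1 → x0 := x0 :* con (+ 1) :- x1 :* con (+ 0))
          ≈-refl (p 0) (q 0))
  rotating-signs {p} {q} r (suc n) = begin-equality
    p (suc n)                                   ≈⟨ rotating-signs (rotating-suc r) n ⟩
    p 1 * cosSign n - q 1 * sinSign n           ≈⟨ +-cong (*-congʳ (p-suc 0)) (-‿cong (*-congʳ (q-suc 0))) ⟩
    (- q 0) * cosSign n - p 0 * sinSign n       ≈⟨ (solve 4 (λ x0 x1 x2 x3 → (:- x0) :* x1 :- x2 :* x3 := x2 :* (:- x3) :- x0 :* x1)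
            ≈-refl (q 0) (cosSign n) (p 0) (sinSign n)) ⟩
    p 0 * (- sinSign n) - q 0 * cosSign n       ∎
    where open Rotating r

  _∙_ : (ℕ → Carrier) → (ℕ → Carrier) → ℕ → Carrier
  (a ∙ b) n = a n * b n

  -- With p + i q = c iⁿ, the real part of c iʲ⁺ᵏ = (c iʲ) iᵏ is distributed over the terms of the
  -- convolution. A general c is required because the induction shifts p and q.
  ⋆-rotating : ∀ {p q} → Rotating p q → ∀ u v n →
    p n * (u ⋆ v) n ≈ ((p ∙ u) ⋆ (cosSign ∙ v)) n - ((q ∙ u) ⋆ (sinSign ∙ v)) n
  ⋆-rotating {p} {q} r u v zero =
    (solve 4 (λ x0 x1 x2 x3 → x0 :* (x1 :* x2) := x0 :* x1 :* (con (+ 1) :* x2) :- x3 :* x1 :* (con (+ 0) :* x2))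
            ≈-refl (p 0) (u 0) (v 0) (q 0))
  ⋆-rotating {p} {q} r u v (suc n) = begin-equality
    p (suc n) * (u 0 * v (suc n) + W)
      ≈⟨ (solve 4 (λ x0 x1 x2 x3 → x0 :* (x1 :* x2 :+ x3) := x0 :* (x1 :* x2) :+ x0 :* x3)
              ≈-refl (p (suc n)) (u 0) (v (suc n)) W) ⟩
    p (suc n) * (u 0 * v (suc n)) + p (suc n) * W
      ≈⟨ +-cong (*-congʳ (rotating-signs r (suc n))) (⋆-rotating (rotating-suc r) (u ∘ suc) v n) ⟩
    (p 0 * cosSign (suc n) - q 0 * sinSign (suc n)) * (u 0 * v (suc n)) + (C - S)
      ≈⟨ (solve 8 (λ x0 x1 x2 x3 x4 x5 x6 x7 → (x0 :* x1 :- x2 :* x3) :* (x4 :* x5) :+ (x6 :- x7)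
                := x0 :* x4 :* (x1 :* x5) :+ x6 :- (x2 :* x4 :* (x3 :* x5) :+ x7))
              ≈-refl (p 0) (cosSign (suc n)) (q 0) (sinSign (suc n)) (u 0) (v (suc n)) C S) ⟩
    ((p 0 * u 0) * (cosSign (suc n) * v (suc n)) + C) - ((q 0 * u 0) * (sinSign (suc n) * v (suc n)) + S)
      ∎
    where
    W = ((u ∘ suc) ⋆ v) n
    C = (((p ∘ suc) ∙ (u ∘ suc)) ⋆ (cosSign ∙ v)) n
    S = (((q ∘ suc) ∙ (u ∘ suc)) ⋆ (sinSign ∙ v)) n

  limit-minus : ∀ {a b l m} → ConvergesTo a l → ConvergesTo b m → ConvergesTo (λ n → a n - b n) (l - m)
  limit-minus a→l b→m = limit-+ a→l (limit-neg b→m)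

  partialSum-neg : ∀ a n → partialSum (λ i → - a i) n ≈ - partialSum a n
  partialSum-neg a n = ≈-trans (partialSum-cong (λ i → (solve 1 (λ x0 → (:- x0) := (:- (con (+ 1))) :* x0)
          ≈-refl (a i))) n)
    (≈-trans (partialSum-*ˡ (- 1#) a n) (solve 1 (λ x0 → (:- (con (+ 1))) :* x0 := (:- x0))
            ≈-refl (partialSum a n)))

  partialSum-minus : ∀ a b n → partialSum (λ i → a i - b i) n ≈ partialSum a n - partialSum b n
  partialSum-minus a b n = ≈-trans (partialSum-+ a (λ i → - b i) n) (+-congˡ (partialSum-neg b n))

  cos-+ : ∀ x y → cos (x + y) ≈ cos x * cos y - sin x * sin y
  cos-+ x y = let X , _ , x≤X = ∣∣≤-bound x ; Y , _ , y≤Y = ∣∣≤-bound y in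
    limit-unique (cos-converges (x + y)) (limit-cong
      (λ n → ≈-sym (≈-trans (partialSum-cong term n) (partialSum-minus _ _ n))) ≈-refl
      (limit-minus (dominated-mertens x≤X y≤Y (cosTerm-∣∣≤ x≤X) (cosTerm-∣∣≤ y≤Y) (cos-converges x) (cos-converges y))
               (dominated-mertens x≤X y≤Y (sinTerm-∣∣≤ x≤X) (sinTerm-∣∣≤ y≤Y) (sin-converges x) (sin-converges y))))
    where
    term : ∀ n → cosTerm (x + y) n ≈ (cosTerm x ⋆ cosTerm y) n - (sinTerm x ⋆ sinTerm y) n
    term n = ≈-trans (*-congˡ (≈-sym (powerTerm-+ x y n)))
      (⋆-rotating (rotating (λ _ → ≈-refl) (λ _ → ≈-refl)) (e x) (e y) n)

  -- `sinSign n` is the real part of -i iⁿ, whose imaginary part is minus `cosSign n`; the same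
  -- computation as for the cosine then applies.
  sin-+ : ∀ x y → sin (x + y) ≈ sin x * cos y + cos x * sin y
  sin-+ x y = let X , _ , x≤X = ∣∣≤-bound x ; Y , _ , y≤Y = ∣∣≤-bound y in
    limit-unique (sin-converges (x + y)) (limit-cong
      (λ n → ≈-sym (≈-trans (partialSum-cong term n) (partialSum-minus _ _ n)))
      (solve 4 (λ x0 x1 x2 x3 → x0 :* x1 :- (:- x2) :* x3 := x0 :* x1 :+ x2 :* x3)
              ≈-refl (sin x) (cos y) (cos x) (sin y))
      (limit-minus (dominated-mertens x≤X y≤Y (sinTerm-∣∣≤ x≤X) (cosTerm-∣∣≤ y≤Y) (sin-converges x) (cos-converges y))
               (dominated-mertens x≤X y≤Y (λ n → ∣∣≤-cong (solve 2 (λ x0 x1 → (:- (x0 :* x1)) := (:- x0) :* x1)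
                       ≈-refl (cosSign n) (e x n)) ≈-refl (∣-∣≤ (cosTerm-∣∣≤ x≤X n)))
                 (sinTerm-∣∣≤ y≤Y)
                 (limit-cong (λ n → ≈-trans (≈-sym (partialSum-neg (cosTerm x) n))
                   (partialSum-cong (λ i → (solve 2 (λ x0 x1 → (:- (x0 :* x1)) := (:- x0) :* x1)
                           ≈-refl (cosSign i) (e x i))) n)) ≈-refl (limit-neg (cos-converges x)))
                 (sin-converges y))))
    where
    term : ∀ n → sinTerm (x + y) n ≈ (sinTerm x ⋆ cosTerm y) n - (((λ i → - cosSign i) ∙ e x) ⋆ sinTerm y) n
    term n = ≈-trans (*-congˡ (≈-sym (powerTerm-+ x y n)))
      (⋆-rotating (rotating (λ n → (solve 1 (λ x0 → x0 := (:- ((:- x0))))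
              ≈-refl (cosSign n))) (λ n → (solve 1 (λ x0 → (:- ((:- x0))) := x0)
              ≈-refl (sinSign n)))) (e x) (e y) n)

  -- Expresses that the signs vanish at indices of the wrong parity; each step of the induction
  -- trades one family for the other.
  cosSign-neg : ∀ x n → cosSign n * (- x) ^ n ≈ cosSign n * x ^ n
  sinSign-neg : ∀ x n → sinSign n * (- x) ^ n ≈ - (sinSign n * x ^ n)
  cosSign-neg x zero    = ≈-refl
  cosSign-neg x (suc n) = begin-equality
    (- sinSign n) * (- x * (- x) ^ n)     ≈⟨ (solve 3 (λ x0 x1 x2 → (:- x0) :* ((:- x1) :* x2) := x1 :* (x0 :* x2))
            ≈-refl (sinSign n) x ((- x) ^ n)) ⟩
    x * (sinSign n * (- x) ^ n)           ≈⟨ *-congˡ (sinSign-neg x n) ⟩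
    x * - (sinSign n * x ^ n)             ≈⟨ (solve 3 (λ x0 x1 x2 → x0 :* (:- (x1 :* x2)) := (:- x1) :* (x0 :* x2))
            ≈-refl x (sinSign n) (x ^ n)) ⟩
    (- sinSign n) * (x * x ^ n)           ∎
  sinSign-neg x zero    = (solve 0 (con (+ 0) :* con (+ 1) := (:- (con (+ 0) :* con (+ 1)))) ≈-refl)
  sinSign-neg x (suc n) = begin-equality
    cosSign n * (- x * (- x) ^ n)         ≈⟨ (solve 3 (λ x0 x1 x2 → x0 :* ((:- x1) :* x2) := (:- (x1 :* (x0 :* x2))))
            ≈-refl (cosSign n) x ((- x) ^ n)) ⟩
    - (x * (cosSign n * (- x) ^ n))       ≈⟨ -‿cong (*-congˡ (cosSign-neg x n)) ⟩
    - (x * (cosSign n * x ^ n))           ≈⟨ (solve 3 (λ x0 x1 x2 → (:- (x0 :* (x1 :* x2))) := (:- (x1 :* (x0 :* x2))))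
            ≈-refl x (cosSign n) (x ^ n)) ⟩
    - (cosSign n * (x * x ^ n))           ∎

  cos-neg : ∀ x → cos (- x) ≈ cos x
  cos-neg x = limit-unique (cos-converges (- x)) (limit-cong (partialSum-cong term) ≈-refl (cos-converges x))
    where
    term : ∀ n → cosTerm x n ≈ cosTerm (- x) n
    term n = let f = fromℕ (n !) ⁻¹ in begin-equality
      cosSign n * (x ^ n * f)       ≈⟨ (solve 3 (λ x0 x1 x2 → x0 :* (x1 :* x2) := x0 :* x1 :* x2)
              ≈-refl (cosSign n) (x ^ n) f) ⟩
      cosSign n * x ^ n * f         ≈⟨ *-congʳ (cosSign-neg x n) ⟨
      cosSign n * (- x) ^ n * f     ≈⟨ (solve 3 (λ x0 x1 x2 → x0 :* x1 :* x2 := x0 :* (x1 :* x2))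
              ≈-refl (cosSign n) ((- x) ^ n) f) ⟩
      cosSign n * ((- x) ^ n * f)   ∎

  sin-neg : ∀ x → sin (- x) ≈ - sin x
  sin-neg x = limit-unique (sin-converges (- x)) (limit-cong
    (λ n → ≈-trans (≈-sym (partialSum-neg (sinTerm x) n)) (partialSum-cong term n)) ≈-refl (limit-neg (sin-converges x)))
    where
    term : ∀ n → - sinTerm x n ≈ sinTerm (- x) n
    term n = let f = fromℕ (n !) ⁻¹ in begin-equality
      - (sinSign n * (x ^ n * f))   ≈⟨ (solve 3 (λ x0 x1 x2 → (:- (x0 :* (x1 :* x2))) := (:- (x0 :* x1)) :* x2)
              ≈-refl (sinSign n) (x ^ n) f) ⟩
      - (sinSign n * x ^ n) * f     ≈⟨ *-congʳ (sinSign-neg x n) ⟨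
      sinSign n * (- x) ^ n * f     ≈⟨ (solve 3 (λ x0 x1 x2 → x0 :* x1 :* x2 := x0 :* (x1 :* x2))
              ≈-refl (sinSign n) ((- x) ^ n) f) ⟩
      sinSign n * ((- x) ^ n * f)   ∎

  partialSum-zero : ∀ {a} → (∀ n → a n ≈ 0#) → ∀ n → partialSum a n ≈ 0#
  partialSum-zero a≈0 zero    = ≈-refl
  partialSum-zero a≈0 (suc n) = ≈-trans (+-cong (partialSum-zero a≈0 n) (a≈0 n)) (+-identityˡ 0#)

  cos-0 : cos 0# ≈ 1#
  cos-0 = limit-unique (limit-suc (cos-converges 0#)) (limit-cong
    (λ n → ≈-sym (≈-trans (partialSum-suc (cosTerm 0#) n)
      (≈-trans (+-cong (≈-trans (*-identityˡ _) (powerTerm-0 0#)) (partialSum-zero (λ i → vanish i) n)) (+-identityʳ 1#))))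
    ≈-refl (limit-const 1#))
    where
    vanish : ∀ i → cosTerm 0# (suc i) ≈ 0#
    vanish i = (solve 3 (λ x0 x1 x2 → x0 :* (con (+ 0) :* x1 :* x2) := con (+ 0))
            ≈-refl (cosSign (suc i)) (0# ^ i) (fromℕ (suc i !) ⁻¹))

  -- The addition theorem for the cosine at x and -x.
  sin²+cos²≈1 : ∀ x → sin x * sin x + cos x * cos x ≈ 1#
  sin²+cos²≈1 x = begin-equality
    sin x * sin x + cos x * cos x              ≈⟨ (solve 2 (λ x0 x1 → x0 :* x0 :+ x1 :* x1 := x1 :* x1 :- x0 :* (:- x0))
            ≈-refl (sin x) (cos x)) ⟩
    cos x * cos x - sin x * (- sin x)          ≈⟨ +-cong (*-congˡ (cos-neg x)) (-‿cong (*-congˡ (sin-neg x))) ⟨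
    cos x * cos (- x) - sin x * sin (- x)      ≈⟨ cos-+ x (- x) ⟨
    cos (x - x)                                ≈⟨ cos-cong (solve 1 (λ x0 → x0 :- x0 := con (+ 0)) ≈-refl x) ⟩
    cos 0#                                     ≈⟨ cos-0 ⟩
    1#                                         ∎

  -- Alternating series and estimates of the sine on [0, 2]

  alternating-suc : ∀ t N →
    partialSum (alternating t) (suc N) ≈ t 0 - partialSum (alternating (t ∘ suc)) N
  alternating-suc t N = ≈-trans (partialSum-suc (alternating t) N) (+-cong (*-identityˡ (t 0))
    (≈-trans (partialSum-cong (λ n → (solve 2 (λ x0 x1 → (:- (con (+ 1))) :* x0 :* x1 := (:- (x0 :* x1)))
            ≈-refl (sign n) (t (suc n)))) N) (partialSum-neg _ N)))

  -- By induction on the shifted sequence: what is subtracted from t 0 lies between 0 and t 1, which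
  -- is at most t 0.
  leibniz : ∀ {t} → (∀ n → 0# ≤ t n) → (∀ n → t (suc n) ≤ t n) →
            ∀ N → 0# ≤ partialSum (alternating t) N × partialSum (alternating t) N ≤ t 0
  leibniz 0≤t t↓ zero = ≤-refl , 0≤t 0
  leibniz {t} 0≤t t↓ (suc N) =
    let 0≤A , A≤t₁ = leibniz (0≤t ∘ suc) (t↓ ∘ suc) N
    in ≤-trans (0≤y-x (≤-trans A≤t₁ (t↓ 0))) (inj₂ (≈-sym unfold))
     , ≤-trans (inj₂ unfold) (by-≤ 0≤A (solve 2 (λ x0 x1 → x0 :+ con (+ 0) := x0 :- x1 :+ x1) ≈-refl (t 0) A))
    where
    A = partialSum (alternating (t ∘ suc)) N
    unfold = alternating-suc t N

  leibniz-lower : ∀ {t} → (∀ n → 0# ≤ t n) → (∀ n → t (suc n) ≤ t n) →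
                  ∀ N → t 0 - t 1 ≤ partialSum (alternating t) (suc N)
  leibniz-lower {t} 0≤t t↓ N = ≤-trans (by-≤ (proj₂ (leibniz (0≤t ∘ suc) (t↓ ∘ suc) N)) (solve 3 (λ x0 x1 x2 → x0 :- x1 :+ x1 := x0 :- x2 :+ x2)
          ≈-refl (t 0) A (t 1)))
    (inj₂ (≈-sym unfold))
    where
    A = partialSum (alternating (t ∘ suc)) N
    unfold = alternating-suc t N

  -- The ratio is x / (n + 2), at most 1 for x ≤ 2. The first ratio is x itself and may exceed 1,
  -- hence the start at index 1.
  powerTerm-decreasing : ∀ {x} → 0# ≤ x → x ≤ fromℕ 2 → ∀ n → e x (suc (suc n)) ≤ e x (suc n)
  powerTerm-decreasing {x} 0≤x x≤2 n = *-cancelʳ-≤ (0<fromℕ-suc (suc n)) (begin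
    e x (suc (suc n)) * fromℕ (suc (suc n))     ≈⟨ *-comm _ _ ⟩
    fromℕ (suc (suc n)) * e x (suc (suc n))     ≈⟨ powerTerm-suc x (suc n) ⟩
    x * e x (suc n)                             ≤⟨ *-monoˡ-≤ (powerTerm-nonneg 0≤x (suc n)) (≤-trans x≤2 (fromℕ-mono-≤ {2} {suc (suc n)} (s≤s (s≤s z≤n)))) ⟩
    fromℕ (suc (suc n)) * e x (suc n)           ≈⟨ *-comm _ _ ⟩
    e x (suc n) * fromℕ (suc (suc n))           ∎)

  module _ {x : Carrier} (0≤x : 0# ≤ x) (x≤2 : x ≤ fromℕ 2) where

    private
      0≤t : ∀ n → 0# ≤ oddTerm x n
      0≤t n = powerTerm-nonneg 0≤x (suc (double n))
      t↓ : ∀ n → oddTerm x (suc n) ≤ oddTerm x n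
      t↓ n = ≤-trans (powerTerm-decreasing 0≤x x≤2 (suc (double n))) (powerTerm-decreasing 0≤x x≤2 (double n))

    sin-≤ : sin x ≤ x
    sin-≤ = limit-≤ (0 , λ N _ → ≤-trans (proj₂ (leibniz 0≤t t↓ N)) (inj₂ (powerTerm-1 x))) (sin-converges-odd x)

    -- The first two terms of the alternating series, multiplied by 3! = 6 to clear the denominator.
    sin-≥ : fromℕ 6 * x - x * (x * x) ≤ fromℕ 6 * sin x
    sin-≥ = begin
      fromℕ 6 * x - x * (x * x)
        ≈⟨ +-cong (*-congˡ (powerTerm-1 x)) (-‿cong cube) ⟨
      fromℕ 6 * e x 1 - fromℕ 6 * e x 3
        ≈⟨ (solve 2 (λ x0 x1 → lit 6 :* x0 :- lit 6 :* x1 := lit 6 :* (x0 :- x1)) ≈-refl (e x 1) (e x 3)) ⟩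
      fromℕ 6 * (e x 1 - e x 3)
        ≤⟨ *-monoʳ-≤ (0≤fromℕ 6) (limit-≥ (0 , λ N _ → leibniz-lower 0≤t t↓ N) (limit-suc (sin-converges-odd x))) ⟩
      fromℕ 6 * sin x
        ∎
      where
      cube : fromℕ 6 * e x 3 ≈ x * (x * x)
      cube = begin-equality
        fromℕ 6 * e x 3                    ≈⟨ (solve 1 (λ x0 → lit 6 :* x0 := lit 2 :* (lit 3 :* x0))
                ≈-refl (e x 3)) ⟩
        fromℕ 2 * (fromℕ 3 * e x 3)        ≈⟨ *-congˡ (powerTerm-suc x 2) ⟩
        fromℕ 2 * (x * e x 2)              ≈⟨ (solve 2 (λ x0 x1 → lit 2 :* (x0 :* x1) := x0 :* (lit 2 :* x1))
                ≈-refl x (e x 2)) ⟩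
        x * (fromℕ 2 * e x 2)              ≈⟨ *-congˡ (≈-trans (powerTerm-suc x 1) (*-congˡ (powerTerm-1 x))) ⟩
        x * (x * x)                        ∎

-- Continuity and first zeros

module PiLnPowers (lem : ExcludedMiddle 0ℓ) (R : CompleteOrderedField) where

  open OrderedField lem R
  open Series lem R
  open ExpSinCos lem R
  open Trigonometry lem R
  open ≤-Reasoning

  min₂ : ∀ {a b} → 0# < a → 0# < b → ∃ λ d → 0# < d × d ≤ a × d ≤ b
  min₂ {a} {b} 0<a 0<b with ≤-total a b
  ... | inj₁ a≤b = a , 0<a , ≤-refl , a≤b
  ... | inj₂ b≤a = b , 0<b , b≤a , ≤-refl

  Continuous : (Carrier → Carrier) → Set
  Continuous f = ∀ x ε → 0# < ε → ∃ λ δ → 0# < δ × (∀ y → ∣ y - x ∣≤ δ → ∣ f y - f x ∣≤ ε)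

  -- An intermediate value theorem that delivers the first zero, as the supremum of the points up to
  -- which f stays positive. Positivity before it is what makes π least.
  module FirstZero (f : Carrier → Carrier) (f-cong : ∀ {x y} → x ≈ y → f x ≈ f y) (f-continuous : Continuous f)
                   {a b : Carrier} (a≤b : a ≤ b) (0<fa : 0# < f a) (fb≤0 : f b ≤ 0#) where

    private
      Pos : Carrier → Set
      Pos y = a ≤ y × y ≤ b × (∀ u → a ≤ u → u ≤ y → 0# < f u)

      pos-a : Pos a
      pos-a = ≤-refl , a≤b , λ u a≤u u≤a → <-≤-trans 0<fa (inj₂ (f-cong (≤-antisym a≤u u≤a)))

      supremum = complete Pos (a , pos-a) (b , λ _ p → proj₁ (proj₂ p))

    first : Carrier
    first = proj₁ supremum

    private
      upper : ∀ y → Pos y → y ≤ first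
      upper = proj₁ (proj₂ supremum)

    first≤b : first ≤ b
    first≤b = proj₂ (proj₂ supremum) b λ _ p → proj₁ (proj₂ p)

    positive-before : ∀ y → a ≤ y → y < first → 0# < f y
    positive-before y a≤y y<first with lem {∃ λ p → Pos p × y < p}
    ... | yes (p , (_ , _ , pos) , y<p) = pos y a≤y (<⇒≤ y<p)
    ... | no ¬∃ = contradiction y<first (≤⇒≯ (proj₂ (proj₂ supremum) y λ p pos → ≮⇒≥ λ y<p → ¬∃ (p , pos , y<p)))

    private
      -- Continuity would extend positivity to `first + δ`, beyond the supremum, or up to b where f
      -- is nonpositive.
      not-positive : ¬ 0# < f first
      not-positive 0<fz with f-continuous first (½ * f first) (0<half 0<fz)
      ... | δ , 0<δ , close with ≤-total (first + δ) b
      ...   | inj₁ z+δ≤b = ≤⇒≯ (upper (first + δ) (≤-trans (upper a pos-a) z≤z+δ , z+δ≤b , positive)) z<z+δ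
        where
        z<z+δ : first < first + δ
        z<z+δ = by-< 0<δ (solve 2 (λ x0 x1 → x0 :+ x1 :+ con (+ 0) := x0 :+ x1) ≈-refl first δ)
        z≤z+δ = <⇒≤ z<z+δ
        positive : ∀ u → a ≤ u → u ≤ first + δ → 0# < f u
        positive u a≤u u≤z+δ with <-≤-total u first
        ... | inj₁ u<z = positive-before u a≤u u<z
        ... | inj₂ z≤u = by-< (proj₁ (close u (by-≤ (z≤u +-≤ <⇒≤ 0<δ) (solve 3 (λ x0 x1 x2 → x0 :- x1 :+ (x1 :+ con (+ 0)) := (:- x2) :+ (x0 :+ x2))
                ≈-refl u first δ)
                                               , by-≤ u≤z+δ (solve 3 (λ x0 x1 x2 → x0 :+ x1 := x1 :- x2 :+ (x2 :+ x0))
                                                       ≈-refl δ u first))) +-≤< 0<half 0<fz)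
            (≈-trans (solve 3 (λ x0 x1 x2 → x0 :+ ((:- (x1 :* x2)) :+ con (+ 0)) := x0 :- x2 :+ (x2 :- x1 :* x2))
                    ≈-refl (f u) ½ (f first))
              (≈-trans (+-congˡ (+-congʳ (≈-sym (half (f first)))))
                (solve 3 (λ x0 x1 x2 → x0 :- x1 :+ (x2 :* x1 :+ x2 :* x1 :- x2 :* x1) := con (+ 0) :+ (x0 :- x1 :+ x2 :* x1))
                        ≈-refl (f u) (f first) ½)))
      ...   | inj₂ b≤z+δ = ≤⇒≯ fb≤0 (by-< (proj₁ (close b
                (by-≤ (first≤b +-≤ <⇒≤ 0<δ) (solve 3 (λ x0 x1 x2 → x0 :- x1 :+ (x1 :+ con (+ 0)) := (:- x2) :+ (x0 :+ x2))
                        ≈-refl b first δ)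
                , by-≤ b≤z+δ (solve 3 (λ x0 x1 x2 → x0 :+ x1 := x1 :- x2 :+ (x2 :+ x0))
                        ≈-refl δ b first))) +-≤< 0<half 0<fz)
            (≈-trans (solve 3 (λ x0 x1 x2 → x0 :+ ((:- (x1 :* x2)) :+ con (+ 0)) := x0 :- x2 :+ (x2 :- x1 :* x2))
                    ≈-refl (f b) ½ (f first))
              (≈-trans (+-congˡ (+-congʳ (≈-sym (half (f first)))))
                (solve 3 (λ x0 x1 x2 → x0 :- x1 :+ (x2 :* x1 :+ x2 :* x1 :- x2 :* x1) := con (+ 0) :+ (x0 :- x1 :+ x2 :* x1))
                        ≈-refl (f b) (f first) ½))))

    a<first : f first ≤ 0# → a < first
    a<first fz≤0 with upper a pos-a
    ... | inj₁ a<z = a<z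
    ... | inj₂ a≈z = contradiction (<-≤-trans 0<fa (inj₂ (f-cong a≈z))) (≤⇒≯ fz≤0)

    private
      not-negative : ¬ f first < 0#
      not-negative fz<0 with f-continuous first (½ * (- f first)) (0<half (by-< fz<0 (solve 1 (λ x0 → (:- x0) :+ x0 := con (+ 0) :+ con (+ 0))
              ≈-refl (f first))))
      ... | δ , 0<δ , close = ≤⇒≯ fy≤0 (positive-before y a≤y y<z)
        where
        -- The point `first - δ` may lie to the left of a; then a itself is within δ of `first`.
        before : ∃ λ y → a ≤ y × y < first × first ≤ y + δ
        before with ≤-total a (first - δ)
        ... | inj₁ a≤z-δ = first - δ , a≤z-δ , by-< 0<δ (solve 2 (λ x0 x1 → x0 :+ con (+ 0) := x0 :- x1 :+ x1)
                ≈-refl first δ) , inj₂ (solve 2 (λ x0 x1 → x0 := x0 :- x1 :+ x1)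
                ≈-refl first δ)
        ... | inj₂ z-δ≤a = a , ≤-refl , a<first (<⇒≤ fz<0) , by-≤ z-δ≤a (solve 3 (λ x0 x1 x2 → x0 :+ x1 :+ (x2 :- x1) := x2 :+ x0)
                ≈-refl a δ first)
        y = proj₁ before
        a≤y = proj₁ (proj₂ before)
        y<z = proj₁ (proj₂ (proj₂ before))
        z≤y+δ = proj₂ (proj₂ (proj₂ before))
        fy≤0 : f y ≤ 0#
        fy≤0 = by-≤ (proj₂ (close y (by-≤ z≤y+δ (solve 3 (λ x0 x1 x2 → x0 :- x1 :+ x1 := (:- x2) :+ (x0 :+ x2))
                ≈-refl y first δ)
                                    , by-≤ (<⇒≤ y<z +-≤ <⇒≤ 0<δ) (solve 3 (λ x0 x1 x2 → x0 :+ (x1 :+ con (+ 0)) := x1 :- x2 :+ (x2 :+ x0))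
                                            ≈-refl δ y first))) +-≤ *-monoʳ-≤ (<⇒≤ 0<½) (<⇒≤ fz<0))
          (≈-trans (solve 3 (λ x0 x1 x2 → con (+ 0) :+ (x0 :- x1 :+ x2 :* x1) := x0 :+ x2 :* x1 :- x1)
                  ≈-refl (f y) (f first) ½)
            (≈-trans (+-congˡ (-‿cong (≈-sym (half (f first)))))
              (solve 3 (λ x0 x1 x2 → x0 :+ x1 :* x2 :- (x1 :* x2 :+ x1 :* x2) := x0 :+ (x1 :* (:- x2) :+ x1 :* con (+ 0)))
                      ≈-refl (f y) ½ (f first))))

    f-first≈0 : f first ≈ 0#
    f-first≈0 = ≤-antisym (≮⇒≥ not-positive) (≮⇒≥ not-negative)

  x²≤1⇒∣x∣≤1 : ∀ {x} → x * x ≤ 1# → ∣ x ∣≤ 1#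
  x²≤1⇒∣x∣≤1 {x} x²≤1 =
      ≮⇒≥ (λ x<-1 → let 1<-x = by-< x<-1 (solve 1 (λ x0 → (:- x0) :+ x0 := con (+ 1) :+ (:- (con (+ 1)))) ≈-refl x) in
        ≤⇒≯ x²≤1 (by-< (*-pos (0<y-x 1<-x) (0<+ (<-trans 0<1 1<-x) 0<1)) (solve 1 (λ x0 → x0 :* x0 :+ con (+ 0) := con (+ 1) :+ ((:- x0) :- con (+ 1)) :* ((:- x0) :+ con (+ 1)))
                ≈-refl x)))
    , ≮⇒≥ (λ 1<x → ≤⇒≯ x²≤1 (by-< (*-pos (0<y-x 1<x) (0<+ (<-trans 0<1 1<x) 0<1)) (solve 1 (λ x0 → x0 :* x0 :+ con (+ 0) := con (+ 1) :+ (x0 :- con (+ 1)) :* (x0 :+ con (+ 1)))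
            ≈-refl x)))

  ∣sin∣≤1 : ∀ x → ∣ sin x ∣≤ 1#
  ∣sin∣≤1 x = x²≤1⇒∣x∣≤1 (by-≤ (square-nonneg (cos x))
    (≈-trans (+-congʳ (≈-sym (sin²+cos²≈1 x))) (solve 2 (λ x0 x1 → x0 :* x0 :+ x1 :* x1 :+ con (+ 0) := x0 :* x0 :+ x1 :* x1)
            ≈-refl (sin x) (cos x))))

  -- For x ≤ 2 one has x³ ≤ 4x, so 6 sin x ≥ 6x - x³ ≥ 2x.
  x≤3sin : ∀ {x} → 0# ≤ x → x ≤ fromℕ 2 → x ≤ fromℕ 3 * sin x
  x≤3sin {x} 0≤x x≤2 = *-cancelʳ-≤ 0<2 (by-≤ (sin-≥ 0≤x x≤2 +-≤ *-nonneg 0≤x (0≤y-x (*-mono-≤ 0≤x 0≤x x≤2 x≤2)))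
    (solve 2 (λ x0 x1 → lit 3 :* x0 :* lit 2 :+ (lit 6 :* x1 :- x1 :* (x1 :* x1) :+ con (+ 0))
              := x1 :* lit 2 :+ (lit 6 :* x0 :+ x1 :* (lit 2 :* lit 2 :- x1 :* x1)))
            ≈-refl (sin x) x))

  0<3 : 0# < fromℕ 3
  0<3 = 0<fromℕ-suc 2

  sin-pos : ∀ {x} → 0# < x → x ≤ fromℕ 2 → 0# < sin x
  sin-pos {x} 0<x x≤2 = *-cancelʳ-< (<⇒≤ 0<3) (<-≤-trans (≤-<-trans (inj₂ (zeroˡ (fromℕ 3))) 0<x)
    (≤-trans (x≤3sin (<⇒≤ 0<x) x≤2) (inj₂ (*-comm (fromℕ 3) (sin x)))))

  sin-nonneg : ∀ {x} → 0# ≤ x → x ≤ fromℕ 2 → 0# ≤ sin x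
  sin-nonneg {x} 0≤x x≤2 = *-cancelʳ-≤ 0<3 (≤-trans (≤-trans (inj₂ (zeroˡ (fromℕ 3))) 0≤x)
    (≤-trans (x≤3sin 0≤x x≤2) (inj₂ (*-comm (fromℕ 3) (sin x)))))

  ∣sin∣≤ : ∀ {x b} → b ≤ fromℕ 2 → ∣ x ∣≤ b → ∣ sin x ∣≤ b
  ∣sin∣≤ {x} {b} b≤2 (l , u) with ≤-total 0# x
  ... | inj₁ 0≤x = ≤-trans (proj₁ (∣0∣≤ (≤-trans 0≤x u))) (sin-nonneg 0≤x (≤-trans u b≤2)) , ≤-trans (sin-≤ 0≤x (≤-trans u b≤2)) u
  ... | inj₂ x≤0 = ∣∣≤-cong (≈-trans (-‿cong (sin-neg x)) (solve 1 (λ x0 → (:- ((:- x0))) := x0)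
          ≈-refl (sin x))) ≈-refl
      (∣-∣≤ (≤-trans (proj₁ (∣0∣≤ (≤-trans 0≤-x -x≤b))) (sin-nonneg 0≤-x (≤-trans -x≤b b≤2)) , ≤-trans (sin-≤ 0≤-x (≤-trans -x≤b b≤2)) -x≤b))
    where
    0≤-x : 0# ≤ - x
    0≤-x = by-≤ x≤0 (solve 1 (λ x0 → (:- x0) :+ x0 := con (+ 0) :+ con (+ 0)) ≈-refl x)
    -x≤b : - x ≤ b
    -x≤b = by-≤ l (solve 2 (λ x0 x1 → x0 :+ (:- x0) := (:- x1) :+ x1) ≈-refl b x)

  -- Reduces continuity of the cosine to smallness of the sine near 0, where `∣sin∣≤` applies.
  cos-difference : ∀ x y → cos y - cos x ≈ - (fromℕ 2 * (sin (½ * (x + y)) * sin (½ * (y - x))))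
  cos-difference x y = begin-equality
    cos y - cos x
      ≈⟨ +-cong (cos-cong y≈m+d) (-‿cong (cos-cong x≈m-d)) ⟩
    cos (m + d) - cos (m - d)
      ≈⟨ +-cong (cos-+ m d) (-‿cong (≈-trans (cos-+ m (- d)) (+-cong (*-congˡ (cos-neg d)) (-‿cong (*-congˡ (sin-neg d)))))) ⟩
    (cos m * cos d - sin m * sin d) - (cos m * cos d - sin m * (- sin d))
      ≈⟨ (solve 4 (λ x0 x1 x2 x3 → x0 :* x1 :- x2 :* x3 :- (x0 :* x1 :- x2 :* (:- x3)) := (:- (lit 2 :* (x2 :* x3))))
              ≈-refl (cos m) (cos d) (sin m) (sin d)) ⟩
    - (fromℕ 2 * (sin m * sin d))
      ∎
    where
    m = ½ * (x + y)
    d = ½ * (y - x)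
    y≈m+d : y ≈ m + d
    y≈m+d = ≈-trans (≈-sym (half y)) (solve 3 (λ x0 x1 x2 → x0 :* x1 :+ x0 :* x1 := x0 :* (x2 :+ x1) :+ x0 :* (x1 :- x2))
            ≈-refl ½ y x)
    x≈m-d : x ≈ m - d
    x≈m-d = ≈-trans (≈-sym (half x)) (solve 3 (λ x0 x1 x2 → x0 :* x1 :+ x0 :* x1 := x0 :* (x1 :+ x2) :- x0 :* (x2 :- x1))
            ≈-refl ½ x y)

  cos-continuous : Continuous cos
  cos-continuous x ε 0<ε = let δ , 0<δ , δ≤ε , δ≤1 = min₂ 0<ε 0<1 in δ , 0<δ , λ y y-x≤δ →
    ∣∣≤-weaken δ≤ε (∣∣≤-cong (≈-sym (cos-difference x y))
      (≈-trans (solve 2 (λ x0 x1 → lit 2 :* (con (+ 1) :* (x0 :* x1)) := x0 :* x1 :+ x0 :* x1)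
              ≈-refl ½ δ) (half δ))
      (∣-∣≤ (∣*∣≤ (nonneg⇒∣∣≤ (<⇒≤ 0<2)) (∣*∣≤ (∣sin∣≤1 _) (∣sin∣≤ (½δ≤2 0<δ δ≤1) (∣*∣≤ (nonneg⇒∣∣≤ (<⇒≤ 0<½)) y-x≤δ))))))
    where
    ½δ≤2 : ∀ {δ} → 0# < δ → δ ≤ 1# → ½ * δ ≤ fromℕ 2
    ½δ≤2 {δ} 0<δ δ≤1 = ≤-trans (by-≤ (<⇒≤ (0<half 0<δ)) (≈-trans (+-identityʳ δ) (≈-sym (half δ))))
      (≤-trans δ≤1 (by-≤ 0≤1 (solve 0 (lit 2 :+ con (+ 0) := con (+ 1) :+ con (+ 1)) ≈-refl)))

  sin-double : ∀ x → sin (x + x) ≈ fromℕ 2 * (sin x * cos x)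
  sin-double x = ≈-trans (sin-+ x x) (solve 2 (λ x0 x1 → x0 :* x1 :+ x1 :* x0 := lit 2 :* (x0 :* x1))
          ≈-refl (sin x) (cos x))

  -- From 6 sin 1 ≥ 5 follows 36 sin² 1 ≥ 25, whereas 18 cos 2 = 18 - 36 sin² 1 ≥ 0 would give at
  -- most 18. The gap 7 is the contradiction.
  cos2<0 : cos (fromℕ 2) < 0#
  cos2<0 with <-≤-total (cos (fromℕ 2)) 0#
  ... | inj₁ cos2<0 = cos2<0
  ... | inj₂ 0≤cos2 = contradiction (0<fromℕ-suc 6) (≤⇒≯ (by-≤
      (*-nonneg (≤-trans 0≤cos2 (inj₂ cos2≈)) (*-nonneg (0≤fromℕ 9) (<⇒≤ 0<2)) +-≤ *-mono-≤ (0≤fromℕ 5) (0≤fromℕ 5) 5≤6sin1 5≤6sin1)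
      (solve 1 (λ x0 → con (+ 0) :+ (con (+ 0) :+ lit 5 :* lit 5)
                := lit 7 :+ ((con (+ 1) :- lit 2 :* (x0 :* x0)) :* (lit 9 :* lit 2) :+ lit 6 :* x0 :* (lit 6 :* x0)))
              ≈-refl s)))
    where
    s = sin 1#
    5≤6sin1 : fromℕ 5 ≤ fromℕ 6 * s
    5≤6sin1 = ≤-trans (inj₂ (solve 0 (lit 5 := lit 6 :* con (+ 1) :- con (+ 1) :* (con (+ 1) :* con (+ 1)))
            ≈-refl)) (sin-≥ 0≤1 (by-≤ 0≤1 (solve 0 (lit 2 :+ con (+ 0) := con (+ 1) :+ con (+ 1))
            ≈-refl)))
    cos2≈ : cos (fromℕ 2) ≈ 1# - fromℕ 2 * (s * s)
    cos2≈ = begin-equality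
      cos (fromℕ 2)                                              ≈⟨ cos-cong (solve 0 (lit 2 := con (+ 1) :+ con (+ 1))
              ≈-refl) ⟩
      cos (1# + 1#)                                              ≈⟨ cos-+ 1# 1# ⟩
      cos 1# * cos 1# - s * s                                    ≈⟨ (solve 2 (λ x0 x1 → x0 :* x0 :- x1 :* x1 := x1 :* x1 :+ x0 :* x0 :- lit 2 :* (x1 :* x1))
              ≈-refl (cos 1#) s) ⟩
      (s * s + cos 1# * cos 1#) - fromℕ 2 * (s * s)              ≈⟨ +-congʳ (sin²+cos²≈1 1#) ⟩
      1# - fromℕ 2 * (s * s)                                     ∎

  -- The number π

  private
    module CosZero = FirstZero cos cos-cong cos-continuous (<⇒≤ 0<2) (<-≤-trans 0<1 (inj₂ (≈-sym cos-0))) (<⇒≤ cos2<0)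

    π/2 : Carrier
    π/2 = CosZero.first

    π/2≤2 : π/2 ≤ fromℕ 2
    π/2≤2 = CosZero.first≤b

    cos-π/2 : cos π/2 ≈ 0#
    cos-π/2 = CosZero.f-first≈0

    0<π/2 : 0# < π/2
    0<π/2 = CosZero.a<first (inj₂ cos-π/2)

    -- For s = sin π/2 the product (s + 1)(s - 1) vanishes, and s + 1 is positive.
    sin-π/2 : sin π/2 ≈ 1#
    sin-π/2 = *-cancelˡ-≈ (0<+ (sin-pos 0<π/2 π/2≤2) 0<1) (by-≈ sin²≈1
        (solve 1 (λ x0 → (x0 :+ con (+ 1)) :* con (+ 1) :+ x0 :* x0 := (x0 :+ con (+ 1)) :* x0 :+ con (+ 1))
                ≈-refl (sin π/2)))
      where
      sin²≈1 : sin π/2 * sin π/2 ≈ 1#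
      sin²≈1 = ≈-trans (≈-sym (≈-trans (+-congˡ (≈-trans (*-congʳ cos-π/2) (zeroˡ _))) (+-identityʳ _))) (sin²+cos²≈1 π/2)

    IsPi : Carrier → Set
    IsPi p = 0# < p × sin p ≈ 0# × (∀ x → 0# < x → sin x ≈ 0# → p ≤ x)

    -- A smaller positive zero x of the sine would make 2 sin(x/2) cos(x/2) vanish, although sine
    -- and cosine are positive on (0, π/2).
    π/2+π/2-isPi : IsPi (π/2 + π/2)
    π/2+π/2-isPi = 0<+ 0<π/2 0<π/2
      , ≈-trans (sin-double π/2) (≈-trans (*-congˡ (*-congˡ cos-π/2)) (solve 1 (λ x0 → lit 2 :* (x0 :* con (+ 0)) := con (+ 0))
              ≈-refl (sin π/2)))
      , λ x 0<x sin-x → ≮⇒≥ λ x<π/2+π/2 →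
          let y = ½ * x
              0<y = 0<half 0<x
              y<π/2 = *-cancelʳ-< (<⇒≤ 0<2) (<-≤-trans (≤-<-trans (inj₂ (≈-trans (solve 2 (λ x0 x1 → x0 :* x1 :* lit 2 := x0 :* x1 :+ x0 :* x1)
                      ≈-refl ½ x) (half x))) x<π/2+π/2)
                                                       (inj₂ (solve 1 (λ x0 → x0 :+ x0 := x0 :* lit 2)
                                                               ≈-refl π/2)))
              0<sin = *-pos 0<2 (*-pos (sin-pos 0<y (≤-trans (<⇒≤ y<π/2) π/2≤2)) (CosZero.positive-before y (<⇒≤ 0<y) y<π/2))
          in >⇒≉0 0<sin (≈-trans (≈-sym (sin-double y)) (≈-trans (sin-cong (half x)) sin-x))

    π-isPi : IsPi π
    π-isPi = the-satisfies IsPi (π/2 + π/2 , π/2+π/2-isPi)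

    π≈π/2+π/2 : π ≈ π/2 + π/2
    π≈π/2+π/2 = ≤-antisym (proj₂ (proj₂ π-isPi) (π/2 + π/2) (proj₁ π/2+π/2-isPi) (proj₁ (proj₂ π/2+π/2-isPi)))
                      (proj₂ (proj₂ π/2+π/2-isPi) π (proj₁ π-isPi) (proj₁ (proj₂ π-isPi)))

  0<π : 0# < π
  0<π = proj₁ π-isPi

  π≤4 : π ≤ fromℕ 4
  π≤4 = ≤-trans (inj₂ π≈π/2+π/2) (≤-trans (π/2≤2 +-≤ π/2≤2) (inj₂ (solve 0 (lit 2 :+ lit 2 := lit 4) ≈-refl)))

  -- 1 = sin(π/2) ≤ π/2.
  2≤π : fromℕ 2 ≤ π
  2≤π = ≤-trans (by-≤ (1≤π/2 +-≤ 1≤π/2) (solve 1 (λ x0 → x0 :+ x0 :+ (con (+ 1) :+ con (+ 1)) := lit 2 :+ (x0 :+ x0))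
          ≈-refl π/2)) (inj₂ (≈-sym π≈π/2+π/2))
    where
    1≤π/2 : 1# ≤ π/2
    1≤π/2 = ≤-trans (inj₂ (≈-sym sin-π/2)) (sin-≤ (<⇒≤ 0<π/2) π/2≤2)

  sin-π : sin π ≈ 0#
  sin-π = proj₁ (proj₂ π-isPi)

  cos-π : cos π ≈ - 1#
  cos-π = begin-equality
    cos π                            ≈⟨ cos-cong π≈π/2+π/2 ⟩
    cos (π/2 + π/2)                      ≈⟨ cos-+ π/2 π/2 ⟩
    cos π/2 * cos π/2 - sin π/2 * sin π/2    ≈⟨ +-cong (*-cong cos-π/2 cos-π/2) (-‿cong (*-cong sin-π/2 sin-π/2)) ⟩
    0# * 0# - 1# * 1#                ≈⟨ (solve 0 (con (+ 0) :* con (+ 0) :- con (+ 1) :* con (+ 1) := (:- (con (+ 1))))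
            ≈-refl) ⟩
    - 1#                             ∎

  sin-+π : ∀ x → sin (x + π) ≈ - sin x
  sin-+π x = ≈-trans (sin-+ x π) (≈-trans (+-cong (*-congˡ cos-π) (*-congˡ sin-π))
    (solve 2 (λ x0 x1 → x0 :* (:- (con (+ 1))) :+ x1 :* con (+ 0) := (:- x0)) ≈-refl (sin x) (cos x)))

  2π : Carrier
  2π = fromℕ 2 * π

  0<2π : 0# < 2π
  0<2π = *-pos 0<2 0<π

  sin-+2π : ∀ x → sin (x + 2π) ≈ sin x
  sin-+2π x = begin-equality
    sin (x + 2π)          ≈⟨ sin-cong (solve 2 (λ x0 x1 → x0 :+ lit 2 :* x1 := x0 :+ x1 :+ x1) ≈-refl x π) ⟩
    sin ((x + π) + π)     ≈⟨ sin-+π (x + π) ⟩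
    - sin (x + π)         ≈⟨ -‿cong (sin-+π x) ⟩
    - (- sin x)           ≈⟨ (solve 1 (λ x0 → (:- ((:- x0))) := x0) ≈-refl (sin x)) ⟩
    sin x                 ∎

  sin-+2πn : ∀ x n → sin (x + 2π * fromℕ n) ≈ sin x
  sin-+2πn x zero    = sin-cong (solve 2 (λ x0 x1 → x0 :+ x1 :* con (+ 0) := x0) ≈-refl x 2π)
  sin-+2πn x (suc n) = ≈-trans (sin-cong (solve 3 (λ x0 x1 x2 → x0 :+ x1 :* (con (+ 1) :+ x2) := x0 :+ x1 :* x2 :+ x1)
          ≈-refl x 2π (fromℕ n)))
    (≈-trans (sin-+2π _) (sin-+2πn x n))

  sin-+2πz : ∀ x z → sin (x + 2π * fromℤ z) ≈ sin x
  sin-+2πz x (+ n)    = sin-+2πn x n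
  sin-+2πz x -[1+ n ] = ≈-trans (≈-sym (sin-+2πn (x + 2π * - fromℕ (suc n)) (suc n)))
    (sin-cong (solve 3 (λ x0 x1 x2 → x0 :+ x1 :* (:- x2) :+ x1 :* x2 := x0) ≈-refl x 2π (fromℕ (suc n))))

  -- Inverting the exponential: logarithm and real powers

  exp-0 : exp 0# ≈ 1#
  exp-0 = ≤-antisym (≤-trans (exp≤1+x*exp ≤-refl) (inj₂ (solve 1 (λ x0 → con (+ 1) :+ con (+ 0) :* x0 := con (+ 1))
          ≈-refl (exp 0#))))
                    (≤-trans (inj₂ (solve 0 (con (+ 1) := con (+ 1) :+ con (+ 0)) ≈-refl)) (1+x≤exp ≤-refl))

  exp-inverse : ∀ x → exp x * exp (- x) ≈ 1#
  exp-inverse x = ≈-trans (≈-sym (exp-+ x (- x))) (≈-trans (exp-cong (solve 1 (λ x0 → x0 :+ (:- x0) := con (+ 0))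
          ≈-refl x)) exp-0)

  exp-pos : ∀ x → 0# < exp x
  exp-pos x with ≤-total 0# x
  ... | inj₁ 0≤x = <-≤-trans 0<1 (≤-trans (by-≤ 0≤x (+-identityʳ (1# + x))) (1+x≤exp 0≤x))
  ... | inj₂ x≤0 = *-cancelʳ-< (≤-trans 0≤1 1≤exp-x) (≤-<-trans (inj₂ (zeroˡ _)) (<-≤-trans 0<1 (inj₂ (≈-sym (exp-inverse x)))))
    where
    0≤-x = by-≤ x≤0 (solve 1 (λ x0 → (:- x0) :+ x0 := con (+ 0) :+ con (+ 0)) ≈-refl x)
    1≤exp-x : 1# ≤ exp (- x)
    1≤exp-x = ≤-trans (by-≤ 0≤-x (+-identityʳ (1# + - x))) (1+x≤exp 0≤-x)

  exp-mono-< : ∀ {x y} → x < y → exp x < exp y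
  exp-mono-< {x} {y} x<y = begin-strict
    exp x                ≈⟨ *-identityʳ (exp x) ⟨
    exp x * 1#           <⟨ *-monoʳ-< (exp-pos x) (<-≤-trans (by-< (0<y-x x<y) (+-identityʳ (1# + (y - x)))) (1+x≤exp (<⇒≤ (0<y-x x<y)))) ⟩
    exp x * exp (y - x)  ≈⟨ exp-+ x (y - x) ⟨
    exp (x + (y - x))    ≈⟨ exp-cong (solve 2 (λ x0 x1 → x0 :+ (x1 :- x0) := x1) ≈-refl x y) ⟩
    exp y                ∎

  exp-mono-≤ : ∀ {x y} → x ≤ y → exp x ≤ exp y
  exp-mono-≤ (inj₁ x<y) = <⇒≤ (exp-mono-< x<y)
  exp-mono-≤ (inj₂ x≈y) = inj₂ (exp-cong x≈y)

  exp-cancel-≤ : ∀ {x y} → exp x ≤ exp y → x ≤ y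
  exp-cancel-≤ h = ≮⇒≥ λ y<x → ≤⇒≯ h (exp-mono-< y<x)

  exp-injective : ∀ {x y} → exp x ≈ exp y → x ≈ y
  exp-injective eq = ≤-antisym (exp-cancel-≤ (inj₂ eq)) (exp-cancel-≤ (inj₂ (≈-sym eq)))

  -- With x ≤ ½, exp x ≤ 1 + x exp x yields first exp x ≤ 2 and then exp x ≤ 1 + 2x.
  exp-1≤2x : ∀ {x} → 0# ≤ x → x ≤ ½ → exp x - 1# ≤ x + x
  exp-1≤2x {x} 0≤x x≤½ = by-≤ (exp≤1+x*exp 0≤x +-≤ *-monoʳ-≤ 0≤x exp≤2)
    (solve 2 (λ x0 x1 → x0 :+ x0 :+ (x1 :+ x0 :* x1) := x1 :- con (+ 1) :+ (con (+ 1) :+ x0 :* x1 :+ x0 :* lit 2))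
            ≈-refl x (exp x))
    where
    exp≤2 : exp x ≤ fromℕ 2
    exp≤2 = by-≤ (exp≤1+½exp +-≤ exp≤1+½exp) (≈-trans (+-congˡ (+-congˡ (≈-sym (half (exp x)))))
      (solve 2 (λ x0 x1 → lit 2 :+ (x0 :+ (x1 :* x0 :+ x1 :* x0))
                := x0 :+ (con (+ 1) :+ x1 :* x0 :+ (con (+ 1) :+ x1 :* x0)))
              ≈-refl (exp x) ½))
      where
      exp≤1+½exp : exp x ≤ 1# + ½ * exp x
      exp≤1+½exp = ≤-trans (exp≤1+x*exp 0≤x) (≤-refl +-≤ *-monoˡ-≤ (<⇒≤ (exp-pos x)) x≤½)

  -- For negative x the deviation 1 - exp x = exp x (exp(-x) - 1) is at most exp(-x) - 1, which
  -- returns to the nonnegative case.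
  ∣exp-1∣≤ : ∀ {x d} → d ≤ ½ → ∣ x ∣≤ d → ∣ exp x - 1# ∣≤ d + d
  ∣exp-1∣≤ {x} {d} d≤½ (l , u) with ≤-total 0# x
  ... | inj₁ 0≤x = ≤-trans (proj₁ (∣0∣≤ (0≤+ 0≤d 0≤d))) (0≤y-x 1≤exp) , ≤-trans (exp-1≤2x 0≤x (≤-trans u d≤½)) (u +-≤ u)
    where
    0≤d = ≤-trans 0≤x u
    1≤exp : 1# ≤ exp x
    1≤exp = ≤-trans (by-≤ 0≤x (+-identityʳ (1# + x))) (1+x≤exp 0≤x)
  ... | inj₂ x≤0 = by-≤ (≤-trans 1-exp≤ (exp-1≤2x 0≤y (≤-trans y≤d d≤½)) +-≤ (y≤d +-≤ y≤d))
          (solve 3 (λ x0 x1 x2 → x0 :- con (+ 1) :+ (con (+ 1) :- x0 :+ ((:- x1) :+ (:- x1)))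
                    := (:- (x2 :+ x2)) :+ ((:- x1) :+ (:- x1) :+ (x2 :+ x2)))
                  ≈-refl (exp x) x d)
      , by-≤ (exp≤1 +-≤ 0≤+ 0≤d 0≤d) (solve 2 (λ x0 x1 → x0 :+ x0 :+ (x1 :+ con (+ 0)) := x1 :- con (+ 1) :+ (con (+ 1) :+ (x0 :+ x0)))
              ≈-refl d (exp x))
    where
    0≤y : 0# ≤ - x
    0≤y = by-≤ x≤0 (solve 1 (λ x0 → (:- x0) :+ x0 := con (+ 0) :+ con (+ 0)) ≈-refl x)
    y≤d : - x ≤ d
    y≤d = by-≤ l (solve 2 (λ x0 x1 → x0 :+ (:- x0) := (:- x1) :+ x1) ≈-refl d x)
    0≤d = ≤-trans 0≤y y≤d
    exp≤1 : exp x ≤ 1#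
    exp≤1 = ≤-trans (exp-mono-≤ x≤0) (inj₂ exp-0)
    1≤exp-y : 1# ≤ exp (- x)
    1≤exp-y = ≤-trans (inj₂ (≈-sym exp-0)) (exp-mono-≤ 0≤y)
    1-exp≤ : 1# - exp x ≤ exp (- x) - 1#
    1-exp≤ = begin
      1# - exp x                        ≈⟨ +-cong (≈-sym (exp-inverse x)) ≈-refl ⟩
      exp x * exp (- x) - exp x         ≈⟨ (solve 2 (λ x0 x1 → x0 :* x1 :- x0 := x0 :* (x1 :- con (+ 1)))
              ≈-refl (exp x) (exp (- x))) ⟩
      exp x * (exp (- x) - 1#)          ≤⟨ *-monoˡ-≤ (0≤y-x 1≤exp-y) exp≤1 ⟩
      1# * (exp (- x) - 1#)             ≈⟨ *-identityˡ _ ⟩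
      exp (- x) - 1#                    ∎

  exp-continuous : Continuous exp
  exp-continuous x ε 0<ε =
    let E = exp x
        0<E = exp-pos x
        η = ε * E ⁻¹
        δ , 0<δ , δ≤½η , δ≤½ = min₂ (0<half (*-pos 0<ε (⁻¹-pos 0<E))) 0<½
        E[δ+δ]≤ε : E * (δ + δ) ≤ ε
        E[δ+δ]≤ε = begin
          E * (δ + δ)                ≤⟨ *-monoʳ-≤ (<⇒≤ 0<E) (δ≤½η +-≤ δ≤½η) ⟩
          E * (½ * η + ½ * η)        ≈⟨ *-congˡ (half η) ⟩
          E * (ε * E ⁻¹)             ≈⟨ (solve 3 (λ x0 x1 x2 → x0 :* (x1 :* x2) := x1 :* (x0 :* x2))
                  ≈-refl E ε (E ⁻¹)) ⟩
          ε * (E * E ⁻¹)             ≈⟨ *-congˡ (*-inverse-pos 0<E) ⟩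
          ε * 1#                     ≈⟨ *-identityʳ ε ⟩
          ε                          ∎
    in δ , 0<δ , λ y y-x≤δ → ∣∣≤-weaken E[δ+δ]≤ε (∣∣≤-cong
         (≈-trans (solve 2 (λ x0 x1 → x0 :* (x1 :- con (+ 1)) := x0 :* x1 :- x0) ≈-refl E (exp (y - x)))
           (+-congʳ (≈-trans (≈-sym (exp-+ x (y - x))) (exp-cong (solve 2 (λ x0 x1 → x0 :+ (x1 :- x0) := x1)
                   ≈-refl x y))))) ≈-refl
         (∣*∣≤ (nonneg⇒∣∣≤ (<⇒≤ 0<E)) (∣exp-1∣≤ δ≤½ y-x≤δ)))

  -- x - exp y changes sign between y = -1/x and y = x: exp x exceeds x, and exp(1/x) exceeds 1/x.
  exp-surjective : ∀ {x} → 0# < x → ∃ λ y → exp y ≈ x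
  exp-surjective {x} 0<x = Zero.first , by-≈ (≈-sym Zero.f-first≈0) (solve 2 (λ x0 x1 → x0 :+ con (+ 0) := x1 :+ (x0 :- x1))
          ≈-refl x (exp Zero.first))
    where
    u = x ⁻¹
    0<u = ⁻¹-pos 0<x
    f : Carrier → Carrier
    f y = x - exp y
    f-continuous : Continuous f
    f-continuous y ε 0<ε = let δ , 0<δ , close = exp-continuous y ε 0<ε in
      δ , 0<δ , λ z z-y≤δ → ∣∣≤-cong (solve 3 (λ x0 x1 x2 → (:- (x0 :- x1)) := x2 :- x0 :- (x2 :- x1))
              ≈-refl (exp z) (exp y) x) ≈-refl (∣-∣≤ (close z z-y≤δ))
    x<exp-x : ∀ {y} → 0# < y → y < exp y
    x<exp-x {y} 0<y = <-≤-trans (by-< 0<1 (solve 1 (λ x0 → con (+ 1) :+ x0 :+ con (+ 0) := x0 :+ con (+ 1))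
            ≈-refl y)) (1+x≤exp (<⇒≤ 0<y))
    exp-u<x : exp (- u) < x
    exp-u<x = *-cancelʳ-< (<⇒≤ (exp-pos u)) (begin-strict
      exp (- u) * exp u   ≈⟨ ≈-trans (*-comm _ _) (exp-inverse u) ⟩
      1#                  ≈⟨ *-inverse-pos 0<x ⟨
      x * u               <⟨ *-monoʳ-< 0<x (x<exp-x 0<u) ⟩
      x * exp u           ∎)
    module Zero = FirstZero f (λ eq → +-congˡ (-‿cong (exp-cong eq))) f-continuous
      {a = - u} {b = x} (<⇒≤ (by-< (0<+ 0<x 0<u) (solve 2 (λ x0 x1 → x0 :+ con (+ 0) := (:- x1) :+ (x0 :+ x1))
              ≈-refl x u))) (0<y-x exp-u<x)
      (by-≤ (<⇒≤ (x<exp-x 0<x)) (solve 2 (λ x0 x1 → con (+ 0) :+ x0 := x0 :- x1 :+ x1) ≈-refl x (exp x)))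

  exp-ln : ∀ {x} → 0# < x → exp (ln x) ≈ x
  exp-ln {x} 0<x = the-satisfies (λ y → exp y ≈ x) (exp-surjective 0<x)

  ln-* : ∀ {x y} → 0# < x → 0# < y → ln (x * y) ≈ ln x + ln y
  ln-* {x} {y} 0<x 0<y = exp-injective (begin-equality
    exp (ln (x * y))         ≈⟨ exp-ln (*-pos 0<x 0<y) ⟩
    x * y                    ≈⟨ *-cong (exp-ln 0<x) (exp-ln 0<y) ⟨
    exp (ln x) * exp (ln y)  ≈⟨ exp-+ (ln x) (ln y) ⟨
    exp (ln x + ln y)        ∎)

  0≤ln : ∀ {x} → 1# ≤ x → 0# ≤ ln x
  0≤ln 1≤x = exp-cancel-≤ (≤-trans (inj₂ exp-0) (≤-trans 1≤x (inj₂ (≈-sym (exp-ln (<-≤-trans 0<1 1≤x))))))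

  -- `ln` is chosen by description; that it respects `≈` on positive arguments comes from
  -- injectivity of `exp`.
  ^ʳ-congˡ : ∀ {x y} β → 0# < x → x ≈ y → x ^ʳ β ≈ y ^ʳ β
  ^ʳ-congˡ β 0<x x≈y = exp-cong (*-congˡ (exp-injective
    (≈-trans (exp-ln 0<x) (≈-trans x≈y (≈-sym (exp-ln (<-≤-trans 0<x (inj₂ x≈y))))))))

  ^ʳ-pos : ∀ x β → 0# < x ^ʳ β
  ^ʳ-pos x β = exp-pos _

  ^ʳ-* : ∀ {x y} β → 0# < x → 0# < y → (x * y) ^ʳ β ≈ x ^ʳ β * y ^ʳ β
  ^ʳ-* {x} {y} β 0<x 0<y = ≈-trans (exp-cong (≈-trans (*-congˡ (ln-* 0<x 0<y)) (solve 3 (λ x0 x1 x2 → x0 :* (x1 :+ x2) := x0 :* x1 :+ x0 :* x2)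
          ≈-refl β (ln x) (ln y)))) (exp-+ _ _)

  module _ {β : Carrier} (0<β : 0# < β) where

    1≤^ʳ : ∀ {x} → 1# ≤ x → 1# ≤ x ^ʳ β
    1≤^ʳ 1≤x = ≤-trans (inj₂ (≈-sym exp-0)) (exp-mono-≤ (*-nonneg (<⇒≤ 0<β) (0≤ln 1≤x)))

    -- For B ≥ K and n above exp(B/β) one has β ln n ≥ B, hence n^β ≥ exp B ≥ 1 + B.
    ^ʳ-unbounded : ∀ K → ∃ λ N → 1 ℕ.≤ N × (∀ n → N ℕ.≤ n → K ≤ fromℕ n ^ʳ β)
    ^ʳ-unbounded K = suc N , s≤s z≤n , λ { n N<n → begin
        K                        ≤⟨ proj₂ (proj₂ (proj₂ (∣∣≤-bound K))) ⟩
        B                        ≤⟨ by-≤ 0≤1 (solve 1 (λ x0 → con (+ 1) :+ x0 :+ con (+ 0) := x0 :+ con (+ 1))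
                ≈-refl B) ⟩
        1# + B                   ≤⟨ 1+x≤exp 0≤B ⟩
        exp B                    ≈⟨ exp-cong βL≈B ⟨
        exp (β * L)              ≤⟨ exp-mono-≤ (*-monoʳ-≤ (<⇒≤ 0<β) (L≤ln n N<n)) ⟩
        fromℕ n ^ʳ β             ∎ }
      where
      B = proj₁ (∣∣≤-bound K)
      0≤B = proj₁ (proj₂ (∣∣≤-bound K))
      L = B * β ⁻¹
      βL≈B : β * L ≈ B
      βL≈B = ≈-trans (solve 3 (λ x0 x1 x2 → x0 :* (x1 :* x2) := x1 :* (x0 :* x2))
              ≈-refl β B (β ⁻¹)) (≈-trans (*-congˡ (*-inverse-pos 0<β)) (*-identityʳ B))
      N = proj₁ (archimedean (exp L))
      L≤ln : ∀ n → suc N ℕ.≤ n → L ≤ ln (fromℕ n)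
      L≤ln n N<n = exp-cancel-≤ (≤-trans (≤-trans (<⇒≤ (proj₂ (archimedean (exp L)))) (fromℕ-mono-≤ (ℕ.≤-trans (ℕ.n≤1+n N) N<n)))
        (inj₂ (≈-sym (exp-ln (0<fromℕ (ℕ.≤-trans (s≤s z≤n) N<n))))))

    -- x ^ β x = exp ((β + 1) ln x), and ln (x + 2) ≤ ln x + 2/x.
    power-growth : ∀ {x δ} → 0# < x → δ * x ≈ fromℕ 2 * (β + 1#) → δ ≤ ½ →
                   (fromℕ 2 + x) ^ʳ β * (fromℕ 2 + x) ≤ x ^ʳ β * x * (1# + (δ + δ))
    power-growth {x} {δ} 0<x δx≈ δ≤½ = begin
      y ^ʳ β * y                          ≈⟨ as-exp 0<y ⟩
      exp (γ * ln y)                      ≤⟨ exp-mono-≤ (≤-trans (*-monoʳ-≤ (<⇒≤ 0<γ) ln-y≤) (inj₂ γ[ln+r]≈)) ⟩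
      exp (γ * ln x + δ)                  ≈⟨ exp-+ _ δ ⟩
      exp (γ * ln x) * exp δ              ≤⟨ *-monoʳ-≤ (<⇒≤ (exp-pos _)) (by-≤ (exp-1≤2x (<⇒≤ 0<δ) δ≤½) (solve 2 (λ x0 x1 → con (+ 1) :+ (x0 :+ x0) :+ (x1 :- con (+ 1)) := x1 :+ (x0 :+ x0))
              ≈-refl δ (exp δ))) ⟩
      exp (γ * ln x) * (1# + (δ + δ))     ≈⟨ *-congʳ (as-exp 0<x) ⟨
      x ^ʳ β * x * (1# + (δ + δ))         ∎
      where
      y = fromℕ 2 + x
      0<y = 0<+ 0<2 0<x
      γ = β + 1#
      0<γ = 0<+ 0<β 0<1
      r = fromℕ 2 * x ⁻¹
      0<r = *-pos 0<2 (⁻¹-pos 0<x)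
      δ≈γr : δ ≈ γ * r
      δ≈γr = *-cancelˡ-≈ 0<x (≈-trans (*-comm x δ) (≈-trans δx≈ (≈-sym (begin-equality
        x * (γ * (fromℕ 2 * x ⁻¹))      ≈⟨ (solve 3 (λ x0 x1 x2 → x0 :* (x1 :* (lit 2 :* x2)) := lit 2 :* x1 :* (x0 :* x2))
                ≈-refl x γ (x ⁻¹)) ⟩
        fromℕ 2 * γ * (x * x ⁻¹)        ≈⟨ *-congˡ (*-inverse-pos 0<x) ⟩
        fromℕ 2 * γ * 1#                ≈⟨ *-identityʳ _ ⟩
        fromℕ 2 * γ                     ∎))))
      0<δ = <-≤-trans (*-pos 0<γ 0<r) (inj₂ (≈-sym δ≈γr))
      γ[ln+r]≈ : γ * (ln x + r) ≈ γ * ln x + δ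
      γ[ln+r]≈ = ≈-trans (solve 3 (λ x0 x1 x2 → x0 :* (x1 :+ x2) := x0 :* x1 :+ x0 :* x2)
              ≈-refl γ (ln x) r) (+-congˡ (≈-sym δ≈γr))
      as-exp : ∀ {z} → 0# < z → z ^ʳ β * z ≈ exp (γ * ln z)
      as-exp {z} 0<z = begin-equality
        exp (β * ln z) * z               ≈⟨ *-congˡ (exp-ln 0<z) ⟨
        exp (β * ln z) * exp (ln z)      ≈⟨ exp-+ _ _ ⟨
        exp (β * ln z + ln z)            ≈⟨ exp-cong (solve 2 (λ x0 x1 → x0 :* x1 :+ x1 := (x0 :+ con (+ 1)) :* x1)
                ≈-refl β (ln z)) ⟩
        exp (γ * ln z)                   ∎
      ln-y≤ : ln y ≤ ln x + r
      ln-y≤ = exp-cancel-≤ (begin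
        exp (ln y)               ≈⟨ exp-ln 0<y ⟩
        fromℕ 2 + x              ≈⟨ +-comm _ _ ⟩
        x + fromℕ 2              ≈⟨ +-congˡ (≈-trans (≈-sym (≈-trans (*-congˡ (*-inverse-pos 0<x)) (*-identityʳ _))) (solve 2 (λ x0 x1 → lit 2 :* (x0 :* x1) := x0 :* (lit 2 :* x1))
                ≈-refl x (x ⁻¹))) ⟩
        x + x * r                ≈⟨ (solve 2 (λ x0 x1 → x0 :+ x0 :* x1 := x0 :* (con (+ 1) :+ x1)) ≈-refl x r) ⟩
        x * (1# + r)             ≤⟨ *-monoʳ-≤ (<⇒≤ 0<x) (1+x≤exp (<⇒≤ 0<r)) ⟩
        x * exp r                ≈⟨ *-congʳ (exp-ln 0<x) ⟨
        exp (ln x) * exp r       ≈⟨ exp-+ _ _ ⟨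
        exp (ln x + r)           ∎)

-- Signed fractional parts

module FractionalPartLiminf (lem : ExcludedMiddle 0ℓ) (R : CompleteOrderedField) where

  open OrderedField lem R
  open ≤-Reasoning

  -- A discrete intermediate value principle, by descent from the upper index. It yields both the
  -- integer part and the stopping point of the sweep through odd multiples.
  crossing : ∀ (f : ℕ → Carrier) c a k → f a < c → c ≤ f (k ℕ.+ a) →
             ∃ λ n → a ℕ.≤ n × f n < c × c ≤ f (suc n)
  crossing f c a zero    fa<c c≤fa = contradiction fa<c (≤⇒≯ c≤fa)
  crossing f c a (suc k) fa<c c≤fk with <-≤-total (f (k ℕ.+ a)) c
  ... | inj₁ f<c = k ℕ.+ a , ℕ.m≤n+m a k , f<c , c≤fk
  ... | inj₂ c≤f = crossing f c a k fa<c c≤f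

  integer-below : ∀ x → ∃ λ w → fromℤ w < x × x ≤ fromℤ w + 1#
  integer-below x =
    let N , -x<N = archimedean (- x)
        M , x+N<M = archimedean (x + fromℕ N)
        n , _ , below , above = crossing (λ n → fromℕ n - fromℕ N) x 0 M
          (by-< -x<N (solve 2 (λ x0 x1 → x0 :+ (:- x0) := con (+ 0) :- x1 :+ x1) ≈-refl x (fromℕ N)))
          (≤-trans (by-≤ (<⇒≤ x+N<M) (solve 3 (λ x0 x1 x2 → x0 :- x1 :+ (x2 :+ x1) := x2 :+ x0)
                  ≈-refl (fromℕ M) (fromℕ N) x))
                   (inj₂ (+-congʳ (≈-sym (≈-trans (fromℕ-+ M 0) (+-identityʳ _))))))
        n-N : fromℤ (+ n ℤ.+ ℤ.- + N) ≈ fromℕ n - fromℕ N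
        n-N = ≈-trans (fromℤ-+ (+ n) (ℤ.- + N)) (+-congˡ (fromℤ-neg (+ N)))
    in + n ℤ.+ ℤ.- + N
     , ≤-<-trans (inj₂ n-N) below
     , ≤-trans above (inj₂ (≈-trans (solve 2 (λ x0 x1 → con (+ 1) :+ x0 :- x1 := x0 :- x1 :+ con (+ 1))
             ≈-refl (fromℕ n) (fromℕ N)) (+-congʳ (≈-sym n-N))))

  IsFrac : Carrier → Carrier → Set
  IsFrac x y = - ½ ≤ y × y < ½ × ∃ λ z → x - y ≈ fromℤ z

  frac-exists : ∀ x → ∃ (IsFrac x)
  frac-exists x =
    -- From w < -x - ½ ≤ w + 1 follows -½ ≤ x + w + 1 < ½, with the strict side where the signed
    -- fractional part has it.
    let w , w<c , c≤w+1 = integer-below (- x - ½)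
    in x + (fromℤ w + 1#)
     , by-≤ c≤w+1 (solve 3 (λ x0 x1 x2 → x0 :+ (x1 :+ con (+ 1)) :+ ((:- x0) :- x2) := (:- x2) :+ (x1 :+ con (+ 1)))
             ≈-refl x (fromℤ w) ½)
     , by-< w<c (≈-trans
         (solve 3 (λ x0 x1 x2 → x0 :+ x1 := x2 :+ (x1 :+ con (+ 1)) :+ ((:- x2) :- x0 :+ (x0 :+ x0 :- con (+ 1))))
                 ≈-refl ½ (fromℤ w) x)
         (+-congˡ (≈-trans (+-congˡ (≈-trans (+-congʳ ½+½≈1) (solve 0 (con (+ 1) :- con (+ 1) := con (+ 0))
                 ≈-refl))) (+-identityʳ _))))
     , ℤ.- (w ℤ.+ + 1)
     , ≈-trans (solve 2 (λ x0 x1 → x0 :- (x0 :+ (x1 :+ con (+ 1))) := (:- (x1 :+ (con (+ 1) :+ con (+ 0)))))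
             ≈-refl x (fromℤ w))
         (≈-sym (≈-trans (fromℤ-neg (w ℤ.+ + 1)) (-‿cong (fromℤ-+ w (+ 1)))))

  frac-isFrac : ∀ x → IsFrac x ⟨ x ⟩₂
  frac-isFrac x = the-satisfies (IsFrac x) (frac-exists x)

  integer-in-unit-interval : ∀ z → - 1# < fromℤ z → fromℤ z < 1# → fromℤ z ≈ 0#
  integer-in-unit-interval (+ zero)  _ _    = ≈-refl
  integer-in-unit-interval (+ suc n) _ z<1  = contradiction z<1 (≤⇒≯ (1≤fromℕ-suc n))
  integer-in-unit-interval -[1+ n ]  -1<z _ = contradiction -1<z (≤⇒≯ (neg-≤ (1≤fromℕ-suc n)))

  -- Two candidates differ by an integer strictly between -1 and 1.
  frac-unique : ∀ {x y} → - ½ ≤ y → y < ½ → ∀ z → x ≈ y + fromℤ z → ⟨ x ⟩₂ ≈ y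
  frac-unique {x} {y} -½≤y y<½ z x≈y+z = by-≈ difference (solve 2 (λ x0 x1 → x0 :+ (x1 :- x0) := x1 :+ con (+ 0))
          ≈-refl y (⟨ x ⟩₂))
    where
    t = ⟨ x ⟩₂
    -½≤t = proj₁ (frac-isFrac x)
    t<½ = proj₁ (proj₂ (frac-isFrac x))
    z′ = proj₁ (proj₂ (proj₂ (frac-isFrac x)))
    x-t≈z′ = proj₂ (proj₂ (proj₂ (frac-isFrac x)))
    k≈ : fromℤ (z ℤ.+ ℤ.- z′) ≈ t - y
    k≈ = begin-equality
      fromℤ (z ℤ.+ ℤ.- z′)             ≈⟨ ≈-trans (fromℤ-+ z (ℤ.- z′)) (+-congˡ (fromℤ-neg z′)) ⟩
      fromℤ z - fromℤ z′               ≈⟨ +-congˡ (-‿cong x-t≈z′) ⟨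
      fromℤ z - (x - t)                ≈⟨ +-congˡ (-‿cong (+-congʳ x≈y+z)) ⟩
      fromℤ z - ((y + fromℤ z) - t)    ≈⟨ (solve 3 (λ x0 x1 x2 → x0 :- (x1 :+ x0 :- x2) := x2 :- x1)
              ≈-refl (fromℤ z) y t) ⟩
      t - y                            ∎
    difference : t - y ≈ 0#
    difference = ≈-trans (≈-sym k≈) (integer-in-unit-interval (z ℤ.+ ℤ.- z′)
      (<-≤-trans (by-< (-½≤t +-≤< y<½) (≈-trans (solve 3 (λ x0 x1 x2 → x0 :- x1 :+ ((:- x2) :+ x1) := (:- (x2 :+ x2)) :+ (x0 :+ x2))
              ≈-refl t y ½) (+-congʳ (-‿cong ½+½≈1)))) (inj₂ (≈-sym k≈)))
      (≤-<-trans (inj₂ k≈) (by-< (t<½ +-<≤ -½≤y) (≈-trans (+-congʳ (≈-sym ½+½≈1)) (solve 3 (λ x0 x1 x2 → x0 :+ x0 :+ (x1 :+ (:- x0)) := x1 :- x2 :+ (x0 :+ x2))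
              ≈-refl ½ t y)))))

  -- Extended reals and vanishing lower limits

  private
    module ≤± = ExtremaOrder _≤_
    module ≈± = ExtremaEquality _≈_

  ≤±-trans : ∀ {x y z} → x ≤± y → y ≤± z → x ≤± z
  ≤±-trans = ≤±.≤±-trans ≤-trans

  ≤±-antisym : ∀ {x y} → x ≤± y → y ≤± x → x ≈± y
  ≤±-antisym = ≤±.≤±-antisym ≤-antisym

  ≤±-reflexive : ∀ {x y} → x ≈± y → x ≤± y
  ≤±-reflexive = ≤±.≤±-reflexive inj₂

  ≈±-refl : ∀ {x} → x ≈± x
  ≈±-refl = ≈±.≈±-refl ≈-refl

  ≈±-sym : ∀ {x y} → x ≈± y → y ≈± x
  ≈±-sym = ≈±.≈±-sym ≈-sym

  ⊤±≰[] : ∀ {u} → ¬ ⊤± ≤± [ u ]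
  ⊤±≰[] ()

  -- Passing through `⊥±` would give u ≤ u - 1.
  []≰⊥± : ∀ {u} → ¬ [ u ] ≤± ⊥±
  []≰⊥± {u} u≤⊥ = ≤⇒≯ ([≤]-injective (≤±-trans u≤⊥ (≤±.⊥±≤ [ u - 1# ])))
    (by-< 0<1 (solve 1 (λ x0 → x0 :+ con (+ 0) := x0 :- con (+ 1) :+ con (+ 1)) ≈-refl u))

  sup±-upper : ∀ {P} x → P x → x ≤± sup± P
  sup±-upper {P} x p with lem {∃ λ u → ∀ x → P x → x ≤± [ u ]}
  ... | no  _       = x ≤±.≤⊤±
  ... | yes (u , b) with lem {∃ λ x → P [ x ]}
  sup±-upper ⊥± p    | yes (u , b) | no ¬e = ≤±.⊥±≤ ⊥±
  sup±-upper [ x ] p | yes (u , b) | no ¬e = contradiction (x , p) ¬e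
  sup±-upper ⊤± p    | yes (u , b) | no ¬e = contradiction (b ⊤± p) ⊤±≰[]
  sup±-upper ⊥± p    | yes (u , b) | yes e = ≤±.⊥±≤ _
  sup±-upper [ x ] p | yes (u , b) | yes e = ≤±.[ proj₁ (proj₂ (complete _ e _)) x p ]
  sup±-upper ⊤± p    | yes (u , b) | yes e = contradiction (b ⊤± p) ⊤±≰[]

  sup±-least : ∀ {P} u → (∀ x → P x → x ≤± u) → sup± P ≤± u
  sup±-least {P} u b with lem {∃ λ u → ∀ x → P x → x ≤± [ u ]}
  sup±-least ⊥± b    | no ¬u = contradiction (0# , λ x p → ≤±-trans (b x p) (≤±.⊥±≤ [ 0# ])) ¬u
  sup±-least [ u ] b | no ¬u = contradiction (u , b) ¬u
  sup±-least ⊤± b    | no ¬u = ≤±.⊤±≤⊤±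
  sup±-least {P} u b | yes _ with lem {∃ λ x → P [ x ]}
  ... | no _ = ≤±.⊥±≤ u
  sup±-least ⊥± b    | yes _ | yes (x , p) = contradiction (b [ x ] p) []≰⊥±
  sup±-least [ u ] b | yes _ | yes e = ≤±.[ proj₂ (proj₂ (complete _ e _)) u (λ x p → [≤]-injective (b [ x ] p)) ]
  sup±-least ⊤± b    | yes _ | yes e = _ ≤±.≤⊤±

  inf±-greatest : ∀ {P} l → (∀ x → P x → l ≤± x) → l ≤± inf± P
  inf±-greatest l lower = sup±-upper l lower

  module _ {A : ℕ → Set} {f : ℕ → Carrier} (0≤f : ∀ k → A k → 0# ≤ f k) where

    -- For nonnegative f this is equivalent to a vanishing lower limit, and it lets the later
    -- arguments avoid extended reals.
    FrequentlySmall : Set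
    FrequentlySmall = ∀ n ε → 0# < ε → ∃ λ k → 1 ℕ.≤ k × n ℕ.≤ k × A k × f k < ε

    -- Otherwise ε would be a lower bound of some tail, hence of the lower limit.
    liminf≈0⇒small : liminf A f ≈± 0± → FrequentlySmall
    liminf≈0⇒small eq n ε 0<ε with lem {∃ λ k → 1 ℕ.≤ k × n ℕ.≤ k × A k × f k < ε}
    ... | yes e = e
    ... | no ¬e = contradiction 0<ε (≤⇒≯ ([≤]-injective (≤±-trans (≤±-trans
            (inf±-greatest [ ε ] λ { x (k , 1≤k , n≤k , a , x≈fk) →
              ≤±-trans ≤±.[ ≮⇒≥ (λ fk<ε → ¬e (k , 1≤k , n≤k , a , fk<ε)) ] (≤±-reflexive (≈±-sym x≈fk)) })
            (sup±-upper _ (n , ≈±-refl))) (≤±-reflexive eq))))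

    small⇒liminf≈0 : FrequentlySmall → liminf A f ≈± 0±
    small⇒liminf≈0 small = ≤±-antisym
      (sup±-least 0± λ { y (n , y≈inf) → ≤±-trans (≤±-reflexive y≈inf) (inf≤0 n) })
      (≤±-trans (inf±-greatest 0± λ { x (k , _ , _ , a , x≈fk) → ≤±-trans ≤±.[ 0≤f k a ] (≤±-reflexive (≈±-sym x≈fk)) })
                (sup±-upper _ (0 , ≈±-refl)))
      where
      -- Restates the local `tail` of `liminf`, which cannot be named here.
      Tail : ℕ → Carrier ± → Set
      Tail n x = ∃ λ k → 1 ℕ.≤ k × n ℕ.≤ k × A k × x ≈± [ f k ]
      lower≤0 : ∀ n l → (∀ x → Tail n x → l ≤± x) → l ≤± 0±
      lower≤0 n ⊥± _ = ≤±.⊥±≤ 0±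
      -- Only an empty tail has `⊤±` as a lower bound; any small value shows that the tail is
      -- inhabited.
      lower≤0 n ⊤± lower with small n 1# 0<1
      ... | k , 1≤k , n≤k , a , _ = contradiction (lower [ f k ] (k , 1≤k , n≤k , a , ≈±-refl)) ⊤±≰[]
      lower≤0 n [ l ] lower = ≤±.[ ≤-all-ε (λ ε 0<ε → let k , 1≤k , n≤k , a , fk<ε = small n ε 0<ε in
        ≤-trans ([≤]-injective (lower [ f k ] (k , 1≤k , n≤k , a , ≈±-refl))) (≤-trans (<⇒≤ fk<ε) (inj₂ (≈-sym (+-identityˡ ε))))) ]
      inf≤0 : ∀ n → inf± (Tail n) ≤± 0±
      inf≤0 n = sup±-least 0± (lower≤0 n)

-- Approximations of 0 and ½ modulo 1

module SineDensity (lem : ExcludedMiddle 0ℓ) (R : CompleteOrderedField)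
                   (β α : CompleteOrderedField.Carrier R)
                   (0<β : CompleteOrderedField._<_ R (CompleteOrderedField.0# R) β) where

  open OrderedField lem R
  open Series lem R
  open ExpSinCos lem R
  open Trigonometry lem R
  open PiLnPowers lem R
  open FractionalPartLiminf lem R
  open ≤-Reasoning

  p : ℕ → Carrier
  p k = fromℕ k ^ʳ β

  value : ℕ → Carrier
  value k = p k * sin (fromℕ 2 * π * fromℕ k * α)

  p-* : ∀ {m k} → 1 ℕ.≤ m → 1 ℕ.≤ k → p (m ℕ.* k) ≈ p m * p k
  p-* {m} {k} 1≤m 1≤k = ≈-trans
    (^ʳ-congˡ β (0<fromℕ (ℕ.*-mono-≤ 1≤m 1≤k)) (fromℕ-* m k))
    (^ʳ-* β (0<fromℕ 1≤m) (0<fromℕ 1≤k))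

  0<p : ∀ k → 0# < p k
  0<p k = ^ʳ-pos (fromℕ k) β

  1≤p : ∀ {k} → 1 ℕ.≤ k → 1# ≤ p k
  1≤p 1≤k = 1≤^ʳ 0<β (1≤fromℕ 1≤k)

  x≤px : ∀ {k x} → 1 ℕ.≤ k → 0# ≤ x → x ≤ p k * x
  x≤px {k} {x} 1≤k 0≤x = ≤-trans (inj₂ (≈-sym (*-identityˡ x))) (*-monoˡ-≤ 0≤x (1≤p 1≤k))

  -- k is within x of ρ modulo 1, on the side given by the sign s.
  SmallAt : (ρ s : Carrier) (n : ℕ) (ε : Carrier) → Set
  SmallAt ρ s n ε = ∃ λ k → 1 ℕ.≤ k × n ℕ.≤ k × ∃ λ x → ∃ λ z →
    0# < x × p k * x < ε × fromℕ k * α - ρ ≈ s * x + fromℤ z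

  -- For s = 1 and s = -1 this is the vanishing of μ₊ and of μ₋ at ρ, with the signed fractional
  -- part replaced by any x and integer that fit.
  Small : (ρ s : Carrier) → Set
  Small ρ s = ∀ n ε → 0# < ε → SmallAt ρ s n ε

  small-cong : ∀ {ρ s s′} → s ≈ s′ → Small ρ s → Small ρ s′
  small-cong s≈s′ small n ε 0<ε with small n ε 0<ε
  ... | k , 1≤k , n≤k , x , z , 0<x , px<ε , eq = k , 1≤k , n≤k , x , z , 0<x , px<ε , ≈-trans eq (+-congʳ (*-congʳ s≈s′))

  -½<0 : - ½ < 0#
  -½<0 = by-< 0<½ (solve 1 (λ x0 → con (+ 0) :+ con (+ 0) := (:- x0) :+ x0) ≈-refl ½)

  module _ (ρ : Carrier) where

    private
      t : ℕ → Carrier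
      t k = ⟨ fromℕ k * α - ρ ⟩₂

      t-spec : ∀ k → ∃ λ z → fromℕ k * α - ρ ≈ t k + fromℤ z
      t-spec k = let _ , _ , z , eq = frac-isFrac (fromℕ k * α - ρ) in
        z , by-≈ eq (solve 5 (λ x0 x1 x2 x3 x4 → x0 :+ x1 :+ (x2 :* x3 :- x4 :- x0) := x2 :* x3 :- x4 :+ x1)
                ≈-refl (t k) (fromℤ z) (fromℕ k) α ρ)

      0≤f₊ : ∀ k → 0# < t k → 0# ≤ p k * t k
      0≤f₊ k 0<t = <⇒≤ (*-pos (0<p k) 0<t)

      0≤f₋ : ∀ k → t k < 0# → 0# ≤ - (p k * t k)
      0≤f₋ k t<0 = ≤-trans (*-nonneg (<⇒≤ (0<p k)) (0≤y-x (<⇒≤ t<0))) (inj₂ (solve 2 (λ x0 x1 → x0 :* (con (+ 0) :- x1) := (:- (x0 :* x1)))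
              ≈-refl (p k) (t k)))

    μ₊≈0⇒small : μ₊ α β ρ ≈± 0± → Small ρ 1#
    μ₊≈0⇒small μ≈0 n ε 0<ε =
      let k , 1≤k , n≤k , 0<t , pt<ε = liminf≈0⇒small 0≤f₊ μ≈0 n ε 0<ε
          z , eq = t-spec k
      in k , 1≤k , n≤k , t k , z , 0<t , pt<ε , ≈-trans eq (+-congʳ (≈-sym (*-identityˡ (t k))))

    μ₋≈0⇒small : μ₋ α β ρ ≈± 0± → Small ρ (- 1#)
    μ₋≈0⇒small μ≈0 n ε 0<ε =
      let k , 1≤k , n≤k , t<0 , pt<ε = liminf≈0⇒small 0≤f₋ μ≈0 n ε 0<ε
          z , eq = t-spec k
      in k , 1≤k , n≤k , - t k , z , by-< t<0 (solve 1 (λ x0 → (:- x0) :+ x0 := con (+ 0) :+ con (+ 0))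
              ≈-refl (t k))
       , ≤-<-trans (inj₂ (solve 2 (λ x0 x1 → x0 :* (:- x1) := (:- (x0 :* x1))) ≈-refl (p k) (t k))) pt<ε
       , ≈-trans eq (+-congʳ (solve 1 (λ x0 → x0 := (:- (con (+ 1))) :* (:- x0)) ≈-refl (t k)))

    small⇒μ₊≈0 : Small ρ 1# → μ₊ α β ρ ≈± 0±
    small⇒μ₊≈0 small = small⇒liminf≈0 0≤f₊ λ n ε 0<ε →
      -- Since k^β ≥ 1, the cap ½ forces x < ½, which makes x the signed fractional part itself.
      let δ , 0<δ , δ≤ε , δ≤½ = min₂ 0<ε 0<½
          k , 1≤k , n≤k , x , z , 0<x , px<δ , eq = small n δ 0<δ
          x<½ = ≤-<-trans (x≤px 1≤k (<⇒≤ 0<x)) (<-≤-trans px<δ δ≤½)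
          t≈x = frac-unique (<⇒≤ (<-trans -½<0 0<x)) x<½ z (≈-trans eq (+-congʳ (*-identityˡ x)))
      in k , 1≤k , n≤k , <-≤-trans 0<x (inj₂ (≈-sym t≈x))
       , ≤-<-trans (inj₂ (*-congˡ t≈x)) (<-≤-trans px<δ δ≤ε)

    small⇒μ₋≈0 : Small ρ (- 1#) → μ₋ α β ρ ≈± 0±
    small⇒μ₋≈0 small = small⇒liminf≈0 0≤f₋ λ n ε 0<ε →
      let δ , 0<δ , δ≤ε , δ≤½ = min₂ 0<ε 0<½
          k , 1≤k , n≤k , x , z , 0<x , px<δ , eq = small n δ 0<δ
          x<½ = ≤-<-trans (x≤px 1≤k (<⇒≤ 0<x)) (<-≤-trans px<δ δ≤½)
          -x<0 = by-< 0<x (solve 1 (λ x0 → con (+ 0) :+ con (+ 0) := (:- x0) :+ x0) ≈-refl x)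
          t≈-x = frac-unique (neg-≤ (<⇒≤ x<½)) (<-trans -x<0 0<½) z (≈-trans eq (+-congʳ (solve 1 (λ x0 → (:- (con (+ 1))) :* x0 := (:- x0))
                  ≈-refl x)))
      in k , 1≤k , n≤k , ≤-<-trans (inj₂ t≈-x) -x<0
       , ≤-<-trans (inj₂ (≈-trans (-‿cong (*-congˡ t≈-x)) (solve 2 (λ x0 x1 → (:- (x0 :* (:- x1))) := x0 :* x1)
               ≈-refl (p k) x))) (<-≤-trans px<δ δ≤ε)

  small-½⇒small-0 : ∀ {s} → Small ½ s → Small 0# s
  small-½⇒small-0 {s} small n ε 0<ε =
    -- Doubling both k and x multiplies k^β x by 2 · 2^β. The new integer is 2z + 1, the 1 being
    -- twice ½.
    let C = fromℕ 2 * p 2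
        0<C = *-pos 0<2 (0<p 2)
        k , 1≤k , n≤k , x , z , 0<x , px<ε′ , eq = small n (ε * C ⁻¹) (*-pos 0<ε (⁻¹-pos 0<C))
    in 2 ℕ.* k , ℕ.≤-trans 1≤k (ℕ.m≤m+n k _) , ℕ.≤-trans n≤k (ℕ.m≤m+n k _) , x + x , z ℤ.+ z ℤ.+ + 1 , 0<+ 0<x 0<x
     , (begin-strict
         p (2 ℕ.* k) * (x + x)             ≈⟨ *-congʳ (p-* {2} (s≤s z≤n) 1≤k) ⟩
         p 2 * p k * (x + x)               ≈⟨ (solve 3 (λ x0 x1 x2 → x0 :* x1 :* (x2 :+ x2) := lit 2 :* x0 :* (x1 :* x2))
                 ≈-refl (p 2) (p k) x) ⟩
         C * (p k * x)                     <⟨ *-monoʳ-< 0<C px<ε′ ⟩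
         C * (ε * C ⁻¹)                    ≈⟨ (solve 3 (λ x0 x1 x2 → x0 :* (x1 :* x2) := x1 :* (x0 :* x2))
                 ≈-refl C ε (C ⁻¹)) ⟩
         ε * (C * C ⁻¹)                    ≈⟨ ≈-trans (*-congˡ (*-inverse-pos 0<C)) (*-identityʳ ε) ⟩
         ε                                 ∎)
     , (begin-equality
         fromℕ (2 ℕ.* k) * α - 0#          ≈⟨ +-congʳ (*-congʳ (fromℕ-* 2 k)) ⟩
         fromℕ 2 * fromℕ k * α - 0#        ≈⟨ (solve 3 (λ x0 x1 x2 → lit 2 :* x0 :* x1 :- con (+ 0) := x0 :* x1 :- x2 :+ (x0 :* x1 :- x2) :+ (x2 :+ x2))
                 ≈-refl (fromℕ k) α ½) ⟩
         ((fromℕ k * α - ½) + (fromℕ k * α - ½)) + (½ + ½)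
                                           ≈⟨ +-cong (+-cong eq eq) ½+½≈1 ⟩
         ((s * x + fromℤ z) + (s * x + fromℤ z)) + 1#
                                           ≈⟨ (solve 3 (λ x0 x1 x2 → x0 :* x1 :+ x2 :+ (x0 :* x1 :+ x2) :+ con (+ 1)
                                                     := x0 :* (x1 :+ x1) :+ (x2 :+ x2 :+ (con (+ 1) :+ con (+ 0))))
                                                   ≈-refl s x (fromℤ z)) ⟩
         s * (x + x) + ((fromℤ z + fromℤ z) + (1# + 0#))
                                           ≈⟨ +-congˡ (≈-trans (fromℤ-+ (z ℤ.+ z) (+ 1)) (+-congʳ (fromℤ-+ z z))) ⟨
         s * (x + x) + fromℤ (z ℤ.+ z ℤ.+ + 1) ∎)

  odd : ℕ → ℕ
  odd zero    = 1
  odd (suc j) = suc (suc (odd j))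

  fromℕ-odd : ∀ j → fromℕ (odd j) ≈ fromℕ j + fromℕ j + 1#
  fromℕ-odd zero    = (solve 0 (con (+ 1) :+ con (+ 0) := con (+ 0) :+ con (+ 0) :+ con (+ 1)) ≈-refl)
  fromℕ-odd (suc j) = ≈-trans (+-congˡ (+-congˡ (fromℕ-odd j)))
    (solve 1 (λ x0 → con (+ 1) :+ (con (+ 1) :+ (x0 :+ x0 :+ con (+ 1)))
              := con (+ 1) :+ x0 :+ (con (+ 1) :+ x0) :+ con (+ 1))
            ≈-refl (fromℕ j))

  1≤odd : ∀ j → 1 ℕ.≤ odd j
  1≤odd zero    = s≤s z≤n
  1≤odd (suc j) = s≤s z≤n

  j≤odd : ∀ j → j ℕ.≤ odd j
  j≤odd zero    = z≤n
  j≤odd (suc j) = s≤s (ℕ.m≤n⇒m≤1+n (j≤odd j))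

  -- All that the argument uses about ρ, so that 0 and ½ are treated together: the sign that it
  -- gives to the sine, and its stability modulo 1 under odd multiples.
  record Phase (ρ σ : Carrier) : Set where
    field
      σ²≈1         : σ * σ ≈ 1#
      phase        : ∀ k u z → fromℕ k * α - ρ ≈ u + fromℤ z →
                     sin (fromℕ 2 * π * fromℕ k * α) ≈ σ * sin (2π * u)
      odd-multiple : ∀ j k u z → fromℕ k * α - ρ ≈ u + fromℤ z →
                     ∃ λ z′ → fromℕ (odd j ℕ.* k) * α - ρ ≈ fromℕ (odd j) * u + fromℤ z′

  phase-0 : Phase 0# 1#
  phase-0 = record
    { σ²≈1  = *-identityʳ 1#
    ; phase = λ k u z eq → begin-equality
        sin (2π * fromℕ k * α)                ≈⟨ sin-cong (solve 3 (λ x0 x1 x2 → x0 :* x1 :* x2 := x0 :* (x1 :* x2 :- con (+ 0)))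
                ≈-refl 2π (fromℕ k) α) ⟩
        sin (2π * (fromℕ k * α - 0#))         ≈⟨ sin-cong (≈-trans (*-congˡ eq) (solve 3 (λ x0 x1 x2 → x0 :* (x1 :+ x2) := x0 :* x1 :+ x0 :* x2)
                ≈-refl 2π u (fromℤ z))) ⟩
        sin (2π * u + 2π * fromℤ z)           ≈⟨ sin-+2πz (2π * u) z ⟩
        sin (2π * u)                          ≈⟨ *-identityˡ _ ⟨
        1# * sin (2π * u)                     ∎
    ; odd-multiple = λ j k u z eq → + odd j ℤ.* z , (begin-equality
        fromℕ (odd j ℕ.* k) * α - 0#          ≈⟨ +-congʳ (*-congʳ (fromℕ-* (odd j) k)) ⟩
        fromℕ (odd j) * fromℕ k * α - 0#      ≈⟨ (solve 3 (λ x0 x1 x2 → x0 :* x1 :* x2 :- con (+ 0) := x0 :* (x1 :* x2 :- con (+ 0)))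
                ≈-refl (fromℕ (odd j)) (fromℕ k) α) ⟩
        fromℕ (odd j) * (fromℕ k * α - 0#)    ≈⟨ ≈-trans (*-congˡ eq) (solve 3 (λ x0 x1 x2 → x0 :* (x1 :+ x2) := x0 :* x1 :+ x0 :* x2)
                ≈-refl (fromℕ (odd j)) u (fromℤ z)) ⟩
        fromℕ (odd j) * u + fromℕ (odd j) * fromℤ z
                                              ≈⟨ +-congˡ (fromℤ-* (+ odd j) z) ⟨
        fromℕ (odd j) * u + fromℤ (+ odd j ℤ.* z) ∎)
    }

  phase-½ : Phase ½ (- 1#)
  phase-½ = record
    { σ²≈1  = (solve 0 ((:- (con (+ 1))) :* (:- (con (+ 1))) := con (+ 1)) ≈-refl)
    ; phase = λ k u z eq → begin-equality
        sin (2π * fromℕ k * α)                ≈⟨ sin-cong (solve 4 (λ x0 x1 x2 x3 → lit 2 :* x0 :* x1 :* x2 := lit 2 :* x0 :* (x1 :* x2 :- x3) :+ x0 :* (x3 :+ x3))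
                ≈-refl π (fromℕ k) α ½) ⟩
        sin (2π * (fromℕ k * α - ½) + π * (½ + ½))
                                              ≈⟨ sin-cong (+-cong (≈-trans (*-congˡ eq) (solve 3 (λ x0 x1 x2 → x0 :* (x1 :+ x2) := x0 :* x1 :+ x0 :* x2)
                                                      ≈-refl 2π u (fromℤ z)))
                                                                  (≈-trans (*-congˡ ½+½≈1) (*-identityʳ π))) ⟩
        sin ((2π * u + 2π * fromℤ z) + π)     ≈⟨ sin-+π _ ⟩
        - sin (2π * u + 2π * fromℤ z)         ≈⟨ -‿cong (sin-+2πz (2π * u) z) ⟩
        - sin (2π * u)                        ≈⟨ (solve 1 (λ x0 → (:- x0) := (:- (con (+ 1))) :* x0)
                ≈-refl (sin (2π * u))) ⟩
        - 1# * sin (2π * u)                   ∎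
    -- The summand j arises from (2j + 1) · ½ - ½ = j.
    ; odd-multiple = λ j k u z eq → + odd j ℤ.* z ℤ.+ + j , (begin-equality
        fromℕ (odd j ℕ.* k) * α - ½           ≈⟨ +-congʳ (*-congʳ (fromℕ-* (odd j) k)) ⟩
        fromℕ (odd j) * fromℕ k * α - ½       ≈⟨ (solve 4 (λ x0 x1 x2 x3 → x0 :* x1 :* x2 :- x3 := x0 :* (x1 :* x2 :- x3) :+ (x0 :* x3 :- x3))
                ≈-refl (fromℕ (odd j)) (fromℕ k) α ½) ⟩
        fromℕ (odd j) * (fromℕ k * α - ½) + (fromℕ (odd j) * ½ - ½)
                                              ≈⟨ +-cong (*-congˡ eq) (+-congʳ (*-congʳ (fromℕ-odd j))) ⟩
        fromℕ (odd j) * (u + fromℤ z) + ((fromℕ j + fromℕ j + 1#) * ½ - ½)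
                                              ≈⟨ (solve 5 (λ x0 x1 x2 x3 x4 → x0 :* (x1 :+ x2) :+ ((x3 :+ x3 :+ con (+ 1)) :* x4 :- x4)
                                                        := x0 :* x1 :+ (x0 :* x2 :+ x3 :* (x4 :+ x4)))
                                                      ≈-refl (fromℕ (odd j)) u (fromℤ z) (fromℕ j) ½) ⟩
        fromℕ (odd j) * u + (fromℕ (odd j) * fromℤ z + fromℕ j * (½ + ½))
                                              ≈⟨ +-congˡ (+-cong (≈-sym (fromℤ-* (+ odd j) z)) (≈-trans (*-congˡ ½+½≈1) (*-identityʳ _))) ⟩
        fromℕ (odd j) * u + (fromℤ (+ odd j ℤ.* z) + fromℤ (+ j))
                                              ≈⟨ +-congˡ (fromℤ-+ (+ odd j ℤ.* z) (+ j)) ⟨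
        fromℕ (odd j) * u + fromℤ (+ odd j ℤ.* z ℤ.+ + j) ∎)
    }

  -- Stands for 1 or -1, so that both sides of ρ and both target signs share one argument.
  record Sign (s : Carrier) : Set where
    field
      s²≈1  : s * s ≈ 1#
      ∣s∣≤1 : ∣ s ∣≤ 1#
      sin-s : ∀ x → sin (s * x) ≈ s * sin x

  sign-plus : Sign 1#
  sign-plus = record
    { s²≈1 = *-identityʳ 1# ; ∣s∣≤1 = ∣1∣≤1 ; sin-s = λ x → ≈-trans (sin-cong (*-identityˡ x)) (≈-sym (*-identityˡ _)) }

  sign-minus : Sign (- 1#)
  sign-minus = record
    { s²≈1 = (solve 0 ((:- (con (+ 1))) :* (:- (con (+ 1))) := con (+ 1)) ≈-refl) ; ∣s∣≤1 = ∣-∣≤ ∣1∣≤1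
    ; sin-s = λ x → ≈-trans (sin-cong (solve 1 (λ x0 → (:- (con (+ 1))) :* x0 := (:- x0))
            ≈-refl x)) (≈-trans (sin-neg x) (solve 1 (λ x0 → (:- x0) := (:- (con (+ 1))) :* x0)
            ≈-refl (sin x))) }

  -- From approximations to density in the half-line of sign κ

  HalfDense : Carrier → Set
  HalfDense κ = ∀ a b → 0# < a → a < b → ∃ λ k → 1 ℕ.≤ k × a < κ * value k × κ * value k < b

  midpoint : ∀ {a b} → a < b → ∃ λ c → a < c × c < b
  midpoint {a} {b} a<b = a + ½ * (b - a)
    , by-< 0<d (solve 3 (λ x0 x1 x2 → x0 :+ x1 :* (x2 :- x0) :+ con (+ 0) := x0 :+ x1 :* (x2 :- x0)) ≈-refl a ½ b)
    , by-< 0<d (≈-trans (solve 2 (λ x0 x1 → x0 :+ con (+ 0) := x1 :+ (x0 :- x1))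
            ≈-refl b a) (≈-trans (+-congˡ (≈-sym (half (b - a))))
        (solve 3 (λ x0 x1 x2 → x0 :+ (x1 :* (x2 :- x0) :+ x1 :* (x2 :- x0))
                  := x0 :+ x1 :* (x2 :- x0) :+ x1 :* (x2 :- x0))
                ≈-refl a ½ b)))
    where 0<d = 0<half (0<y-x a<b)

  -- Serves two margins: c (1 + 2h) ≤ b for the step of the sweep, and a ≤ c - 2cδ for the loss in
  -- the sine.
  small-factor : ∀ {c d} → 0# < c → 0# < d → ∃ λ q → 0# < q × (∀ r → r ≤ q → c * (r + r) ≤ d)
  small-factor {c} {d} 0<c 0<d = ½ * q , 0<half (*-pos 0<d (⁻¹-pos 0<c)) , λ r r≤ → begin
      c * (r + r)            ≤⟨ *-monoʳ-≤ (<⇒≤ 0<c) (r≤ +-≤ r≤) ⟩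
      c * (½ * q + ½ * q)    ≈⟨ *-congˡ (half q) ⟩
      c * (d * c ⁻¹)         ≈⟨ (solve 3 (λ x0 x1 x2 → x0 :* (x1 :* x2) := x1 :* (x0 :* x2)) ≈-refl c d (c ⁻¹)) ⟩
      d * (c * c ⁻¹)         ≈⟨ ≈-trans (*-congˡ (*-inverse-pos 0<c)) (*-identityʳ d) ⟩
      d                      ∎
    where q = d * c ⁻¹

  -- x² ≤ δ because x ≤ δ ≤ 1, so 6 sin x ≥ 6x - x³ ≥ 6x - xδ, which exceeds 6(x - xδ).
  x-xδ≤sin : ∀ {x δ} → 0# ≤ x → x ≤ δ → δ ≤ 1# → x - x * δ ≤ sin x
  x-xδ≤sin {x} {δ} 0≤x x≤δ δ≤1 = *-cancelʳ-≤ (0<fromℕ-suc 5) (begin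
      (x - x * δ) * fromℕ 6        ≤⟨ by-≤ (*-nonneg (0≤fromℕ 5) (*-nonneg 0≤x (≤-trans 0≤x x≤δ)))
                                        (solve 2 (λ x0 x1 → lit 6 :* x0 :- x0 :* x1 :+ con (+ 0) := (x0 :- x0 :* x1) :* lit 6 :+ lit 5 :* (x0 :* x1))
                                                ≈-refl x δ) ⟩
      fromℕ 6 * x - x * δ          ≤⟨ by-≤ (*-monoʳ-≤ 0≤x x²≤δ) (solve 2 (λ x0 x1 → lit 6 :* x0 :- x0 :* (x0 :* x0) :+ x0 :* (x0 :* x0) := lit 6 :* x0 :- x0 :* x1 :+ x0 :* x1)
              ≈-refl x δ) ⟩
      fromℕ 6 * x - x * (x * x)    ≤⟨ sin-≥ 0≤x (≤-trans (≤-trans x≤δ δ≤1) (by-≤ 0≤1 (solve 0 (lit 2 :+ con (+ 0) := con (+ 1) :+ con (+ 1))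
              ≈-refl))) ⟩
      fromℕ 6 * sin x              ≈⟨ *-comm _ _ ⟩
      sin x * fromℕ 6              ∎)
    where
    x²≤δ : x * x ≤ δ
    x²≤δ = ≤-trans (*-mono-≤ 0≤x 0≤x x≤δ (≤-trans x≤δ δ≤1)) (inj₂ (*-identityʳ δ))

  private
    -- m^(β+1) for m = 2j + 1: the factor by which passing to the multiple m k, with x replaced by m
    -- x, scales k^β x.
    G : ℕ → Carrier
    G j = p (odd j) * fromℕ (odd j)

    0<odd : ∀ j → 0# < fromℕ (odd j)
    0<odd j = 0<fromℕ (1≤odd j)

    0<G : ∀ j → 0# < G j
    0<G j = *-pos (0<p (odd j)) (0<odd j)

    j≤G : ∀ j → fromℕ j ≤ G j
    j≤G j = ≤-trans (fromℕ-mono-≤ (j≤odd j)) (x≤px (1≤odd j) (<⇒≤ (0<odd j)))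

    -- `power-growth` with h = 2(β + 1)/m, which is at most q once m reaches 2(β + 1)/q.
    G-growth : ∀ {q} → 0# < q → q ≤ ½ → ∃ λ J → ∀ j → J ℕ.≤ j → ∃ λ h → h ≤ q × G (suc j) ≤ G j * (1# + (h + h))
    G-growth {q} 0<q q≤½ = J , λ j J≤j →
        let o = fromℕ (odd j)
            h = D * o ⁻¹
            ho≈D : h * o ≈ D
            ho≈D = ≈-trans (solve 3 (λ x0 x1 x2 → x0 :* x1 :* x2 := x0 :* (x2 :* x1))
                    ≈-refl D (o ⁻¹) o) (≈-trans (*-congˡ (*-inverse-pos (0<odd j))) (*-identityʳ D))
            h≤q : h ≤ q
            h≤q = *-cancelʳ-≤ (0<odd j) (begin
              h * o             ≈⟨ ho≈D ⟩
              D                 ≈⟨ ≈-trans (*-congˡ (*-inverse-pos 0<q)) (*-identityʳ D) ⟨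
              D * (q * q ⁻¹)    ≈⟨ (solve 3 (λ x0 x1 x2 → x0 :* (x1 :* x2) := x1 :* (x0 :* x2))
                      ≈-refl D q (q ⁻¹)) ⟩
              q * (D * q ⁻¹)    ≤⟨ *-monoʳ-≤ (<⇒≤ 0<q) (≤-trans (<⇒≤ Dq⁻¹<J) (fromℕ-mono-≤ (ℕ.≤-trans J≤j (j≤odd j)))) ⟩
              q * o             ∎)
        in h , h≤q , (begin
             G (suc j)                                            ≈⟨ *-cong (^ʳ-congˡ β (0<odd (suc j)) (suc-suc j)) (suc-suc j) ⟩
             (fromℕ 2 + o) ^ʳ β * (fromℕ 2 + o)                   ≤⟨ power-growth 0<β (0<odd j) ho≈D (≤-trans h≤q q≤½) ⟩
             G j * (1# + (h + h))                                 ∎)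
      where
      D = fromℕ 2 * (β + 1#)
      J = proj₁ (archimedean (D * q ⁻¹))
      Dq⁻¹<J = proj₂ (archimedean (D * q ⁻¹))
      suc-suc : ∀ j → fromℕ (odd (suc j)) ≈ fromℕ 2 + fromℕ (odd j)
      suc-suc j = (solve 1 (λ x0 → con (+ 1) :+ (con (+ 1) :+ x0) := lit 2 :+ x0) ≈-refl (fromℕ (odd j)))

  -- w G starts below c at J and is unbounded because G j ≥ j; a step that passes c multiplies by at
  -- most 1 + 2h and therefore lands below b.
  G-sweep : ∀ {b c w q J} → 0# < c → c < b → (∀ r → r ≤ q → c * (r + r) ≤ b - c) →
            (∀ j → J ℕ.≤ j → ∃ λ h → h ≤ q × G (suc j) ≤ G j * (1# + (h + h))) →
            0# < w → w * G J < c → ∃ λ i → c ≤ w * G i × w * G i < b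
  G-sweep {b} {c} {w} {q} {J} 0<c c<b factor growth 0<w wGJ<c =
    finish (crossing (λ j → w * G j) c J M wGJ<c c≤wGM)
    where
    M = proj₁ (archimedean (c * w ⁻¹))
    c≤wGM : c ≤ w * G (M ℕ.+ J)
    c≤wGM = begin
      c                    ≈⟨ ≈-trans (*-congˡ (*-inverse-pos 0<w)) (*-identityʳ c) ⟨
      c * (w * w ⁻¹)       ≈⟨ (solve 3 (λ x0 x1 x2 → x0 :* (x1 :* x2) := x1 :* (x0 :* x2)) ≈-refl c w (w ⁻¹)) ⟩
      w * (c * w ⁻¹)       ≤⟨ *-monoʳ-≤ (<⇒≤ 0<w) (≤-trans (<⇒≤ (proj₂ (archimedean (c * w ⁻¹))))
                                (≤-trans (fromℕ-mono-≤ (ℕ.m≤m+n M J)) (j≤G (M ℕ.+ J)))) ⟩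
      w * G (M ℕ.+ J)      ∎
    below : ∀ {g g′ h} → 0# < g → w * g < c → h ≤ q → g′ ≤ g * (1# + (h + h)) → w * g′ < b
    -- Only an upper bound for h is at hand; if h is nonpositive, the growth factor is at most 1.
    below {g} {g′} {h} 0<g wg<c h≤q g′≤ with ≤-total 0# h
    ... | inj₂ h≤0 = begin-strict
      w * g′                      ≤⟨ *-monoʳ-≤ (<⇒≤ 0<w) g′≤ ⟩
      w * (g * (1# + (h + h)))    ≤⟨ *-monoʳ-≤ (<⇒≤ 0<w) (*-monoʳ-≤ (<⇒≤ 0<g) (by-≤ (h≤0 +-≤ h≤0) (solve 1 (λ x0 → con (+ 1) :+ (x0 :+ x0) := con (+ 1) :+ (x0 :+ x0) :+ (con (+ 0) :+ con (+ 0)))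
              ≈-refl h))) ⟩
      w * (g * 1#)                ≈⟨ *-congˡ (*-identityʳ g) ⟩
      w * g                       <⟨ wg<c ⟩
      c                           <⟨ c<b ⟩
      b                           ∎
    ... | inj₁ 0≤h = begin-strict
      w * g′                      ≤⟨ *-monoʳ-≤ (<⇒≤ 0<w) g′≤ ⟩
      w * (g * (1# + (h + h)))    ≈⟨ (solve 3 (λ x0 x1 x2 → x0 :* (x1 :* (con (+ 1) :+ (x2 :+ x2))) := x0 :* x1 :* (con (+ 1) :+ (x2 :+ x2)))
              ≈-refl w g h) ⟩
      w * g * (1# + (h + h))      <⟨ *-monoˡ-< (<-≤-trans 0<1 (by-≤ (0≤h +-≤ 0≤h) (solve 1 (λ x0 → con (+ 1) :+ (x0 :+ x0) :+ (con (+ 0) :+ con (+ 0)) := con (+ 1) :+ (x0 :+ x0))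
              ≈-refl h))) wg<c ⟩
      c * (1# + (h + h))          ≤⟨ by-≤ (factor h h≤q) (solve 3 (λ x0 x1 x2 → x0 :+ x1 :* (x2 :+ x2) := x1 :* (con (+ 1) :+ (x2 :+ x2)) :+ (x0 :- x1))
              ≈-refl b c h) ⟩
      b                           ∎
    finish : (∃ λ n → J ℕ.≤ n × w * G n < c × c ≤ w * G (suc n)) → ∃ λ i → c ≤ w * G i × w * G i < b
    finish (j , J≤j , wGj<c , c≤wGi) with growth j J≤j
    ... | h , h≤q , Gi≤ = suc j , c≤wGi , below (0<G j) wGj<c h≤q Gi≤

  -- sin y lies between y - yδ and y, so P sin y lies between v - vδ and v; the distance from a to c
  -- leaves room for that loss.
  sine-window : ∀ {a b c δ P y v} → 0# < c → 0# < δ → δ ≤ 1# → c * (δ + δ) ≤ c - a →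
                0# < P → 0# ≤ y → y ≤ δ → P * y ≈ v → c ≤ v → v < b → a < P * sin y × P * sin y < b
  sine-window {a} {b} {c} {δ} {P} {y} {v} 0<c 0<δ δ≤1 2cδ≤ 0<P 0≤y y≤δ Py≈v c≤v v<b =
    (begin-strict
      a                          <⟨ by-< (2cδ≤ +-≤< *-pos 0<c 0<δ) (solve 3 (λ x0 x1 x2 → x0 :- x0 :* x1 :+ (x0 :* (x1 :+ x1) :+ con (+ 0)) := x2 :+ (x0 :- x2 :+ x0 :* x1))
              ≈-refl c δ a) ⟩
      c - c * δ                  ≤⟨ by-≤ (*-nonneg (0≤y-x c≤v) (0≤y-x δ≤1)) (solve 3 (λ x0 x1 x2 → x0 :- x0 :* x1 :+ con (+ 0) := x2 :- x2 :* x1 :+ (x0 :- x2) :* (con (+ 1) :- x1))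
              ≈-refl v δ c) ⟩
      v - v * δ                  ≈⟨ +-cong (≈-sym Py≈v) (-‿cong (*-congʳ (≈-sym Py≈v))) ⟩
      P * y - P * y * δ          ≈⟨ (solve 3 (λ x0 x1 x2 → x0 :* x1 :- x0 :* x1 :* x2 := x0 :* (x1 :- x1 :* x2))
              ≈-refl P y δ) ⟩
      P * (y - y * δ)            ≤⟨ *-monoʳ-≤ (<⇒≤ 0<P) (x-xδ≤sin 0≤y y≤δ δ≤1) ⟩
      P * sin y                  ∎)
    , (begin-strict
      P * sin y                  ≤⟨ *-monoʳ-≤ (<⇒≤ 0<P) (sin-≤ 0≤y y≤2) ⟩
      P * y                      ≈⟨ Py≈v ⟩
      v                          <⟨ v<b ⟩
      b                          ∎)
    where
    y≤2 : y ≤ fromℕ 2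
    y≤2 = ≤-trans y≤δ (≤-trans δ≤1 (by-≤ 0≤1 (solve 0 (lit 2 :+ con (+ 0) := con (+ 1) :+ con (+ 1)) ≈-refl)))

  -- The phase produces σ and the oddness of the sine produces s; the prefactor σ s turns both into
  -- squares.
  odd-multiple-value : ∀ {ρ σ s} → Phase ρ σ → Sign s → ∀ i k x z → fromℕ k * α - ρ ≈ s * x + fromℤ z →
    σ * s * value (odd i ℕ.* k) ≈ p (odd i ℕ.* k) * sin (2π * (fromℕ (odd i) * x))
  odd-multiple-value {ρ} {σ} {s} φ sgn i k x z eq = begin-equality
    σ * s * (P * sin (2π * fromℕ (odd i ℕ.* k) * α))
      ≈⟨ *-congˡ (*-congˡ (uncurry (phase (odd i ℕ.* k) (fromℕ (odd i) * (s * x))) (odd-multiple i k (s * x) z eq))) ⟩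
    σ * s * (P * (σ * sin (2π * (fromℕ (odd i) * (s * x)))))
      ≈⟨ *-congˡ (*-congˡ (*-congˡ (≈-trans (sin-cong (solve 4 (λ x0 x1 x2 x3 → x0 :* (x1 :* (x2 :* x3)) := x2 :* (x0 :* (x1 :* x3)))
              ≈-refl 2π (fromℕ (odd i)) s x)) (sin-s y)))) ⟩
    σ * s * (P * (σ * (s * sin y)))
      ≈⟨ (solve 4 (λ x0 x1 x2 x3 → x0 :* x1 :* (x2 :* (x0 :* (x1 :* x3))) := x0 :* x0 :* (x1 :* x1) :* (x2 :* x3))
              ≈-refl σ s P (sin y)) ⟩
    (σ * σ) * (s * s) * (P * sin y)
      ≈⟨ *-congʳ (*-cong σ²≈1 s²≈1) ⟩
    1# * 1# * (P * sin y)
      ≈⟨ (solve 2 (λ x0 x1 → con (+ 1) :* con (+ 1) :* (x0 :* x1) := x0 :* x1) ≈-refl P (sin y)) ⟩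
    P * sin y
      ∎
    where
    open Phase φ
    open Sign sgn
    P = p (odd i ℕ.* k)
    y = 2π * (fromℕ (odd i) * x)

  private
    -- Explains the tolerance c / (2π G J): it puts the start of the sweep below c.
    scale-start : ∀ {c P x g} → 0# < 2π * g → P * x < c * (2π * g) ⁻¹ → 2π * (P * x) * g < c
    scale-start {c} {P} {x} {g} 0<W Px<ε = begin-strict
      2π * (P * x) * g               ≈⟨ (solve 4 (λ x0 x1 x2 x3 → x0 :* (x1 :* x2) :* x3 := x0 :* x3 :* (x1 :* x2))
              ≈-refl 2π P x g) ⟩
      2π * g * (P * x)               <⟨ *-monoʳ-< 0<W Px<ε ⟩
      2π * g * (c * (2π * g) ⁻¹)     ≈⟨ (solve 4 (λ x0 x1 x2 x3 → x0 :* x1 :* (x2 :* x3) := x2 :* (x0 :* x1 :* x3))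
              ≈-refl 2π g c ((2π * g) ⁻¹)) ⟩
      c * (2π * g * (2π * g) ⁻¹)     ≈⟨ ≈-trans (*-congˡ (*-inverse-pos 0<W)) (*-identityʳ c) ⟩
      c                              ∎
    Py≈v : ∀ i {k x} → 1 ℕ.≤ k → p (odd i ℕ.* k) * (2π * (fromℕ (odd i) * x)) ≈ 2π * (p k * x) * G i
    Py≈v i {k} {x} 1≤k = ≈-trans (*-congʳ (p-* (1≤odd i) 1≤k))
      (solve 5 (λ x0 x1 x2 x3 x4 → x0 :* x1 :* (x2 :* (x3 :* x4)) := x2 :* (x1 :* x4) :* (x0 :* x3))
              ≈-refl (p (odd i)) (p k) 2π (fromℕ (odd i)) x)
    -- P y = v < b, while P = (mk)^β ≥ k^β ≥ b/δ. This bounds the angle independently of the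
    -- multiplier at which the sweep stops.
    y≤δ : ∀ i {k x δ b} → 1 ℕ.≤ k → 0# < δ → b * δ ⁻¹ ≤ p k → 2π * (p k * x) * G i < b → 2π * (fromℕ (odd i) * x) ≤ δ
    y≤δ i {k} {x} {δ} {b} 1≤k 0<δ bδ⁻¹≤p v<b = *-cancelʳ-≤ (0<p (odd i ℕ.* k)) (begin
      y * P                    ≈⟨ ≈-trans (*-comm y P) (Py≈v i 1≤k) ⟩
      2π * (p k * x) * G i     ≤⟨ <⇒≤ v<b ⟩
      b                        ≈⟨ ≈-trans (*-congˡ (*-inverse-pos 0<δ)) (*-identityʳ b) ⟨
      b * (δ * δ ⁻¹)           ≈⟨ (solve 3 (λ x0 x1 x2 → x0 :* (x1 :* x2) := x1 :* (x0 :* x2)) ≈-refl b δ (δ ⁻¹)) ⟩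
      δ * (b * δ ⁻¹)           ≤⟨ *-monoʳ-≤ (<⇒≤ 0<δ) (≤-trans bδ⁻¹≤p (≤-trans (x≤px (1≤odd i) (<⇒≤ (0<p k))) (inj₂ (≈-sym (p-* (1≤odd i) 1≤k))))) ⟩
      δ * P                    ∎)
      where
      y = 2π * (fromℕ (odd i) * x)
      P = p (odd i ℕ.* k)

  -- Odd multiples of one good k: w G i sweeps past c in steps of ratio near 1, and sin y ≈ y at that scale.
  small⇒half-dense : ∀ {ρ σ s} → Phase ρ σ → Sign s → Small ρ s → HalfDense (σ * s)
  small⇒half-dense {ρ} {σ} {s} φ sgn small a b 0<a a<b =
    case midpoint a<b of λ { (c , a<c , c<b) →
    case small-factor (<-trans 0<a a<c) (0<y-x a<c) of λ { (q₁ , 0<q₁ , factor₁) →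
    case small-factor (<-trans 0<a a<c) (0<y-x c<b) of λ { (q₂ , 0<q₂ , factor₂) →
    case min₂ 0<q₁ 0<1 of λ { (δ , 0<δ , δ≤q₁ , δ≤1) →
    case min₂ 0<q₂ 0<½ of λ { (q , 0<q , q≤q₂ , q≤½) →
    case G-growth 0<q q≤½ of λ { (J , growth) →
    case ^ʳ-unbounded 0<β (b * δ ⁻¹) of λ { (K , _ , large) →
    case small K (c * (2π * G J) ⁻¹) (*-pos (<-trans 0<a a<c) (⁻¹-pos (*-pos 0<2π (0<G J)))) of
      λ { (k , 1≤k , K≤k , x , z , 0<x , px<ε , eq) →
    case G-sweep (<-trans 0<a a<c) c<b (λ r r≤q → factor₂ r (≤-trans r≤q q≤q₂)) growth
           (*-pos 0<2π (*-pos (0<p k) 0<x)) (scale-start (*-pos 0<2π (0<G J)) px<ε) of λ { (i , c≤v , v<b) →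
    case sine-window (<-trans 0<a a<c) 0<δ δ≤1 (factor₁ δ δ≤q₁) (0<p (odd i ℕ.* k))
           (<⇒≤ (*-pos 0<2π (*-pos (0<odd i) 0<x))) (y≤δ i 1≤k 0<δ (large k K≤k) v<b) (Py≈v i 1≤k) c≤v v<b of λ { (a<Py , Py<b) →
      odd i ℕ.* k , ℕ.*-mono-≤ (1≤odd i) 1≤k
      , <-≤-trans a<Py (inj₂ (≈-sym (odd-multiple-value φ sgn i k x z eq)))
      , ≤-<-trans (inj₂ (odd-multiple-value φ sgn i k x z eq)) Py<b
    }}}}}}}}}}

  Values : Carrier → Set
  Values y = ∃ λ k → 1 ℕ.≤ k × y ≈ value k

  half-dense⇒dense : HalfDense 1# → HalfDense (- 1#) → Dense Values
  half-dense⇒dense dense₊ dense₋ a b a<b = [ above , below ]′ (<-≤-total 0# b)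
    where
    Hit : Set
    Hit = ∃ λ y → Values y × a < y × y < b
    hit₊ : ∀ {a′} → 0# < a′ → a ≤ a′ → a′ < b → Hit
    hit₊ {a′} 0<a′ a≤a′ a′<b = case dense₊ a′ b 0<a′ a′<b of λ { (k , 1≤k , a′<v , v<b) →
      value k , (k , 1≤k , ≈-refl) , ≤-<-trans a≤a′ (<-≤-trans a′<v (inj₂ (*-identityˡ _))) , ≤-<-trans (inj₂ (≈-sym (*-identityˡ _))) v<b }
    above : 0# < b → Hit
    above 0<b = [ (λ 0<a → hit₊ 0<a ≤-refl a<b)
                , (λ a≤0 → case midpoint 0<b of λ { (c , 0<c , c<b) → hit₊ 0<c (≤-trans a≤0 (<⇒≤ 0<c)) c<b }) ]′ (<-≤-total 0# a)
    below : b ≤ 0# → Hit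
    -- As b may be 0, the interval is first cut at a midpoint c < 0, so that its reflection starts
    -- at the positive number -c.
    below b≤0 = case midpoint a<b of λ { (c , a<c , c<b) →
      case dense₋ (- c) (- a) (by-< (<-≤-trans c<b b≤0) (solve 1 (λ x0 → (:- x0) :+ x0 := con (+ 0) :+ con (+ 0))
              ≈-refl c)) (neg-< a<c) of λ { (k , 1≤k , -c<v , v<-a) →
        value k , (k , 1≤k , ≈-refl)
        , by-< v<-a (solve 2 (λ x0 x1 → x0 :+ (:- (con (+ 1))) :* x0 := x1 :+ (:- x1)) ≈-refl (value k) a)
        , <-trans (by-< -c<v (solve 2 (λ x0 x1 → x0 :+ (:- x0) := x1 :+ (:- (con (+ 1))) :* x1)
                ≈-refl c (value k))) c<b } }

-- From density to approximations, and the equivalence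

module Corollary (lem : ExcludedMiddle 0ℓ) (R : CompleteOrderedField)
                 (β α : CompleteOrderedField.Carrier R)
                 (0<β : CompleteOrderedField._<_ R (CompleteOrderedField.0# R) β) where

  open OrderedField lem R
  open Series lem R
  open ExpSinCos lem R
  open Trigonometry lem R
  open PiLnPowers lem R
  open FractionalPartLiminf lem R
  open SineDensity lem R β α 0<β
  open ≤-Reasoning

  -- Parity is phrased for reals, so that successor and negation become ring identities.
  EvenOrOdd : Carrier → Set
  EvenOrOdd x = ∃ λ z → x ≈ fromℤ z + fromℤ z ⊎ x ≈ fromℤ z + fromℤ z + 1#

  evenOrOdd-suc : ∀ {x} → EvenOrOdd x → EvenOrOdd (1# + x)
  evenOrOdd-suc (z , inj₁ even) = z , inj₂ (≈-trans (+-congˡ even) (+-comm _ _))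
  evenOrOdd-suc (z , inj₂ odd)  = z ℤ.+ + 1 , inj₁ (≈-trans (+-congˡ odd) (≈-trans
    (solve 1 (λ x0 → con (+ 1) :+ (x0 :+ x0 :+ con (+ 1))
              := x0 :+ (con (+ 1) :+ con (+ 0)) :+ (x0 :+ (con (+ 1) :+ con (+ 0))))
            ≈-refl (fromℤ z))
    (≈-sym (+-cong (fromℤ-+ z (+ 1)) (fromℤ-+ z (+ 1))))))

  evenOrOdd-neg : ∀ {x} → EvenOrOdd x → EvenOrOdd (- x)
  evenOrOdd-neg (z , inj₁ even) = ℤ.- z , inj₁ (≈-trans (-‿cong even)
    (≈-trans (solve 1 (λ x0 → (:- (x0 :+ x0)) := (:- x0) :+ (:- x0))
            ≈-refl (fromℤ z)) (≈-sym (+-cong (fromℤ-neg z) (fromℤ-neg z)))))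
  evenOrOdd-neg (z , inj₂ odd)  = ℤ.- (z ℤ.+ + 1) , inj₂ (≈-trans (-‿cong odd) (≈-trans
    (solve 1 (λ x0 → (:- (x0 :+ x0 :+ con (+ 1)))
              := (:- (x0 :+ (con (+ 1) :+ con (+ 0)))) :+ (:- (x0 :+ (con (+ 1) :+ con (+ 0)))) :+ con (+ 1))
            ≈-refl (fromℤ z))
    (+-congʳ (≈-sym (+-cong neg neg)))))
    where
    neg : fromℤ (ℤ.- (z ℤ.+ + 1)) ≈ - (fromℤ z + (1# + 0#))
    neg = ≈-trans (fromℤ-neg (z ℤ.+ + 1)) (-‿cong (fromℤ-+ z (+ 1)))

  parity : ∀ N → EvenOrOdd (fromℤ N)
  parity (+ zero)     = + 0 , inj₁ (solve 0 (con (+ 0) := con (+ 0) :+ con (+ 0)) ≈-refl)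
  parity (+ suc n)    = evenOrOdd-suc (parity (+ n))
  parity -[1+ zero ]  = evenOrOdd-neg (evenOrOdd-suc (parity (+ zero)))
  parity -[1+ suc n ] = evenOrOdd-neg (evenOrOdd-suc (evenOrOdd-suc (parity (+ n))))

  halve : ∀ {u v} → u + u ≈ v + v → u ≈ v
  halve {u} {v} eq = *-cancelˡ-≈ 0<2 (≈-trans (solve 1 (λ x0 → lit 2 :* x0 := x0 :+ x0)
          ≈-refl u) (≈-trans eq (solve 1 (λ x0 → x0 :+ x0 := lit 2 :* x0)
          ≈-refl v)))

  -- Half of 2x = y + n: an even n leaves x congruent to y/2 modulo 1, an odd n adds ½.
  halve-parity : ∀ {x y n z} → x + x - y ≈ n → n ≈ z + z ⊎ n ≈ z + z + 1# →
          x - 0# ≈ ½ * y + z ⊎ x - ½ ≈ ½ * y + z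
  halve-parity {x} {y} {n} {z} eq (inj₁ even) = inj₁ (halve (begin-equality
    (x - 0#) + (x - 0#)                                  ≈⟨ (solve 2 (λ x0 x1 → x0 :- con (+ 0) :+ (x0 :- con (+ 0)) := x1 :+ (x0 :+ x0 :- x1))
            ≈-refl x y) ⟩
      y + (x + x - y)                                      ≈⟨ +-cong (≈-sym (half y)) (≈-trans eq even) ⟩
    (½ * y + ½ * y) + (z + z)                  ≈⟨ (solve 3 (λ x0 x1 x2 → x0 :* x1 :+ x0 :* x1 :+ (x2 :+ x2) := x0 :* x1 :+ x2 :+ (x0 :* x1 :+ x2))
            ≈-refl ½ y z) ⟩
    (½ * y + z) + (½ * y + z)                  ∎))
  halve-parity {x} {y} {n} {z} eq (inj₂ odd)  = inj₂ (halve (begin-equality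
    (x - ½) + (x - ½)                                    ≈⟨ (solve 3 (λ x0 x1 x2 → x0 :- x1 :+ (x0 :- x1) := x2 :+ (x0 :+ x0 :- x2) :- (x1 :+ x1))
            ≈-refl x ½ y) ⟩
      y + (x + x - y) - (½ + ½)                            ≈⟨ +-cong (+-cong (≈-sym (half y)) (≈-trans eq odd)) (-‿cong ½+½≈1) ⟩
    (½ * y + ½ * y) + (z + z + 1#) - 1#        ≈⟨ (solve 3 (λ x0 x1 x2 → x0 :* x1 :+ x0 :* x1 :+ (x2 :+ x2 :+ con (+ 1)) :- con (+ 1)
              := x0 :* x1 :+ x2 :+ (x0 :* x1 :+ x2))
            ≈-refl ½ y z) ⟩
    (½ * y + z) + (½ * y + z)                  ∎))

  -- t is half the signed fractional part of 2kα, hence at most ¼ in size, and the parity of the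
  -- integer removed decides between 0 and ½.
  near-0-or-½ : ∀ k → ∃ λ t → ∣ t ∣≤ ½ * ½ × ∃ λ z →
                fromℕ k * α - 0# ≈ t + fromℤ z ⊎ fromℕ k * α - ½ ≈ t + fromℤ z
  near-0-or-½ k = from-frac (frac-exists (fromℕ k * α + fromℕ k * α))
    where
    from-frac : ∃ (IsFrac (fromℕ k * α + fromℕ k * α)) → ∃ λ t → ∣ t ∣≤ ½ * ½ × ∃ λ z →
                fromℕ k * α - 0# ≈ t + fromℤ z ⊎ fromℕ k * α - ½ ≈ t + fromℤ z
    from-frac (y , -½≤y , y<½ , N , eq) = ½ * y , ∣*∣≤ (nonneg⇒∣∣≤ (<⇒≤ 0<½)) (-½≤y , <⇒≤ y<½)
      , proj₁ (parity N) , halve-parity eq (proj₂ (parity N))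

  -- Keeps the angles 2πt with |t| ≤ ¼ inside the range where the sine estimates hold.
  2π¼≤2 : 2π * (½ * ½) ≤ fromℕ 2
  2π¼≤2 = begin
    2π * (½ * ½)                    ≈⟨ (solve 2 (λ x0 x1 → lit 2 :* x0 :* (x1 :* x1) := x0 :* x1 :* (x1 :+ x1))
            ≈-refl π ½) ⟩
    π * ½ * (½ + ½)                 ≈⟨ ≈-trans (*-congˡ ½+½≈1) (*-identityʳ _) ⟩
    π * ½                           ≤⟨ *-monoˡ-≤ (<⇒≤ 0<½) π≤4 ⟩
    fromℕ 4 * ½                     ≈⟨ (solve 1 (λ x0 → lit 4 :* x0 := lit 2 :* (x0 :+ x0)) ≈-refl ½) ⟩
    fromℕ 2 * (½ + ½)               ≈⟨ ≈-trans (*-congˡ ½+½≈1) (*-identityʳ _) ⟩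
    fromℕ 2                         ∎

  -- For |2πx| ≤ 2 the sine has the sign of x, and 3x ≤ 2πx ≤ 3 sin(2πx).
  sin-pos⇒bound : ∀ {x} → ∣ x ∣≤ ½ * ½ → 0# < sin (2π * x) → 0# < x × x ≤ sin (2π * x)
  sin-pos⇒bound {x} (l , u) 0<sin = 0<x , x≤sin
    where
    0<x : 0# < x
    0<x with <-≤-total 0# x
    ... | inj₁ 0<x = 0<x
    ... | inj₂ x≤0 = contradiction 0<sin (≤⇒≯ (begin
        sin (2π * x)          ≈⟨ sin-cong (solve 2 (λ x0 x1 → x0 :* x1 := (:- (x0 :* (:- x1)))) ≈-refl 2π x) ⟩
        sin (- (2π * - x))    ≈⟨ sin-neg _ ⟩
        - sin (2π * - x)      ≤⟨ neg-≤ (sin-nonneg (*-nonneg (<⇒≤ 0<2π) (by-≤ x≤0 (solve 1 (λ x0 → (:- x0) :+ x0 := con (+ 0) :+ con (+ 0))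
                ≈-refl x))) 2π-x≤2) ⟩
        - 0#                  ≈⟨ (solve 0 ((:- (con (+ 0))) := con (+ 0)) ≈-refl) ⟩
        0#                    ∎))
      where
      2π-x≤2 : 2π * - x ≤ fromℕ 2
      2π-x≤2 = ≤-trans (*-monoʳ-≤ (<⇒≤ 0<2π) (by-≤ l (solve 2 (λ x0 x1 → x0 :* x0 :+ (:- (x0 :* x0)) := (:- x1) :+ x1)
              ≈-refl ½ x))) 2π¼≤2
    x≤sin : x ≤ sin (2π * x)
    x≤sin = *-cancelʳ-≤ 0<3 (begin
      x * fromℕ 3                ≤⟨ *-monoʳ-≤ (<⇒≤ 0<x) 3≤2π ⟩
      x * 2π                     ≈⟨ *-comm x 2π ⟩
      2π * x                     ≤⟨ x≤3sin (*-nonneg (<⇒≤ 0<2π) (<⇒≤ 0<x)) (≤-trans (*-monoʳ-≤ (<⇒≤ 0<2π) u) 2π¼≤2) ⟩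
      fromℕ 3 * sin (2π * x)     ≈⟨ *-comm _ _ ⟩
      sin (2π * x) * fromℕ 3     ∎)
      where
      3≤2π : fromℕ 3 ≤ 2π
      3≤2π = ≤-trans (by-≤ 0≤1 (solve 0 (lit 2 :* lit 2 :+ con (+ 0) := lit 3 :+ con (+ 1))
              ≈-refl)) (*-monoʳ-≤ (<⇒≤ 0<2) 2≤π)

  sign-* : ∀ {s s′} → Sign s → Sign s′ → Sign (s * s′)
  sign-* {s} {s′} sgn sgn′ = record
    { s²≈1  = ≈-trans (solve 2 (λ x0 x1 → x0 :* x1 :* (x0 :* x1) := x0 :* x0 :* (x1 :* x1)) ≈-refl s s′)
                (≈-trans (*-cong (Sign.s²≈1 sgn) (Sign.s²≈1 sgn′)) (*-identityʳ 1#))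
    ; ∣s∣≤1 = ∣∣≤-cong ≈-refl (*-identityʳ 1#) (∣*∣≤ (Sign.∣s∣≤1 sgn) (Sign.∣s∣≤1 sgn′))
    ; sin-s = λ x → begin-equality
        sin (s * s′ * x)      ≈⟨ sin-cong (solve 3 (λ x0 x1 x2 → x0 :* x1 :* x2 := x0 :* (x1 :* x2))
                ≈-refl s s′ x) ⟩
        sin (s * (s′ * x))    ≈⟨ Sign.sin-s sgn (s′ * x) ⟩
        s * sin (s′ * x)      ≈⟨ *-congˡ (Sign.sin-s sgn′ x) ⟩
        s * (s′ * sin x)      ≈⟨ (solve 3 (λ x0 x1 x2 → x0 :* (x1 :* x2) := x0 :* x1 :* x2) ≈-refl s s′ (sin x)) ⟩
        s * s′ * sin x        ∎ }

  -- With x = τσt the signed value τ k^β sin(2πkα) equals k^β sin(2πx); its positivity makes x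
  -- positive, and x ≤ sin(2πx) passes its smallness on to k^β x.
  small-value⇒smallAt : ∀ {ρ σ τ n ε k t z} → Phase ρ σ → Sign (τ * σ) → 1 ℕ.≤ k → n ℕ.≤ k → ∣ t ∣≤ ½ * ½ →
    fromℕ k * α - ρ ≈ t + fromℤ z → 0# < τ * value k → τ * value k < ε → SmallAt ρ (τ * σ) n ε
  small-value⇒smallAt {ρ} {σ} {τ} {n} {ε} {k} {t} {z} φ sgn 1≤k n≤k ∣t∣≤¼ eq 0<τv τv<ε =
    k , 1≤k , n≤k , x , z , proj₁ bound
    , ≤-<-trans (≤-trans (*-monoʳ-≤ (<⇒≤ (0<p k)) (proj₂ bound)) (inj₂ (≈-sym τv≈))) τv<ε
    , ≈-trans eq (+-congʳ (≈-sym (≈-trans (solve 2 (λ x0 x1 → x0 :* (x0 :* x1) := x0 :* x0 :* x1)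
            ≈-refl s t) (≈-trans (*-congʳ s²≈1) (*-identityˡ t)))))
    where
    open Sign sgn
    s = τ * σ
    x = s * t
    τv≈ : τ * value k ≈ p k * sin (2π * x)
    τv≈ = begin-equality
      τ * (p k * sin (2π * fromℕ k * α))    ≈⟨ *-congˡ (*-congˡ (Phase.phase φ k t z eq)) ⟩
      τ * (p k * (σ * sin (2π * t)))        ≈⟨ (solve 4 (λ x0 x1 x2 x3 → x0 :* (x1 :* (x2 :* x3)) := x1 :* (x0 :* x2 :* x3))
              ≈-refl τ (p k) σ (sin (2π * t))) ⟩
      p k * (s * sin (2π * t))              ≈⟨ *-congˡ (sin-s (2π * t)) ⟨
      p k * sin (s * (2π * t))              ≈⟨ *-congˡ (sin-cong (solve 3 (λ x0 x1 x2 → x0 :* (x1 :* x2) := x1 :* (x0 :* x2))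
              ≈-refl s 2π t)) ⟩
      p k * sin (2π * x)                    ∎
    bound : 0# < x × x ≤ sin (2π * x)
    bound = sin-pos⇒bound (∣∣≤-cong ≈-refl (*-identityˡ _) (∣*∣≤ ∣s∣≤1 ∣t∣≤¼))
      (*-cancelʳ-< (<⇒≤ (0<p k)) (≤-<-trans (inj₂ (zeroˡ (p k))) (<-≤-trans 0<τv (inj₂ (≈-trans τv≈ (*-comm _ _))))))

  NearZero : Carrier → Set
  NearZero τ = ∀ d → 0# < d → ∃ λ k → 1 ℕ.≤ k × 0# < τ * value k × τ * value k < d

  dense⇒near-zero₊ : Dense Values → NearZero 1#
  dense⇒near-zero₊ dense d 0<d = case dense 0# d 0<d of λ { (y , (k , 1≤k , y≈v) , 0<y , y<d) →
    let y≈1v = ≈-trans y≈v (≈-sym (*-identityˡ _))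
    in k , 1≤k , <-≤-trans 0<y (inj₂ y≈1v) , ≤-<-trans (inj₂ (≈-sym y≈1v)) y<d }

  dense⇒near-zero₋ : Dense Values → NearZero (- 1#)
  dense⇒near-zero₋ dense d 0<d =
    case dense (- d) 0# (by-< 0<d (solve 1 (λ x0 → con (+ 0) :+ con (+ 0) := (:- x0) :+ x0)
            ≈-refl d)) of λ { (y , (k , 1≤k , y≈v) , -d<y , y<0) →
      let -y≈ = ≈-trans (-‿cong y≈v) (solve 1 (λ x0 → (:- x0) := (:- (con (+ 1))) :* x0) ≈-refl (value k))
      in k , 1≤k , <-≤-trans (by-< y<0 (solve 1 (λ x0 → (:- x0) :+ x0 := con (+ 0) :+ con (+ 0))
              ≈-refl y)) (inj₂ -y≈)
       , ≤-<-trans (inj₂ (≈-sym -y≈)) (by-< -d<y (solve 2 (λ x0 x1 → x0 :+ (:- x0) := (:- x1) :+ x1) ≈-refl d y)) }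

  positive-lower-bound : ∀ (g : ℕ → Carrier) n → ∃ λ δ → 0# < δ × (∀ k → k ℕ.< n → 0# < g k → δ ≤ g k)
  positive-lower-bound g zero = 1# , 0<1 , λ _ ()
  positive-lower-bound g (suc n) with positive-lower-bound g n | <-≤-total 0# (g n)
  ... | δ , 0<δ , below | inj₁ 0<gn = let δ′ , 0<δ′ , δ′≤δ , δ′≤gn = min₂ 0<δ 0<gn in
        δ′ , 0<δ′ , λ k k<1+n 0<gk → extend δ′≤δ δ′≤gn k 0<gk (ℕ.m≤n⇒m<n∨m≡n (ℕ.s≤s⁻¹ k<1+n))
    where
    extend : ∀ {δ′} → δ′ ≤ δ → δ′ ≤ g n → ∀ k → 0# < g k → k ℕ.< n ⊎ k ≡ n → δ′ ≤ g k
    extend δ′≤δ δ′≤gn k 0<gk (inj₁ k<n)    = ≤-trans δ′≤δ (below k k<n 0<gk)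
    extend δ′≤δ δ′≤gn k 0<gk (inj₂ ≡.refl) = δ′≤gn
  ... | δ , 0<δ , below | inj₂ gn≤0 = δ , 0<δ , λ k k<1+n 0<gk → extend k 0<gk (ℕ.m≤n⇒m<n∨m≡n (ℕ.s≤s⁻¹ k<1+n))
    where
    extend : ∀ k → 0# < g k → k ℕ.< n ⊎ k ≡ n → δ ≤ g k
    extend k 0<gk (inj₁ k<n)    = below k k<n 0<gk
    extend k 0<gk (inj₂ ≡.refl) = contradiction 0<gk (≤⇒≯ gn≤0)

  -- A positive value below the least positive value among the indices under n can only occur at an
  -- index n or later.
  near-zero-beyond : ∀ {τ} → NearZero τ → ∀ n ε → 0# < ε →
    ∃ λ k → 1 ℕ.≤ k × n ℕ.≤ k × 0# < τ * value k × τ * value k < ε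
  near-zero-beyond {τ} near n ε 0<ε =
    case positive-lower-bound (λ k → τ * value k) n of λ { (δ , 0<δ , below) →
    case min₂ 0<ε 0<δ of λ { (d , 0<d , d≤ε , d≤δ) →
    case near d 0<d of λ { (k , 1≤k , 0<v , v<d) →
    case ℕ.≤-<-connex n k of λ
      { (inj₁ n≤k) → k , 1≤k , n≤k , 0<v , <-≤-trans v<d d≤ε
      ; (inj₂ k<n) → contradiction (<-≤-trans v<d d≤δ) (≤⇒≯ (below k k<n 0<v)) } }}}

  smallAt-weaken : ∀ {ρ s m n δ ε} → n ℕ.≤ m → δ ≤ ε → SmallAt ρ s m δ → SmallAt ρ s n ε
  smallAt-weaken n≤m δ≤ε (k , 1≤k , m≤k , x , z , 0<x , px<δ , eq) =
    k , 1≤k , ℕ.≤-trans n≤m m≤k , x , z , 0<x , <-≤-trans px<δ δ≤ε , eq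

  -- If the first kind fails for some m and δ, it fails for all later indices and smaller
  -- tolerances, so there the second kind always occurs.
  small-⊎ : ∀ {ρ s ρ′ s′} → (∀ n ε → 0# < ε → SmallAt ρ s n ε ⊎ SmallAt ρ′ s′ n ε) → Small ρ s ⊎ Small ρ′ s′
  small-⊎ {ρ} {s} {ρ′} {s′} either with lem {∃ λ n → ∃ λ ε → 0# < ε × ¬ SmallAt ρ s n ε}
  ... | no ¬∃ = inj₁ λ n ε 0<ε → decide n ε 0<ε lem
    where
    decide : ∀ n ε → 0# < ε → Dec (SmallAt ρ s n ε) → SmallAt ρ s n ε
    decide n ε 0<ε (yes at) = at
    decide n ε 0<ε (no ¬at) = contradiction (n , ε , 0<ε , ¬at) ¬∃
  ... | yes (m , δ , 0<δ , ¬at) = inj₂ second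
    where
    second : Small ρ′ s′
    second n ε 0<ε = case min₂ 0<δ 0<ε of λ { (d , 0<d , d≤δ , d≤ε) →
      [ (λ at → contradiction (smallAt-weaken (ℕ.m≤m+n m n) d≤δ at) ¬at) , smallAt-weaken (ℕ.m≤n+m n m) d≤ε ]′
        (either (m ℕ.+ n) d 0<d) }

  near-zero⇒small : ∀ {τ} → Sign τ → NearZero τ → Small 0# (τ * 1#) ⊎ Small ½ (τ * - 1#)
  near-zero⇒small {τ} sgn near = small-⊎ λ n ε 0<ε →
    case near-zero-beyond near n ε 0<ε of λ { (k , 1≤k , n≤k , 0<v , v<ε) →
    case near-0-or-½ k of λ
      { (t , ∣t∣≤¼ , z , inj₁ eq) → inj₁ (small-value⇒smallAt {z = z} phase-0 (sign-* sgn sign-plus) 1≤k n≤k ∣t∣≤¼ eq 0<v v<ε)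
      ; (t , ∣t∣≤¼ , z , inj₂ eq) → inj₂ (small-value⇒smallAt {z = z} phase-½ (sign-* sgn sign-minus) 1≤k n≤k ∣t∣≤¼ eq 0<v v<ε) } }

  Condition : Set
  Condition = (μ₊ α β 0# ≈± 0± × μ₋ α β 0# ≈± 0±)
            ⊎ (μ₊ α β 0# ≈± 0± × μ₊ α β ½ ≈± 0±)
            ⊎ (μ₋ α β 0# ≈± 0± × μ₋ α β ½ ≈± 0±)

  half-dense-cong : ∀ {κ κ′} → κ ≈ κ′ → HalfDense κ → HalfDense κ′
  half-dense-cong κ≈κ′ dense a b 0<a a<b = case dense a b 0<a a<b of λ { (k , 1≤k , a<v , v<b) →
    k , 1≤k , <-≤-trans a<v (inj₂ (*-congʳ κ≈κ′)) , ≤-<-trans (inj₂ (*-congʳ (≈-sym κ≈κ′))) v<b }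

  condition⇒dense : Condition → Dense Values
  condition⇒dense (inj₁ (μ₊≈0 , μ₋≈0)) = half-dense⇒dense
    (half-dense-cong (solve 0 (con (+ 1) :* con (+ 1) := con (+ 1))
            ≈-refl) (small⇒half-dense phase-0 sign-plus (μ₊≈0⇒small 0# μ₊≈0)))
    (half-dense-cong (solve 0 (con (+ 1) :* (:- (con (+ 1))) := (:- (con (+ 1))))
            ≈-refl) (small⇒half-dense phase-0 sign-minus (μ₋≈0⇒small 0# μ₋≈0)))
  condition⇒dense (inj₂ (inj₁ (μ₊≈0 , μ₊½≈0))) = half-dense⇒dense
    (half-dense-cong (solve 0 (con (+ 1) :* con (+ 1) := con (+ 1))
            ≈-refl) (small⇒half-dense phase-0 sign-plus (μ₊≈0⇒small 0# μ₊≈0)))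
    (half-dense-cong (solve 0 ((:- (con (+ 1))) :* con (+ 1) := (:- (con (+ 1))))
            ≈-refl) (small⇒half-dense phase-½ sign-plus (μ₊≈0⇒small ½ μ₊½≈0)))
  condition⇒dense (inj₂ (inj₂ (μ₋≈0 , μ₋½≈0))) = half-dense⇒dense
    (half-dense-cong (solve 0 ((:- (con (+ 1))) :* (:- (con (+ 1))) := con (+ 1))
            ≈-refl) (small⇒half-dense phase-½ sign-minus (μ₋≈0⇒small ½ μ₋½≈0)))
    (half-dense-cong (solve 0 (con (+ 1) :* (:- (con (+ 1))) := (:- (con (+ 1))))
            ≈-refl) (small⇒half-dense phase-0 sign-minus (μ₋≈0⇒small 0# μ₋≈0)))

  dense⇒condition : Dense Values → Condition
  dense⇒condition dense = combine
    (near-zero⇒small sign-plus (dense⇒near-zero₊ dense)) (near-zero⇒small sign-minus (dense⇒near-zero₋ dense))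
    where
    combine : Small 0# (1# * 1#) ⊎ Small ½ (1# * - 1#) → Small 0# (- 1# * 1#) ⊎ Small ½ (- 1# * - 1#) → Condition
    combine (inj₁ small₊) (inj₁ small₋) = inj₁
      ( small⇒μ₊≈0 0# (small-cong (solve 0 (con (+ 1) :* con (+ 1) := con (+ 1)) ≈-refl) small₊)
      , small⇒μ₋≈0 0# (small-cong (solve 0 ((:- (con (+ 1))) :* con (+ 1) := (:- (con (+ 1)))) ≈-refl) small₋))
    combine (inj₁ small₊) (inj₂ small₊½) = inj₂ (inj₁
      ( small⇒μ₊≈0 0# (small-cong (solve 0 (con (+ 1) :* con (+ 1) := con (+ 1)) ≈-refl) small₊)
      , small⇒μ₊≈0 ½ (small-cong (solve 0 ((:- (con (+ 1))) :* (:- (con (+ 1))) := con (+ 1)) ≈-refl) small₊½)))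
    -- Approximating ½ from below doubles to approximating 0 from below, so both halves of the third
    -- alternative come from the same data.
    combine (inj₂ small₋½) _ = inj₂ (inj₂
      ( small⇒μ₋≈0 0# (small-½⇒small-0 (small-cong (solve 0 (con (+ 1) :* (:- (con (+ 1))) := (:- (con (+ 1))))
              ≈-refl) small₋½))
      , small⇒μ₋≈0 ½ (small-cong (solve 0 (con (+ 1) :* (:- (con (+ 1))) := (:- (con (+ 1)))) ≈-refl) small₋½)))

corollary1 : (lem : ExcludedMiddle 0ℓ) (R : CompleteOrderedField) →
    let open CompleteOrderedField R
        open Analysis lem R
    in (β α : Carrier) → 0# < β → Irrational α →
       Dense (λ y → ∃ λ (k : ℕ) → 1 ℕ.≤ k × y ≈ fromℕ k ^ʳ β * sin (fromℕ 2 * π * fromℕ k * α))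
       ⇔
       ( (μ₊ α β 0# ≈± 0± × μ₋ α β 0# ≈± 0±)
       ⊎ (μ₊ α β 0# ≈± 0± × μ₊ α β ½ ≈± 0±)
       ⊎ (μ₋ α β 0# ≈± 0± × μ₋ α β ½ ≈± 0±))
corollary1 lem R β α 0<β _ = mk⇔ dense⇒condition condition⇒dense
  where open Corollary lem R β α 0<β
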